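{- Let $V$ be a model of set theory, $\kappa$ an infinite ordinal, $X\in V$ an infinite set and $\mathscr{L}\in V$ a relational language. Suppose $\mathcal{M}$ is Cohen generic on $X$ over $V$ for some strong Fraïssé class of $\mathscr{L}$-structures that is not highly homogeneous. Then $\mathcal{M}$ is not $\nu$-random generic over $V$ for any invariant measure $\nu\in V$ on $\mathrm{Str}^\kappa_{\mathscr{L}}(X)$. Similarly, if $\mathcal{M}$ is $\nu$-random generic over $V$ for some invariant measure $\nu\in V$ on $\mathrm{Str}^\kappa_{\mathscr{L}}(X)$, then $\mathcal{M}$ is not Cohen generic on $X$ over $V$ for any strong Fraïssé class of $\mathscr{L}$-structures that is not highly homogeneous.
   Context: A model of set theory is a transitive model of ZFC. Structures and measures: $\mathrm{Str}_{\mathscr{L}}(X)$ is the set of $\mathscr{L}$-structures with underlying set $X$. An $\mathscr{L}$-literal is an atomic formula or a (possibly iterated) negation of one. $\sigma_\kappa(\mathrm{Str}_{\mathscr{L}}(X))$ is the smallest family of subsets of $\mathrm{Str}_{\mathscr{L}}(X)$ closed under complements and under unions of size $\le\kappa$ and containing all sets $\{\mathcal{M}:\mathcal{M}\models\varphi(\bar a)\}$ for $\varphi$ a literal and $\bar a$ a tuple from $X$. $\mathrm{Str}^\kappa_{\mathscr{L}}(X)$ is $\mathrm{Str}_{\mathscr{L}}(X)$ with this family of measurable sets. A probability $\kappa$-measure on it is a probability measure $\mu$ with $\mu(\bigcup_{i\in\kappa}A_i)=\sum_{i\in\kappa}\mu(A_i)$ for pairwise disjoint measurable $A_i$. $\mathrm{Sym}(X)$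 acts by $g\mathcal{M}\models R(g(a_0),\dots)$ iff $\mathcal{M}\models R(a_0,\dots)$; "invariant measure" means a probability $\kappa$-measure $\mu$ with $\mu(g[A])=\mu(A)$ for all $g\in\mathrm{Sym}(X)$ and measurable $A$. Codes: the set $\mathbb{B}^\kappa_{\mathscr{L}:X}$ of $\kappa$-Borel codes is the smallest set containing the basic codes $\langle 0,\varphi,\bar a\rangle$ ($\varphi$ a finite conjunction of $\mathscr{L}$-literals, $\bar a$ a tuple from $X$) and closed under formal negation $\neg\gamma$ and formal $\bigvee\Gamma$, $\bigwedge\Gamma$ for $\Gamma=\{\gamma_i\}_{i\in\kappa}$. The interpretation $\mathrm{Int}(\gamma)\subseteq\mathrm{Str}_{\mathscr{L}}(X)$ interprets basic codes as $\{\mathcal{M}:\mathcal{M}\models\varphi(\bar a)\}$ and $\neg,\bigvee,\bigwedge$ as complement, union, intersection. $\mu(\gamma)=\mu(\mathrm{Int}(\gamma))$. Random generics: $\gamma\preceq_\mu\zeta$ means $\mu(\gamma\wedge\neg\zeta)=0$, and $\mathcal{O}^+(\mu)=(\{\gamma\in\mathbb{B}^\kappa_{\mathscr{L}:X}:\mu(\gamma)>0\},\preceq_\mu)$ (smaller is stronger), computed in $V$. For a filter $G$ on $\mathcal{O}^+(\mu)$ generic over $V$, there is a unique structure $\mathcal{M}_G$ with $V[G]\models\bigcap_{g\in G}\mathrm{Int}(g)=\{\mathcal{M}_G\}$; structures of this form are called $\mu$-random generic (over $V$). Cohen generics: a strong Fraïssé class is a class $\mathbf{K}$ of finite $\mathscr{L}$-structures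 closed under isomorphism and substructures (HP), such that any two members embed in a common member (JEP), and with strong amalgamation: for embeddings $i_1:\mathcal{M}_0\to\mathcal{M}_1$, $i_2:\mathcal{M}_0\to\mathcal{M}_2$ in $\mathbf{K}$ there are $\mathcal{M}_3\in\mathbf{K}$ and embeddings $j_1:\mathcal{M}_1\to\mathcal{M}_3$, $j_2:\mathcal{M}_2\to\mathcal{M}_3$ with $j_1 i_1=j_2 i_2$ and $j_1[M_1]\cap j_2[M_2]=j_1i_1[M_0]$. It is highly homogeneous if any two members of the same size are isomorphic. $\mathfrak{C}_X(\mathbf{K})$ is the partial order of members of $\mathbf{K}$ with underlying set a subset of $X$, with $\mathcal{A}\le\mathcal{B}$ ($\mathcal{A}$ stronger) iff $\mathcal{B}$ is a substructure of $\mathcal{A}$. A structure is Cohen generic for $\mathbf{K}$ on $X$ over $V$ ($\mathbf{K}$ in $V$) if it equals $\bigcup G$ for some filter $G$ on $\mathfrak{C}_X(\mathbf{K})$ generic over $V$. -}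

module Defs where

open import Level using (Lift; _⊔_) renaming (zero to 0ℓ; suc to lsuc)
open import Data.Bool.Base using (Bool; true; false)
open import Data.Empty using (⊥)
open import Data.Fin.Base using (Fin; toℕ)
open import Data.Integer.Base using (ℤ; +_; -[1+_])
open import Data.List.Base as List using (List; []; _∷_)
open import Data.List.Relation.Unary.All as ListAll using ()
open import Data.List.Relation.Unary.AllPairs using (AllPairs)
open import Data.Maybe.Base using (Maybe; just; nothing)
open import Data.Nat.Base using (ℕ; zero; suc)
open import Data.Product using (_×_; ∃; ∃-syntax; _,_)
open import Data.Rational.Base using (ℚ; mkℚ; 0ℚ; 1ℚ; _+_; _<_)
open import Data.Sum.Base using (_⊎_)
open import Data.Vec.Base as Vec using (Vec; []; _∷_)
open import Data.Vec.Relation.Unary.All as VecAll using ()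
open import Data.Vec.Relation.Binary.Pointwise.Inductive using (Pointwise)
open import Function.Bundles using (_⇔_)
open import Relation.Binary.PropositionalEquality.Core using (_≡_)
open import Relation.Nullary.Negation.Core using (¬_)

-- The ambient universe of sets (Aczel's cumulative hierarchy).  Equality
-- of sets is _≐_ (extensional equality), never _≡_.

data 𝕍 : Set₁ where
  sup : (A : Set) → (A → 𝕍) → 𝕍

infix 4 _≐_ _∈_ _⊆_

_≐_ : 𝕍 → 𝕍 → Set
sup A f ≐ sup B g = (∀ a → ∃[ b ] (f a ≐ g b)) × (∀ b → ∃[ a ] (f a ≐ g b))

_∈_ : 𝕍 → 𝕍 → Set
x ∈ sup A f = ∃[ a ] (x ≐ f a)

_⊆_ : 𝕍 → 𝕍 → Set₁
x ⊆ y = ∀ z → z ∈ x → z ∈ y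

∅ : 𝕍
∅ = sup ⊥ λ ()

⁅_,_⁆ : 𝕍 → 𝕍 → 𝕍
⁅ x , y ⁆ = sup Bool λ { true → x ; false → y }

-- Kuratowski pairs
⟨_,_⟩ : 𝕍 → 𝕍 → 𝕍
⟨ x , y ⟩ = ⁅ ⁅ x , x ⁆ , ⁅ x , y ⁆ ⁆

succ : 𝕍 → 𝕍
succ (sup A f) = sup (Maybe A) λ { (just a) → f a ; nothing → sup A f }

num : ℕ → 𝕍
num zero    = ∅
num (suc n) = succ (num n)

ω : 𝕍
ω = sup ℕ num

-- Finite sequences as iterated pairs ending in ∅.
tuple : ∀ {n} → Vec 𝕍 n → 𝕍
tuple []       = ∅
tuple (x ∷ xs) = ⟨ x , tuple xs ⟩

Class : Set₂
Class = 𝕍 → Set₁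

-- First-order formulas of set theory (de Bruijn), and satisfaction in
-- the structure (V, ∈).  They are needed for the axiom schemes and for
-- definable classes; all other notions "in V" are written out with
-- their quantifiers relativised to V.

data Fml : ℕ → Set where
  _∈̇_ _≐̇_     : ∀ {n} → Fin n → Fin n → Fml n
  ⊥̇           : ∀ {n} → Fml n
  _∧̇_ _∨̇_ _⇒̇_ : ∀ {n} → Fml n → Fml n → Fml n
  ∀̇_ ∃̇_       : ∀ {n} → Fml (suc n) → Fml n

Sat : Class → ∀ {n} → Fml n → Vec 𝕍 n → Set₁
Sat V (i ∈̇ j) ρ = Lift _ (Vec.lookup ρ i ∈ Vec.lookup ρ j)
Sat V (i ≐̇ j) ρ = Lift _ (Vec.lookup ρ i ≐ Vec.lookup ρ j)
Sat V ⊥̇       ρ = Lift _ ⊥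
Sat V (φ ∧̇ ψ) ρ = Sat V φ ρ × Sat V ψ ρ
Sat V (φ ∨̇ ψ) ρ = Sat V φ ρ ⊎ Sat V ψ ρ
Sat V (φ ⇒̇ ψ) ρ = Sat V φ ρ → Sat V ψ ρ
Sat V (∀̇ φ)   ρ = ∀ x → V x → Sat V φ (x ∷ ρ)
Sat V (∃̇ φ)   ρ = ∃[ x ] V x × Sat V φ (x ∷ ρ)

-- Definable over (V, ∈) with parameters from V: a "class in V".
Definable : Class → Class → Set₁
Definable V K =
  ∃[ n ] ∃[ φ ] ∃[ ρ ] VecAll.All V {n} ρ ×
    (∀ x → K x ⇔ (V x × Sat V {suc n} φ (x ∷ ρ)))

-- Transitive models of ZFC; set models and class models are both
-- covered.
record IsTransitiveModel (V : Class) : Set₁ where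
  field
    respects   : ∀ x y → x ≐ y → V x → V y
    transitive : ∀ x y → y ∈ x → V x → V y

    extensionality : ∀ x y → V x → V y →
      (∀ z → V z → z ∈ x ⇔ z ∈ y) → x ≐ y
    foundation : ∀ x → V x → (∃[ y ] V y × y ∈ x) →
      ∃[ y ] V y × y ∈ x × (∀ z → V z → z ∈ y → ¬ (z ∈ x))
    pairing : ∀ x y → V x → V y →
      ∃[ p ] V p × (∀ z → V z → z ∈ p ⇔ (z ≐ x ⊎ z ≐ y))
    union : ∀ x → V x →
      ∃[ u ] V u × (∀ z → V z → z ∈ u ⇔ (∃[ y ] V y × y ∈ x × z ∈ y))
    powerset : ∀ x → V x →
      ∃[ p ] V p × (∀ y → V y → y ∈ p ⇔ (∀ z → V z → z ∈ y → z ∈ x))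
    infinity :
      ∃[ w ] V w
        × (∃[ e ] V e × e ∈ w × (∀ z → V z → ¬ (z ∈ e)))
        × (∀ x → V x → x ∈ w →
             ∃[ s ] V s × s ∈ w × (∀ z → V z → z ∈ s ⇔ (z ∈ x ⊎ z ≐ x)))
    separation : ∀ {n} (φ : Fml (suc n)) ρ → VecAll.All V ρ → ∀ a → V a →
      ∃[ b ] V b × (∀ x → V x → x ∈ b ⇔ (x ∈ a × Sat V φ (x ∷ ρ)))
    replacement : ∀ {n} (φ : Fml (suc (suc n))) ρ → VecAll.All V ρ →
      ∀ a → V a →
      (∀ x → V x → x ∈ a →
         ∃[ y ] V y × Sat V φ (y ∷ x ∷ ρ)
           × (∀ y′ → V y′ → Sat V φ (y′ ∷ x ∷ ρ) → y′ ≐ y)) →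
      ∃[ b ] V b ×
        (∀ y → V y → y ∈ b ⇔ (∃[ x ] V x × x ∈ a × Sat V φ (y ∷ x ∷ ρ)))
    choice : ∀ a → V a →
      (∀ x → V x → x ∈ a → ∃[ y ] V y × y ∈ x) →
      (∀ x y z → V x → V y → V z → x ∈ a → y ∈ a → z ∈ x → z ∈ y → x ≐ y) →
      ∃[ c ] V c × (∀ x → V x → x ∈ a →
        ∃[ y ] V y × y ∈ x × y ∈ c
          × (∀ y′ → V y′ → y′ ∈ x → y′ ∈ c → y′ ≐ y))

-- f is (the graph of) a function from the set A to the class B.
IsMap : ∀ {ℓ} → 𝕍 → 𝕍 → (𝕍 → Set ℓ) → Set (lsuc 0ℓ ⊔ ℓ)
IsMap f A B =
  (∀ z → z ∈ f → ∃[ x ] ∃[ y ] z ≐ ⟨ x , y ⟩ × x ∈ A × B y)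
  × (∀ x → x ∈ A → ∃[ y ] ⟨ x , y ⟩ ∈ f)
  × (∀ x y y′ → ⟨ x , y ⟩ ∈ f → ⟨ x , y′ ⟩ ∈ f → y ≐ y′)

IsInjection : 𝕍 → 𝕍 → 𝕍 → Set₁
IsInjection f A B =
  IsMap f A (_∈ B) × (∀ x x′ y → ⟨ x , y ⟩ ∈ f → ⟨ x′ , y ⟩ ∈ f → x ≐ x′)

IsSurjection : 𝕍 → 𝕍 → 𝕍 → Set₁
IsSurjection f A B =
  IsMap f A (_∈ B) × (∀ y → y ∈ B → ∃[ x ] ⟨ x , y ⟩ ∈ f)

IsBijection : 𝕍 → 𝕍 → 𝕍 → Set₁
IsBijection f A B = IsInjection f A B × IsSurjection f A B

Equinumerous : Class → 𝕍 → 𝕍 → Set₁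
Equinumerous V A B = ∃[ f ] V f × IsBijection f A B

Finite Infinite : Class → 𝕍 → Set₁
Finite V A = ∃[ n ] Equinumerous V (num n) A
Infinite V A = ¬ Finite V A

IsTransitive : 𝕍 → Set₁
IsTransitive x = ∀ y → y ∈ x → y ⊆ x

IsOrdinal : 𝕍 → Set₁
IsOrdinal x = IsTransitive x × (∀ y → y ∈ x → IsTransitive y)

-- Relational languages and structures.  A language is the function
-- sending each of its relation symbols to its arity.  The structure with
-- underlying set A in which R(v) holds exactly for the pairs (R, v) in
-- the set ⟦ ⟧ = { ⟨ R , tuple v ⟩ : R(v) holds } is the set ⟨ A , ⟦ ⟧ ⟩.

IsLanguage : 𝕍 → Set₁
IsLanguage L = ∃[ S ] IsMap L S (_∈ ω)

Arity : 𝕍 → 𝕍 → ℕ → Set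
Arity L R n = ⟨ R , num n ⟩ ∈ L

IsStr : 𝕍 → 𝕍 → 𝕍 → Set₁
IsStr L A M =
  ∃[ I ] M ≐ ⟨ A , I ⟩ ×
    (∀ z → z ∈ I → ∃[ R ] ∃[ n ] ∃[ v ]
       Arity L R n × VecAll.All (_∈ A) {n} v × z ≐ ⟨ R , tuple v ⟩)

Holds : 𝕍 → 𝕍 → ∀ {n} → Vec 𝕍 n → Set₁
Holds M R v = ∃[ A ] ∃[ I ] M ≐ ⟨ A , I ⟩ × ⟨ R , tuple v ⟩ ∈ I

-- M ⊨ R(a₀,…) iff N ⊨ R(f(a₀),…)
Preserves : 𝕍 → 𝕍 → 𝕍 → 𝕍 → Set₁
Preserves L f M N =
  ∀ R {n} (v w : Vec 𝕍 n) → Arity L R n →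
  Pointwise (λ a b → ⟨ a , b ⟩ ∈ f) v w → Holds M R v ⇔ Holds N R w

IsEmbedding : 𝕍 → 𝕍 → 𝕍 → 𝕍 → Set₁
IsEmbedding L f M N =
  ∃[ A ] ∃[ B ] IsStr L A M × IsStr L B N × IsInjection f A B × Preserves L f M N

IsIsomorphism : 𝕍 → 𝕍 → 𝕍 → 𝕍 → Set₁
IsIsomorphism L f M N =
  ∃[ A ] ∃[ B ] IsStr L A M × IsStr L B N × IsBijection f A B × Preserves L f M N

Embeds Isomorphic : Class → 𝕍 → 𝕍 → 𝕍 → Set₁
Embeds     V L M N = ∃[ f ] V f × IsEmbedding L f M N
Isomorphic V L M N = ∃[ f ] V f × IsIsomorphism L f M N

IsSubstructure : 𝕍 → 𝕍 → 𝕍 → Set₁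
IsSubstructure L M N =
  ∃[ A ] ∃[ B ] IsStr L A M × IsStr L B N × A ⊆ B ×
    (∀ R {n} (v : Vec 𝕍 n) → Arity L R n → VecAll.All (_∈ A) v →
       Holds M R v ⇔ Holds N R v)

-- Str_L(X) as computed in V
Str : Class → 𝕍 → 𝕍 → Class
Str V L X M = V M × IsStr L X M

data Atomic (L : 𝕍) (k : ℕ) : Set₁ where
  eq  : Fin k → Fin k → Atomic L k
  rel : (R : 𝕍) (n : ℕ) → Arity L R n → Vec (Fin k) n → Atomic L k

data Literal (L : 𝕍) (k : ℕ) : Set₁ where
  atom : Atomic L k → Literal L k
  neg  : Literal L k → Literal L k

⊨ᵃ : ∀ {L k} → 𝕍 → Atomic L k → Vec 𝕍 k → Set₁
⊨ᵃ M (eq i j)       v = Lift _ (Vec.lookup v i ≐ Vec.lookup v j)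
⊨ᵃ M (rel R n _ is) v = Holds M R (Vec.map (Vec.lookup v) is)

⊨ˡ : ∀ {L k} → 𝕍 → Literal L k → Vec 𝕍 k → Set₁
⊨ˡ M (atom α) v = ⊨ᵃ M α v
⊨ˡ M (neg φ)  v = ¬ ⊨ˡ M φ v

⊨ᶜ : ∀ {L k} → 𝕍 → List (Literal L k) → Vec 𝕍 k → Set₁
⊨ᶜ M φs v = ListAll.All (λ φ → ⊨ˡ M φ v) φs

⌜_⌝ᵃ : ∀ {L k} → Atomic L k → 𝕍
⌜ eq i j ⌝ᵃ       = ⟨ num 0 , ⟨ num (toℕ i) , num (toℕ j) ⟩ ⟩
⌜ rel R n _ is ⌝ᵃ = ⟨ num 1 , ⟨ R , tuple (Vec.map (λ i → num (toℕ i)) is) ⟩ ⟩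

⌜_⌝ˡ : ∀ {L k} → Literal L k → 𝕍
⌜ atom α ⌝ˡ = ⌜ α ⌝ᵃ
⌜ neg φ ⌝ˡ  = ⟨ num 2 , ⌜ φ ⌝ˡ ⟩

⌜_⌝ᶜ : ∀ {L k} → List (Literal L k) → 𝕍
⌜ φs ⌝ᶜ = tuple (Vec.fromList (List.map ⌜_⌝ˡ φs))

basicᶜ : ∀ {L k} → List (Literal L k) → Vec 𝕍 k → 𝕍
basicᶜ φ v = ⟨ num 0 , ⟨ ⌜ φ ⌝ᶜ , tuple v ⟩ ⟩

¬ᶜ_ ⋁ᶜ_ ⋀ᶜ_ : 𝕍 → 𝕍
¬ᶜ γ = ⟨ num 1 , γ ⟩
⋁ᶜ Γ = ⟨ num 2 , Γ ⟩
⋀ᶜ Γ = ⟨ num 3 , Γ ⟩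

_∧ᶜ_ : 𝕍 → 𝕍 → 𝕍
γ ∧ᶜ ζ = ⋀ᶜ ⁅ γ , ζ ⁆

-- The codes of V are the γ in V with IsCode V κ L X γ: being a code is
-- an inductive, hence absolute, notion once the enumerations Γ = {γᵢ}_{i∈κ}
-- are required to be in V.
data IsCode (V : Class) (κ L X : 𝕍) (γ : 𝕍) : Set₁ where
  basic : ∀ {k} (φ : List (Literal L k)) (v : Vec 𝕍 k) → VecAll.All (_∈ X) v →
          γ ≐ basicᶜ φ v → IsCode V κ L X γ
  neg   : ∀ δ → γ ≐ (¬ᶜ δ) → IsCode V κ L X δ → IsCode V κ L X γ
  join  : ∀ Γ → γ ≐ (⋁ᶜ Γ) → (∃[ f ] V f × IsSurjection f κ Γ) →
          (∀ δ → δ ∈ Γ → IsCode V κ L X δ) → IsCode V κ L X γ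
  meet  : ∀ Γ → γ ≐ (⋀ᶜ Γ) → (∃[ f ] V f × IsSurjection f κ Γ) →
          (∀ δ → δ ∈ Γ → IsCode V κ L X δ) → IsCode V κ L X γ

-- Membership in Int(γ) is absolute: Int(γ) computed in V or in V[G] is
-- the set of structures M on X in V or V[G] with M ∈Int d, for any
-- derivation d that γ is a code.
_∈Int_ : ∀ {V κ L X γ} → 𝕍 → IsCode V κ L X γ → Set₁
M ∈Int basic φ v _ _ = ⊨ᶜ M φ v
M ∈Int neg _ _ d     = ¬ (M ∈Int d)
M ∈Int join Γ _ _ ds = ∃[ δ ] ∃[ δ∈Γ ] (M ∈Int ds δ δ∈Γ)
M ∈Int meet Γ _ _ ds = ∀ δ (δ∈Γ : δ ∈ Γ) → M ∈Int ds δ δ∈Γ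

-- The measurable sets σ_κ(Str_L(X)), computed in V

IsSigmaClosed : Class → 𝕍 → 𝕍 → 𝕍 → 𝕍 → Set₁
IsSigmaClosed V κ L X 𝒮 =
  (∀ A → A ∈ 𝒮 → ∀ M → M ∈ A → Str V L X M)
  × (∀ {k} (φ : Literal L k) v → VecAll.All (_∈ X) v → ∀ A → V A →
       (∀ M → M ∈ A ⇔ (Str V L X M × ⊨ˡ M φ v)) → A ∈ 𝒮)
  × (∀ A B → V B → A ∈ 𝒮 →
       (∀ M → M ∈ B ⇔ (Str V L X M × ¬ (M ∈ A))) → B ∈ 𝒮)
  × (∀ 𝒜 U → V 𝒜 → V U → 𝒜 ⊆ 𝒮 → (∃[ f ] V f × IsInjection f 𝒜 κ) →
       (∀ M → M ∈ U ⇔ (∃[ A ] A ∈ 𝒜 × M ∈ A)) → U ∈ 𝒮)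

IsSigma : Class → 𝕍 → 𝕍 → 𝕍 → 𝕍 → Set₁
IsSigma V κ L X 𝒮 =
  V 𝒮 × IsSigmaClosed V κ L X 𝒮 × (∀ 𝒯 → V 𝒯 → IsSigmaClosed V κ L X 𝒯 → 𝒮 ⊆ 𝒯)

-- Real numbers, as sets of rationals: r is identified with {q : q < r}.

⌜_⌝ℤ : ℤ → 𝕍
⌜ + n ⌝ℤ      = ⟨ num 0 , num n ⟩
⌜ -[1+ n ] ⌝ℤ = ⟨ num 1 , num n ⟩

⌜_⌝ℚ : ℚ → 𝕍
⌜ mkℚ a b _ ⌝ℚ = ⟨ ⌜ a ⌝ℤ , num b ⟩

_<ᴿ_ : ℚ → 𝕍 → Set
q <ᴿ r = ⌜ q ⌝ℚ ∈ r

IsReal : 𝕍 → Set₁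
IsReal r =
  (∀ z → z ∈ r → ∃[ q ] z ≐ ⌜ q ⌝ℚ)
  × (∃[ q ] q <ᴿ r)
  × (∃[ q ] ¬ (q <ᴿ r))
  × (∀ p q → p < q → q <ᴿ r → p <ᴿ r)
  × (∀ p → p <ᴿ r → ∃[ q ] p < q × q <ᴿ r)

IsRational : 𝕍 → ℚ → Set
IsRational r p = ∀ q → q <ᴿ r ⇔ q < p

-- Measures; ν is the set of pairs ⟨ A , ν(A) ⟩.

-- q < ν(f(i₁)) + … + ν(f(iₘ)), as sums of cuts
BelowSum : 𝕍 → 𝕍 → List 𝕍 → ℚ → Set₁
BelowSum ν f []       q = Lift _ (q < 0ℚ)
BelowSum ν f (i ∷ is) q =
  ∃[ A ] ∃[ r ] ∃[ s ] ∃[ t ] ⟨ i , A ⟩ ∈ f × ⟨ A , r ⟩ ∈ ν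
    × s <ᴿ r × BelowSum ν f is t × q ≡ s + t

-- Additivity for disjoint families (in V) indexed by ι.  The sum of
-- non-negative reals over ι is the supremum of its finite subsums.
Additive : Class → 𝕍 → 𝕍 → 𝕍 → Set₁
Additive V 𝒮 ν ι =
  ∀ f U r → V f → IsMap f ι (_∈ 𝒮) →
  (∀ i j A B M → ⟨ i , A ⟩ ∈ f → ⟨ j , B ⟩ ∈ f → ¬ (i ≐ j) →
     M ∈ A → ¬ (M ∈ B)) →
  V U → (∀ M → M ∈ U ⇔ (∃[ i ] ∃[ A ] ⟨ i , A ⟩ ∈ f × M ∈ A)) →
  ⟨ U , r ⟩ ∈ ν →
  ∀ q → q <ᴿ r ⇔
    (∃[ is ] ListAll.All (_∈ ι) is × AllPairs (λ i j → ¬ (i ≐ j)) is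
             × BelowSum ν f is q)

record IsProbabilityMeasure (V : Class) (κ L X ν : 𝕍) : Set₁ where
  field
    𝒮           : 𝕍
    isSigma     : IsSigma V κ L X 𝒮
    inV         : V ν
    isMap       : IsMap ν 𝒮 IsReal
    nonNegative : ∀ A r q → ⟨ A , r ⟩ ∈ ν → q < 0ℚ → q <ᴿ r
    total       : ∃[ A ] ∃[ r ] (∀ M → M ∈ A ⇔ Str V L X M)
                    × ⟨ A , r ⟩ ∈ ν × IsRational r 1ℚ
    ω-additive  : Additive V 𝒮 ν ω
    κ-additive  : Additive V 𝒮 ν κ

-- Since gM is the structure on X with gM ⊨ R(g(a₀),…) iff M ⊨ R(a₀,…),
-- N = gM is expressed by Preserves L g M N.
record IsInvariantMeasure (V : Class) (κ L X ν : 𝕍) : Set₁ where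
  field
    isProbabilityMeasure : IsProbabilityMeasure V κ L X ν
    invariant : ∀ g A B r → V g → IsBijection g X X → ⟨ A , r ⟩ ∈ ν → V B →
      (∀ N → N ∈ B ⇔
        (Str V L X N × (∃[ M ] M ∈ A × Preserves L g M N))) →
      ⟨ B , r ⟩ ∈ ν

CodeMeasure : ∀ {V κ L X γ} → 𝕍 → IsCode V κ L X γ → 𝕍 → Set₁
CodeMeasure {V} {κ} {L} {X} ν d r =
  ∃[ A ] V A × (∀ M → M ∈ A ⇔ (Str V L X M × M ∈Int d)) × ⟨ A , r ⟩ ∈ ν

-- Forcing.  A partial order is given by its underlying set P and the set
-- E of pairs ⟨ p , q ⟩ with p ≤ q (p stronger than q).

IsGenericFilter : Class → 𝕍 → 𝕍 → 𝕍 → Set₁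
IsGenericFilter V P E G =
  G ⊆ P
  × (∃[ p ] p ∈ G)
  × (∀ p q → p ∈ G → q ∈ P → ⟨ p , q ⟩ ∈ E → q ∈ G)
  × (∀ p q → p ∈ G → q ∈ G → ∃[ r ] r ∈ G × ⟨ r , p ⟩ ∈ E × ⟨ r , q ⟩ ∈ E)
  × (∀ D → V D → D ⊆ P →
       (∀ p → p ∈ P → ∃[ d ] d ∈ D × ⟨ d , p ⟩ ∈ E) →
       ∃[ p ] p ∈ D × p ∈ G)

data IsName (P τ : 𝕍) : Set₁ where
  name : (∀ z → z ∈ τ →
            ∃[ σ ] ∃[ p ] z ≐ ⟨ σ , p ⟩ × p ∈ P × IsName P σ) →
         IsName P τ

-- x = val_G(τ) = { val_G(σ) : ⟨ σ , p ⟩ ∈ τ for some p ∈ G }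
data Val (G τ x : 𝕍) : Set₁ where
  val : (∀ σ p → ⟨ σ , p ⟩ ∈ τ → p ∈ G → ∃[ y ] y ∈ x × Val G σ y) →
        (∀ y → y ∈ x → ∃[ σ ] ∃[ p ] ⟨ σ , p ⟩ ∈ τ × p ∈ G × Val G σ y) →
        Val G τ x

-- The elements of V[G], for G a filter on P
_[_,_] : Class → 𝕍 → 𝕍 → Class
(V [ P , G ]) x = ∃[ τ ] V τ × IsName P τ × Val G τ x

-- (P, E) is O⁺(ν), computed in V.
IsRandomPoset : Class → 𝕍 → 𝕍 → 𝕍 → 𝕍 → 𝕍 → 𝕍 → Set₁
IsRandomPoset V κ L X ν P E =
  V P × V E
  × (∀ γ → γ ∈ P ⇔
       (V γ × (∃[ d ] ∃[ r ] CodeMeasure {V} {κ} {L} {X} {γ} ν d r × 0ℚ <ᴿ r)))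
  × (∀ z → z ∈ E ⇔
       (∃[ γ ] ∃[ ζ ] z ≐ ⟨ γ , ζ ⟩ × γ ∈ P × ζ ∈ P ×
          (∃[ d ] ∃[ r ] CodeMeasure {V} {κ} {L} {X} {γ ∧ᶜ (¬ᶜ ζ)} ν d r
                         × IsRational r 0ℚ)))

-- The last clause says V[G] ⊨ ⋂_{g∈G} Int(g) = {M}.
IsRandomGeneric : Class → 𝕍 → 𝕍 → 𝕍 → 𝕍 → 𝕍 → Set₁
IsRandomGeneric V κ L X ν M =
  ∃[ P ] ∃[ E ] ∃[ G ]
    IsRandomPoset V κ L X ν P E
    × IsGenericFilter V P E G
    × (V [ P , G ]) M
    × (∀ N → (V [ P , G ]) N →
         (IsStr L X N × (∀ g → g ∈ G → (d : IsCode V κ L X g) → N ∈Int d))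
           ⇔ N ≐ M)

record IsStrongFraisse (V : Class) (L : 𝕍) (K : Class) : Set₁ where
  field
    definable  : Definable V K
    structures : ∀ M → K M → ∃[ A ] IsStr L A M × Finite V A
    isoClosed  : ∀ M N → K M → V N → Isomorphic V L M N → K N
    hereditary : ∀ M N → K N → V M → IsSubstructure L M N → K M
    jointEmbedding : ∀ M N → K M → K N →
      ∃[ P ] K P × Embeds V L M P × Embeds V L N P
    strongAmalgamation : ∀ M₀ M₁ M₂ i₁ i₂ → K M₀ → K M₁ → K M₂ →
      V i₁ → V i₂ → IsEmbedding L i₁ M₀ M₁ → IsEmbedding L i₂ M₀ M₂ →
      ∃[ M₃ ] ∃[ j₁ ] ∃[ j₂ ] K M₃ × V j₁ × V j₂
        × IsEmbedding L j₁ M₁ M₃ × IsEmbedding L j₂ M₂ M₃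
        × (∀ w x y z z′ → ⟨ w , x ⟩ ∈ i₁ → ⟨ x , z ⟩ ∈ j₁ →
             ⟨ w , y ⟩ ∈ i₂ → ⟨ y , z′ ⟩ ∈ j₂ → z ≐ z′)
        × (∀ z → ((∃[ x ] ⟨ x , z ⟩ ∈ j₁) × (∃[ y ] ⟨ y , z ⟩ ∈ j₂))
                   ⇔ (∃[ w ] ∃[ x ] ⟨ w , x ⟩ ∈ i₁ × ⟨ x , z ⟩ ∈ j₁))

IsHighlyHomogeneous : Class → 𝕍 → Class → Set₁
IsHighlyHomogeneous V L K =
  ∀ M N A B → K M → K N → IsStr L A M → IsStr L B N →
  Equinumerous V A B → Isomorphic V L M N

-- (P, E) is ℭ_X(K), computed in V.
IsCohenPoset : Class → 𝕍 → 𝕍 → Class → 𝕍 → 𝕍 → Set₁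
IsCohenPoset V L X K P E =
  V P × V E
  × (∀ p → p ∈ P ⇔ (K p × (∃[ A ] IsStr L A p × A ⊆ X)))
  × (∀ z → z ∈ E ⇔
       (∃[ p ] ∃[ q ] z ≐ ⟨ p , q ⟩ × p ∈ P × q ∈ P × IsSubstructure L q p))

IsUnion : 𝕍 → 𝕍 → Set₁
IsUnion G M =
  ∃[ U ] ∃[ I ] M ≐ ⟨ U , I ⟩
    × (∀ x → x ∈ U ⇔ (∃[ p ] ∃[ A ] ∃[ J ] p ∈ G × p ≐ ⟨ A , J ⟩ × x ∈ A))
    × (∀ x → x ∈ I ⇔ (∃[ p ] ∃[ A ] ∃[ J ] p ∈ G × p ≐ ⟨ A , J ⟩ × x ∈ J))

IsCohenGeneric : Class → 𝕍 → 𝕍 → Class → 𝕍 → Set₁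
IsCohenGeneric V L X K M =
  ∃[ P ] ∃[ E ] ∃[ G ]
    IsCohenPoset V L X K P E × IsGenericFilter V P E G × IsUnion G M

{-# OPTIONS --safe #-}

-- If K is not highly homogeneous, some R holds at a tuple of one member of K and fails at the corresponding tuple of another.
-- Fix in V distinct points of X, arranged in rows of disjoint blocks, each block carrying a copy of these tuples, and let Run k k
-- say that R holds on the first k blocks of row k and fails on the next one.  Strong amalgamation over the empty structure
-- extends every Cohen condition to one forcing Run k k for some large k, so a Cohen generic satisfies infinitely many Run k k.
-- For an invariant measure, exchanging row k with row 0 gives Run k k the probability that row 0 fails R first at block k.
-- These events are disjoint, so the probabilities are summable and, by Borel-Cantelli, the limit superior of Run k k is null.
-- It has a Borel code in V, hence a random generic avoids it.

module Submission where

open import Defs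
open import Level using (Level; Lift; lift; lower; _⊔_) renaming (zero to 0ℓ; suc to lsuc)
open import Data.Product using (_×_; ∃-syntax; Σ; _,_; proj₁; proj₂)
open import Relation.Nullary.Negation.Core using (¬_)
open import Axiom.ExcludedMiddle using (ExcludedMiddle)
open import Data.Bool.Base using (true; false)
open import Data.Empty using (⊥-elim)
open import Data.Fin.Base using (Fin; zero; suc; toℕ; fromℕ<; _↑ʳ_)
import Data.Fin.Properties as Fin
open import Data.Integer.Base as ℤ using (+_; -[1+_])
import Data.Integer.Properties as ℤ
open import Data.Integer.Tactic.RingSolver using (solve-∀)
open import Data.List.Base as List using (List; []; _∷_; _++_)
open import Data.List.Relation.Unary.All as ListAll using ([]; _∷_)
open import Data.List.Relation.Unary.AllPairs as AllPairs using (AllPairs; []; _∷_)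
import Data.List.Relation.Unary.AllPairs.Properties as AllPairs
open import Data.Maybe.Base using (just; nothing)
open import Data.Nat.Base as ℕ using (ℕ; zero; suc; z≤n; s≤s)
import Data.Nat.Properties as ℕ
open import Data.Rational.Base as ℚ using (ℚ; mkℚ; 0ℚ; 1ℚ; toℚᵘ)
import Data.Rational.Properties as ℚ
open import Data.Rational.Unnormalised.Base as ℚᵘ using (mkℚᵘ; *≡*; *<*)
import Data.Rational.Unnormalised.Properties as ℚᵘ
open import Data.Sum.Base using (_⊎_; inj₁; inj₂; [_,_]′)
open import Data.Vec.Base as Vec using (Vec; []; _∷_; lookup; tabulate)
import Data.Vec.Properties as Vec
open import Data.Vec.Relation.Binary.Pointwise.Inductive as PW using (Pointwise; []; _∷_)
open import Data.Vec.Relation.Unary.All as VecAll using ([]; _∷_)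
open import Function.Base using (_∘_; id; case_of_)
open import Function.Bundles using (_⇔_; mk⇔; Equivalence)
open import Relation.Binary.Definitions using (tri<; tri≈; tri>)
open import Relation.Binary.PropositionalEquality using (_≡_; refl; sym; trans; cong; cong₂; subst; subst₂)
open import Relation.Nullary.Decidable.Core using (Dec; yes; no)

open Equivalence using (to; from)

-- No independence between rows is available, and none is used. Invariance compares each row with
-- row 0 only; because the length of the run grows with the row, the events carried to row 0 cannot
-- occur together, whatever the measure is. The failure that ends a run is essential for this: its
-- positive part alone would give nested events instead of disjoint ones.
--
-- The obstacle that shapes the development is that V is an arbitrary transitive model.
-- Permutations, measurable sets, codes and dense sets count only if they belong to V, and
-- additivity applies only to sequences in V. Every infinite object (points, rows, events, codes) is
-- therefore described outside V together with a formula that defines it, and replacement brings it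
-- into V. A generic structure need not belong to V, so the events are predicates of arbitrary
-- structures: a code transfers them to the random generic, and a dense set in V to the Cohen
-- generic.

private variable
  ℓ ℓ′ : Level
  n : ℕ

-- Equality, pairs and numerals in the cumulative hierarchy.

⇔-sym : {P : Set ℓ} {Q : Set ℓ′} → P ⇔ Q → Q ⇔ P
⇔-sym e = mk⇔ (from e) (to e)

≐-refl : ∀ x → x ≐ x
≐-refl (sup I f) = (λ i → i , ≐-refl (f i)) , (λ i → i , ≐-refl (f i))

≐-sym : ∀ {x y} → x ≐ y → y ≐ x
≐-sym {sup I f} {sup J g} (h , k) =
  (λ j → proj₁ (k j) , ≐-sym (proj₂ (k j))) , (λ i → proj₁ (h i) , ≐-sym (proj₂ (h i)))

≐-trans : ∀ {x y z} → x ≐ y → y ≐ z → x ≐ z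
≐-trans {sup I f} {sup J g} {sup K h} (p , p′) (q , q′) =
  (λ i → let j , e = p i ; k , e′ = q j in k , ≐-trans e e′) ,
  (λ k → let j , e = q′ k ; i , e′ = p′ j in i , ≐-trans e′ e)

≡⇒≐ : ∀ {x y} → x ≡ y → x ≐ y
≡⇒≐ {x} refl = ≐-refl x

∈-respˡ : ∀ {x y z} → x ≐ y → x ∈ z → y ∈ z
∈-respˡ {z = sup I f} e (i , e′) = i , ≐-trans (≐-sym e) e′

∈-respʳ : ∀ {x y z} → y ≐ z → x ∈ y → x ∈ z
∈-respʳ {y = sup I f} {sup J g} (p , _) (i , e) = let j , e′ = p i in j , ≐-trans e e′

ext : ∀ {x y} → (∀ z → z ∈ x → z ∈ y) → (∀ z → z ∈ y → z ∈ x) → x ≐ y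
ext {sup I f} {sup J g} p q =
  (λ i → p (f i) (i , ≐-refl _)) , (λ j → let i , e = q (g j) (j , ≐-refl _) in i , ≐-sym e)

elem : (I : Set) (f : I → 𝕍) (i : I) → f i ∈ sup I f
elem I f i = i , ≐-refl (f i)

∈-induction : (P : 𝕍 → Set ℓ) → (∀ x → (∀ y → y ∈ x → P y) → P x) → ∀ x → P x
∈-induction P step x = go x x (≐-refl x)
  where
  -- `P` need not respect `≐`, while the recursion descends along the tree `x`; so all `y` equal to
  -- it are treated at once.
  go : ∀ x y → y ≐ x → P y
  go (sup I f) y e = step y λ z z∈y → let i , e′ = ∈-respʳ e z∈y in go (f i) z e′

∈-irrefl : ∀ x → ¬ (x ∈ x)
∈-irrefl = ∈-induction _ λ x ih x∈x → ih x x∈x x∈x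

∈⁅⁆⁻ : ∀ {x a b} → x ∈ ⁅ a , b ⁆ → x ≐ a ⊎ x ≐ b
∈⁅⁆⁻ (true  , e) = inj₁ e
∈⁅⁆⁻ (false , e) = inj₂ e

∈⁅⁆ˡ : ∀ {x a b} → x ≐ a → x ∈ ⁅ a , b ⁆
∈⁅⁆ˡ e = true , e

∈⁅⁆ʳ : ∀ {x a b} → x ≐ b → x ∈ ⁅ a , b ⁆
∈⁅⁆ʳ e = false , e

⁅⁆⊆ : ∀ {a b x} → a ∈ x → b ∈ x → ⁅ a , b ⁆ ⊆ x
⁅⁆⊆ p q z z∈ = [ (λ e → ∈-respˡ (≐-sym e) p) , (λ e → ∈-respˡ (≐-sym e) q) ]′ (∈⁅⁆⁻ z∈)

⁅⁆-cong : ∀ {a a′ b b′} → a ≐ a′ → b ≐ b′ → ⁅ a , b ⁆ ≐ ⁅ a′ , b′ ⁆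
⁅⁆-cong p q = (λ { true → true , p ; false → false , q }) , (λ { true → true , p ; false → false , q })

⟨⟩-cong : ∀ {a a′ b b′} → a ≐ a′ → b ≐ b′ → ⟨ a , b ⟩ ≐ ⟨ a′ , b′ ⟩
⟨⟩-cong p q = ⁅⁆-cong (⁅⁆-cong p p) (⁅⁆-cong p q)

⁅⁆-injˡ : ∀ {a b c} → ⁅ a , a ⁆ ≐ ⁅ b , c ⁆ → a ≐ b × a ≐ c
⁅⁆-injˡ e with proj₂ e true | proj₂ e false
... | true , p | true , q = p , q
... | true , p | false , q = p , q
... | false , p | true , q = p , q
... | false , p | false , q = p , q

⁅⁆-injʳ : ∀ {a b c} → ⁅ a , b ⁆ ≐ ⁅ a , c ⁆ → b ≐ c
⁅⁆-injʳ e with proj₁ e false | proj₂ e false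
... | false , p | _ = p
... | true , p | true , q = ≐-trans p q
... | true , p | false , q = q

pair-respˡ : ∀ {x x′ f} y → x ≐ x′ → ⟨ x , y ⟩ ∈ f → ⟨ x′ , y ⟩ ∈ f
pair-respˡ {x} {x′} {f} y e = ∈-respˡ {⟨ x , y ⟩} {⟨ x′ , y ⟩} {f} (⟨⟩-cong e (≐-refl y))

pair-respʳ : ∀ {y y′ f} x → y ≐ y′ → ⟨ x , y ⟩ ∈ f → ⟨ x , y′ ⟩ ∈ f
pair-respʳ {y} {y′} {f} x e = ∈-respˡ {⟨ x , y ⟩} {⟨ x , y′ ⟩} {f} (⟨⟩-cong (≐-refl x) e)

⟨⟩-injˡ : ∀ {a a′ b b′} → ⟨ a , b ⟩ ≐ ⟨ a′ , b′ ⟩ → a ≐ a′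
⟨⟩-injˡ e with proj₁ e true
... | true , p = proj₁ (⁅⁆-injˡ p)
... | false , p = proj₁ (⁅⁆-injˡ p)

⟨⟩-injʳ : ∀ {a a′ b b′} → ⟨ a , b ⟩ ≐ ⟨ a′ , b′ ⟩ → b ≐ b′
⟨⟩-injʳ {a} {a′} {b} {b′} e = ⁅⁆-injʳ {a′} (≐-trans (≐-sym (⁅⁆-cong a≐a′ (≐-refl b))) pairs)
  where
  a≐a′ = ⟨⟩-injˡ {a} {a′} {b} {b′} e
  pairs : ⁅ a , b ⁆ ≐ ⁅ a′ , b′ ⁆
  pairs = ⁅⁆-injʳ (≐-trans (⁅⁆-cong (≐-sym (⁅⁆-cong a≐a′ a≐a′)) (≐-refl ⁅ a , b ⁆)) e)

∈-succ⁻ : ∀ {z} x → z ∈ succ x → z ∈ x ⊎ z ≐ x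
∈-succ⁻ (sup I f) (just i , e)  = inj₁ (i , e)
∈-succ⁻ (sup I f) (nothing , e) = inj₂ e

∈-succˡ : ∀ {z} x → z ∈ x → z ∈ succ x
∈-succˡ (sup I f) (i , e) = just i , e

∈-succʳ : ∀ {z} x → z ≐ x → z ∈ succ x
∈-succʳ (sup I f) e = nothing , e

succ-cong : ∀ {x y} → x ≐ y → succ x ≐ succ y
succ-cong {x} {y} e = ext (half e) (half (≐-sym e))
  where
  half : ∀ {x y} → x ≐ y → ∀ z → z ∈ succ x → z ∈ succ y
  half {x} {y} e z z∈ with ∈-succ⁻ x z∈
  ... | inj₁ p = ∈-succˡ y (∈-respʳ e p)
  ... | inj₂ p = ∈-succʳ y (≐-trans p e)

∈-num⁻ : ∀ n {z} → z ∈ num n → ∃[ m ] m ℕ.< n × z ≐ num m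
∈-num⁻ (suc n) z∈ with ∈-succ⁻ (num n) z∈
... | inj₁ p = let m , m<n , e = ∈-num⁻ n p in m , ℕ.m<n⇒m<1+n m<n , e
... | inj₂ e = n , ℕ.n<1+n n , e

num-∈ : ∀ {m n} → m ℕ.< n → num m ∈ num n
num-∈ {n = suc n} (s≤s m≤n) with ℕ.m≤n⇒m<n∨m≡n m≤n
... | inj₁ m<n  = ∈-succˡ (num n) (num-∈ m<n)
... | inj₂ refl = ∈-succʳ (num n) (≐-refl _)

num-inj : ∀ {m n} → num m ≐ num n → m ≡ n
num-inj {m} {n} e with ℕ.<-cmp m n
... | tri< m<n _ _ = ⊥-elim (∈-irrefl _ (∈-respˡ e (num-∈ m<n)))
... | tri≈ _ m≡n _ = m≡n
... | tri> _ _ n<m = ⊥-elim (∈-irrefl _ (∈-respˡ (≐-sym e) (num-∈ n<m)))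

num-∈⁻ : ∀ {m n} → num m ∈ num n → m ℕ.< n
num-∈⁻ {m} {n} p = let m′ , m′<n , e = ∈-num⁻ n p in subst (ℕ._< n) (sym (num-inj e)) m′<n

num-∈ω : ∀ n → num n ∈ ω
num-∈ω n = n , ≐-refl _

succ≢∅ : ∀ {x y} → x ≐ succ y → ¬ (x ≐ ∅)
succ≢∅ {x} {y} p q with ∈-respʳ (≐-trans (≐-sym p) q) (∈-succʳ y (≐-refl y))
... | ()

num-suc : ∀ {n x} → num (suc n) ≐ succ x → x ≐ num n
num-suc {n} {x} e with ∈-num⁻ (suc n) (∈-respʳ (≐-sym e) (∈-succʳ x (≐-refl x)))
... | m , s≤s m≤n , x≐ with num-inj {suc n} {suc m} (≐-trans e (succ-cong x≐))
... | refl = x≐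

tuple-cong : {xs ys : Vec 𝕍 n} → Pointwise _≐_ xs ys → tuple xs ≐ tuple ys
tuple-cong []       = ≐-refl _
tuple-cong (e ∷ es) = ⟨⟩-cong e (tuple-cong es)

⟨⟩≢∅ : ∀ {x y} → ¬ (⟨ x , y ⟩ ≐ ∅)
⟨⟩≢∅ e = proj₁ (proj₁ e true)

-- Even the length is recovered, because tuples end in `∅` and a Kuratowski pair is never empty.
tuple-inj : ∀ {m n} (xs : Vec 𝕍 m) (ys : Vec 𝕍 n) → tuple xs ≐ tuple ys →
            Σ (m ≡ n) λ e → Pointwise _≐_ (subst (Vec 𝕍) e xs) ys
tuple-inj [] [] e = refl , []
tuple-inj [] (y ∷ ys) e = ⊥-elim (⟨⟩≢∅ (≐-sym e))
tuple-inj (x ∷ xs) [] e = ⊥-elim (⟨⟩≢∅ e)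
tuple-inj (x ∷ xs) (y ∷ ys) e with tuple-inj xs ys (⟨⟩-injʳ e)
... | refl , es = refl , ⟨⟩-injˡ e ∷ es

-- Definability over V, and closure of V under definable constructions

module Definability (V : Class) (isModel : IsTransitiveModel V) where
  open IsTransitiveModel isModel

  AllV : ∀ {n} → Vec 𝕍 n → Set₁
  AllV = VecAll.All V

  lookupV : {ρ : Vec 𝕍 n} → AllV ρ → ∀ i → V (lookup ρ i)
  lookupV (v ∷ vs) zero    = v
  lookupV (v ∷ vs) (suc i) = lookupV vs i

  elemV : ∀ {x y} → V x → y ∈ x → V y
  elemV Vx y∈x = transitive _ _ y∈x Vx

  -- Pairs a predicate with a formula that expresses it for parameters in V. Formulas are then never
  -- written by hand: the combinators assemble them in parallel with the predicates, and the
  -- predicates are what the proofs work with.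
  record Dfn {n} (P : Vec 𝕍 n → Set ℓ) : Set (lsuc 0ℓ ⊔ ℓ) where
    constructor dfn
    field
      fml : Fml n
      sat : ∀ ρ → AllV ρ → P ρ ⇔ Sat V fml ρ

  private variable
    P : Vec 𝕍 n → Set ℓ
    Q : Vec 𝕍 n → Set ℓ′

  mapD : (∀ ρ → AllV ρ → P ρ ⇔ Q ρ) → Dfn P → Dfn Q
  mapD e (dfn φ s) = dfn φ λ ρ vs →
    mk⇔ (λ q → to (s ρ vs) (from (e ρ vs) q)) (λ t → to (e ρ vs) (from (s ρ vs) t))

  infix  6 _∈ᴰ_ _≐ᴰ_
  infixr 5 _∧ᴰ_
  infixr 4 _∨ᴰ_
  infixr 3 _⇒ᴰ_

  _∈ᴰ_ : (i j : Fin n) → Dfn (λ ρ → lookup ρ i ∈ lookup ρ j)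
  i ∈ᴰ j = dfn (i ∈̇ j) λ ρ _ → mk⇔ lift lower

  _≐ᴰ_ : (i j : Fin n) → Dfn (λ ρ → lookup ρ i ≐ lookup ρ j)
  i ≐ᴰ j = dfn (i ≐̇ j) λ ρ _ → mk⇔ lift lower

  _∧ᴰ_ : Dfn P → Dfn Q → Dfn (λ ρ → P ρ × Q ρ)
  dfn φ s ∧ᴰ dfn ψ t = dfn (φ ∧̇ ψ) λ ρ vs →
    mk⇔ (λ (p , q) → to (s ρ vs) p , to (t ρ vs) q)
        (λ (p , q) → from (s ρ vs) p , from (t ρ vs) q)

  _∨ᴰ_ : Dfn P → Dfn Q → Dfn (λ ρ → P ρ ⊎ Q ρ)
  dfn φ s ∨ᴰ dfn ψ t = dfn (φ ∨̇ ψ) λ ρ vs →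
    mk⇔ [ inj₁ ∘ to (s ρ vs) , inj₂ ∘ to (t ρ vs) ]′
        [ inj₁ ∘ from (s ρ vs) , inj₂ ∘ from (t ρ vs) ]′

  _⇒ᴰ_ : Dfn P → Dfn Q → Dfn (λ ρ → P ρ → Q ρ)
  dfn φ s ⇒ᴰ dfn ψ t = dfn (φ ⇒̇ ψ) λ ρ vs →
    mk⇔ (λ f → to (t ρ vs) ∘ f ∘ from (s ρ vs)) (λ f → from (t ρ vs) ∘ f ∘ to (s ρ vs))

  ¬ᴰ_ : Dfn P → Dfn (λ ρ → ¬ P ρ)
  ¬ᴰ dfn φ s = dfn (φ ⇒̇ ⊥̇) λ ρ vs →
    mk⇔ (λ f p → lift (f (from (s ρ vs) p))) (λ f p → lower (f (to (s ρ vs) p)))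

  _⇔ᴰ_ : Dfn P → Dfn Q → Dfn (λ ρ → P ρ ⇔ Q ρ)
  d ⇔ᴰ e = mapD (λ ρ _ → mk⇔ (λ (f , g) → mk⇔ f g) (λ e → to e , from e)) ((d ⇒ᴰ e) ∧ᴰ (e ⇒ᴰ d))

  ∃ᴰ_ : {P : Vec 𝕍 (suc n) → Set ℓ} → Dfn P → Dfn (λ ρ → ∃[ x ] V x × P (x ∷ ρ))
  ∃ᴰ dfn φ s = dfn (∃̇ φ) λ ρ vs →
    mk⇔ (λ (x , v , p) → x , v , to (s (x ∷ ρ) (v ∷ vs)) p)
        (λ (x , v , p) → x , v , from (s (x ∷ ρ) (v ∷ vs)) p)

  ∀ᴰ_ : {P : Vec 𝕍 (suc n) → Set ℓ} → Dfn P → Dfn (λ ρ → ∀ x → V x → P (x ∷ ρ))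
  ∀ᴰ dfn φ s = dfn (∀̇ φ) λ ρ vs →
    mk⇔ (λ f x v → to (s (x ∷ ρ) (v ∷ vs)) (f x v))
        (λ f x v → from (s (x ∷ ρ) (v ∷ vs)) (f x v))

  ∃∈ᴰ : (i : Fin n) {P : Vec 𝕍 (suc n) → Set ℓ} → Dfn P →
        Dfn (λ ρ → ∃[ x ] x ∈ lookup ρ i × P (x ∷ ρ))
  ∃∈ᴰ i d = mapD (λ ρ vs → mk⇔ (λ t → proj₁ t , proj₂ (proj₂ t))
                               (λ t → proj₁ t , elemV (lookupV vs i) (proj₁ (proj₂ t)) , proj₂ t))
                 (∃ᴰ (zero ∈ᴰ suc i ∧ᴰ d))

  ∀∈ᴰ : (i : Fin n) {P : Vec 𝕍 (suc n) → Set ℓ} → Dfn P →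
        Dfn (λ ρ → ∀ x → x ∈ lookup ρ i → P (x ∷ ρ))
  ∀∈ᴰ i d = mapD (λ ρ vs → mk⇔ (λ f x x∈ → f x (elemV (lookupV vs i) x∈) x∈)
                               (λ f x _ → f x))
                 (∀ᴰ (zero ∈ᴰ suc i ⇒ᴰ d))

  under : ∀ {m n} → (Fin m → Fin n) → Fin (suc m) → Fin (suc n)
  under σ zero    = zero
  under σ (suc i) = suc (σ i)

  rename : ∀ {m n} → (Fin m → Fin n) → Fml m → Fml n
  rename σ (i ∈̇ j) = σ i ∈̇ σ j
  rename σ (i ≐̇ j) = σ i ≐̇ σ j
  rename σ ⊥̇       = ⊥̇
  rename σ (φ ∧̇ ψ) = rename σ φ ∧̇ rename σ ψ
  rename σ (φ ∨̇ ψ) = rename σ φ ∨̇ rename σ ψ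
  rename σ (φ ⇒̇ ψ) = rename σ φ ⇒̇ rename σ ψ
  rename σ (∀̇ φ)   = ∀̇ rename (under σ) φ
  rename σ (∃̇ φ)   = ∃̇ rename (under σ) φ

  Agree : ∀ {m n} → (Fin m → Fin n) → Vec 𝕍 m → Vec 𝕍 n → Set
  Agree σ ρ ρ′ = ∀ i → lookup ρ i ≐ lookup ρ′ (σ i)

  agree-lift : ∀ {m n} (σ : Fin m → Fin n) {ρ ρ′} x → Agree σ ρ ρ′ →
               Agree (under σ) (x ∷ ρ) (x ∷ ρ′)
  agree-lift σ x e zero    = ≐-refl x
  agree-lift σ x e (suc i) = e i

  -- Agreement is only up to `≐`, so besides renaming variables this yields that satisfaction
  -- respects extensional equality.
  sat-rename : ∀ {m n} (σ : Fin m → Fin n) φ {ρ ρ′} → Agree σ ρ ρ′ →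
               Sat V φ ρ ⇔ Sat V (rename σ φ) ρ′
  sat-rename σ (i ∈̇ j) e =
    mk⇔ (λ (lift p) → lift (∈-respˡ (e i) (∈-respʳ (e j) p)))
        (λ (lift p) → lift (∈-respˡ (≐-sym (e i)) (∈-respʳ (≐-sym (e j)) p)))
  sat-rename σ (i ≐̇ j) e =
    mk⇔ (λ (lift p) → lift (≐-trans (≐-sym (e i)) (≐-trans p (e j))))
        (λ (lift p) → lift (≐-trans (e i) (≐-trans p (≐-sym (e j)))))
  sat-rename σ ⊥̇ e = mk⇔ id id
  sat-rename σ (φ ∧̇ ψ) e =
    mk⇔ (λ (p , q) → to (sat-rename σ φ e) p , to (sat-rename σ ψ e) q)
        (λ (p , q) → from (sat-rename σ φ e) p , from (sat-rename σ ψ e) q)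
  sat-rename σ (φ ∨̇ ψ) e =
    mk⇔ [ inj₁ ∘ to (sat-rename σ φ e) , inj₂ ∘ to (sat-rename σ ψ e) ]′
        [ inj₁ ∘ from (sat-rename σ φ e) , inj₂ ∘ from (sat-rename σ ψ e) ]′
  sat-rename σ (φ ⇒̇ ψ) e =
    mk⇔ (λ f → to (sat-rename σ ψ e) ∘ f ∘ from (sat-rename σ φ e))
        (λ f → from (sat-rename σ ψ e) ∘ f ∘ to (sat-rename σ φ e))
  sat-rename σ (∀̇ φ) e =
    mk⇔ (λ f x v → to (sat-rename _ φ (agree-lift σ x e)) (f x v))
        (λ f x v → from (sat-rename _ φ (agree-lift σ x e)) (f x v))
  sat-rename σ (∃̇ φ) e =
    mk⇔ (λ (x , v , p) → x , v , to (sat-rename _ φ (agree-lift σ x e)) p)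
        (λ (x , v , p) → x , v , from (sat-rename _ φ (agree-lift σ x e)) p)

  private
    place : ∀ {k m} → Vec (Fin k) n → (Fin m → Fin k) → Fin (n ℕ.+ m) → Fin k
    place []       f i       = f i
    place (j ∷ js) f zero    = j
    place (j ∷ js) f (suc i) = place js f i

    lookup-drop : ∀ k (ρ : Vec 𝕍 (k ℕ.+ n)) i → lookup (Vec.drop k ρ) i ≡ lookup ρ (k ↑ʳ i)
    lookup-drop zero    ρ       i = refl
    lookup-drop (suc k) (x ∷ ρ) i = lookup-drop k ρ i

    agree-place : ∀ {m} k (ρ : Vec 𝕍 (k ℕ.+ n)) (is : Vec (Fin (k ℕ.+ n)) m) →
                  Agree (place is (k ↑ʳ_)) (Vec.map (lookup ρ) is Vec.++ Vec.drop k ρ) ρ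
    agree-place k ρ []       i       = ≡⇒≐ (lookup-drop k ρ i)
    agree-place k ρ (j ∷ js) zero    = ≐-refl _
    agree-place k ρ (j ∷ js) (suc i) = agree-place k ρ js i

    placedV : ∀ {m} k {ρ : Vec 𝕍 (k ℕ.+ n)} → AllV ρ → (is : Vec (Fin (k ℕ.+ n)) m) →
              AllV (Vec.map (lookup ρ) is Vec.++ Vec.drop k ρ)
    placedV zero    vs       []       = vs
    placedV (suc k) (v ∷ vs) []       = placedV k vs []
    placedV k       vs       (i ∷ is) = lookupV vs i ∷ placedV k vs is

  -- Weakening, for reusing a given predicate under quantifiers: its first `m` variables are read at
  -- the positions `is`, and its parameters are what remains of the environment after the first `k`
  -- entries.
  shiftᴰ : ∀ {m} k (is : Vec (Fin (k ℕ.+ n)) m) {P : Vec 𝕍 (m ℕ.+ n) → Set ℓ} → Dfn P →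
           Dfn (λ ρ → P (Vec.map (lookup ρ) is Vec.++ Vec.drop k ρ))
  shiftᴰ k is (dfn φ s) = dfn (rename (place is (k ↑ʳ_)) φ) λ ρ vs →
    let e = sat-rename _ φ (agree-place k ρ is) ; t = s _ (placedV k vs is) in
    mk⇔ (to e ∘ to t) (from t ∘ from e)

  ≐*-refl : {ρ : Vec 𝕍 n} → Pointwise _≐_ ρ ρ
  ≐*-refl = PW.refl (≐-refl _)

  resp : {P : Vec 𝕍 n → Set ℓ} → Dfn P → ∀ {ρ ρ′} → AllV ρ → AllV ρ′ → Pointwise _≐_ ρ ρ′ → P ρ → P ρ′
  resp (dfn φ s) {ρ} {ρ′} vs vs′ e p =
    -- `rename id φ` is not definitionally `φ`, so the argument passes through it and back.
    from (s _ vs′) (from (sat-rename id φ {ρ′} {ρ} (λ i → ≐-sym (PW.lookup e i)))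
                     (to (sat-rename id φ {ρ} {ρ} (λ i → ≐-refl _)) (to (s _ vs) p)))

graph : (I : Set) (c F : I → 𝕍) → 𝕍
graph I c F = sup I λ i → ⟨ c i , F i ⟩

prod : 𝕍 → 𝕍 → 𝕍
prod (sup I f) (sup J g) = sup (I × J) λ (i , j) → ⟨ f i , g j ⟩

∈-prod⁺ : ∀ {a b x y} → x ∈ a → y ∈ b → ⟨ x , y ⟩ ∈ prod a b
∈-prod⁺ {sup I f} {sup J g} (i , e) (j , e′) = (i , j) , ⟨⟩-cong e e′

∈-prod⁻ : ∀ a b {z} → z ∈ prod a b → ∃[ x ] ∃[ y ] z ≐ ⟨ x , y ⟩ × x ∈ a × y ∈ b
∈-prod⁻ (sup I f) (sup J g) ((i , j) , e) = f i , g j , e , elem I f i , elem J g j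

infixl 6 _∪_
_∪_ : 𝕍 → 𝕍 → 𝕍
sup I f ∪ sup J g = sup (I ⊎ J) [ f , g ]′

∈-∪ˡ : ∀ {a b x} → x ∈ a → x ∈ a ∪ b
∈-∪ˡ {sup I f} {sup J g} (i , e) = inj₁ i , e

∈-∪ʳ : ∀ {a b x} → x ∈ b → x ∈ a ∪ b
∈-∪ʳ {sup I f} {sup J g} (j , e) = inj₂ j , e

∈-∪⁻ : ∀ a b {x} → x ∈ a ∪ b → x ∈ a ⊎ x ∈ b
∈-∪⁻ (sup I f) (sup J g) (inj₁ i , e) = inj₁ (i , e)
∈-∪⁻ (sup I f) (sup J g) (inj₂ j , e) = inj₂ (j , e)

vecSet : ∀ {n} → Vec 𝕍 n → 𝕍
vecSet {n} xs = sup (Fin n) (lookup xs)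

pattern v0 = zero
pattern v1 = suc v0
pattern v2 = suc v1
pattern v3 = suc v2
pattern v4 = suc v3
pattern v5 = suc v4
pattern v6 = suc v5
pattern v7 = suc v6
pattern v8 = suc v7
pattern v9 = suc v8

module Closure (V : Class) (isModel : IsTransitiveModel V) where
  open IsTransitiveModel isModel
  open Definability V isModel public

  setᴰ : (i j k : Fin n) → Dfn (λ ρ → lookup ρ i ≐ ⁅ lookup ρ j , lookup ρ k ⁆)
  setᴰ i j k = mapD
    (λ ρ _ → mk⇔
      (λ (f , p , q) → ext (λ z z∈ → [ ∈⁅⁆ˡ , ∈⁅⁆ʳ ]′ (f z z∈)) (⁅⁆⊆ p q))
      (λ e → (λ z z∈ → ∈⁅⁆⁻ (∈-respʳ e z∈)) , ∈-respʳ (≐-sym e) (∈⁅⁆ˡ (≐-refl _))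
             , ∈-respʳ (≐-sym e) (∈⁅⁆ʳ (≐-refl _))))
    (∀∈ᴰ i (v0 ≐ᴰ suc j ∨ᴰ v0 ≐ᴰ suc k) ∧ᴰ j ∈ᴰ i ∧ᴰ k ∈ᴰ i)

  infix 6 _≐⟨_,_⟩ᴰ ⟨_,_⟩∈ᴰ_

  _≐⟨_,_⟩ᴰ : (i j k : Fin n) → Dfn (λ ρ → lookup ρ i ≐ ⟨ lookup ρ j , lookup ρ k ⟩)
  i ≐⟨ j , k ⟩ᴰ = mapD
    (λ ρ _ → mk⇔
      (λ (p , _ , q , _ , p≐ , q≐ , e) → ≐-trans e (⁅⁆-cong p≐ q≐))
      (λ e → _ , ∈-respʳ (≐-sym e) (∈⁅⁆ˡ (≐-refl _)) , _ , ∈-respʳ (≐-sym e) (∈⁅⁆ʳ (≐-refl _))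
             , ≐-refl _ , ≐-refl _ , e))
    (∃∈ᴰ i (∃∈ᴰ (suc i) (setᴰ v1 (suc (suc j)) (suc (suc j)) ∧ᴰ setᴰ v0 (suc (suc j)) (suc (suc k))
                          ∧ᴰ setᴰ (suc (suc i)) v1 v0)))

  ⟨_,_⟩∈ᴰ_ : (i j k : Fin n) → Dfn (λ ρ → ⟨ lookup ρ i , lookup ρ j ⟩ ∈ lookup ρ k)
  ⟨ i , j ⟩∈ᴰ k = mapD
    (λ ρ _ → mk⇔ (λ (z , z∈ , e) → ∈-respˡ e z∈) (λ p → _ , p , ≐-refl _))
    (∃∈ᴰ k (v0 ≐⟨ suc i , suc j ⟩ᴰ))

  succᴰ : (i j : Fin n) → Dfn (λ ρ → lookup ρ i ≐ succ (lookup ρ j))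
  succᴰ i j = mapD
    (λ ρ _ → mk⇔
      (λ (f , g , p) → ext
        (λ z z∈ → [ ∈-succˡ (lookup ρ j) , ∈-succʳ (lookup ρ j) ]′ (f z z∈))
        (λ z z∈ → [ g z , (λ e → ∈-respˡ (≐-sym e) p) ]′ (∈-succ⁻ (lookup ρ j) z∈)))
      (λ e → (λ z z∈ → ∈-succ⁻ (lookup ρ j) (∈-respʳ e z∈))
           , (λ z z∈ → ∈-respʳ (≐-sym e) (∈-succˡ (lookup ρ j) z∈))
           , ∈-respʳ (≐-sym e) (∈-succʳ (lookup ρ j) (≐-refl _))))
    (∀∈ᴰ i (v0 ∈ᴰ suc j ∨ᴰ v0 ≐ᴰ suc j) ∧ᴰ ∀∈ᴰ j (v0 ∈ᴰ suc i) ∧ᴰ j ∈ᴰ i)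

  pairV : ∀ {x y} → V x → V y → V ⁅ x , y ⁆
  pairV {x} {y} Vx Vy with pairing x y Vx Vy
  ... | p , Vp , e = respects _ _ (ext (λ z z∈ → [ ∈⁅⁆ˡ , ∈⁅⁆ʳ ]′ (to (e z (elemV Vp z∈)) z∈)) (λ z z∈ → from (e z (el z∈)) (∈⁅⁆⁻ z∈))) Vp
    where
    el : ∀ {z} → z ∈ ⁅ x , y ⁆ → V z
    el z∈ = [ (λ e → respects _ _ (≐-sym e) Vx) , (λ e → respects _ _ (≐-sym e) Vy) ]′ (∈⁅⁆⁻ z∈)

  ⟨⟩V : ∀ {x y} → V x → V y → V ⟨ x , y ⟩
  ⟨⟩V Vx Vy = pairV (pairV Vx Vx) (pairV Vx Vy)

  ⟨⟩V⁻ : ∀ {x y} → V ⟨ x , y ⟩ → V x × V y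
  ⟨⟩V⁻ Vp = elemV (elemV Vp (∈⁅⁆ʳ (≐-refl _))) (∈⁅⁆ˡ (≐-refl _)) , elemV (elemV Vp (∈⁅⁆ʳ (≐-refl _))) (∈⁅⁆ʳ (≐-refl _))

  ∪V : ∀ {x y} → V x → V y → V (x ∪ y)
  ∪V {x} {y} Vx Vy with union ⁅ x , y ⁆ (pairV Vx Vy)
  ... | u , Vu , e = respects _ _ (ext
    (λ z z∈ → let w , _ , w∈ , z∈w = to (e z (elemV Vu z∈)) z∈ in
       [ (λ e → ∈-∪ˡ {x} {y} (∈-respʳ e z∈w)) , (λ e → ∈-∪ʳ {x} {y} (∈-respʳ e z∈w)) ]′ (∈⁅⁆⁻ w∈))
    (λ z z∈ → [ (λ p → from (e z (elemV Vx p)) (x , Vx , ∈⁅⁆ˡ (≐-refl _) , p))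
              , (λ p → from (e z (elemV Vy p)) (y , Vy , ∈⁅⁆ʳ (≐-refl _) , p)) ]′ (∈-∪⁻ x y z∈))) Vu

  abstract
    sep : {P : Vec 𝕍 (suc n) → Set ℓ} → Dfn P → ∀ {ρ} → AllV ρ → ∀ {a} → V a →
          ∃[ b ] V b × (∀ x → x ∈ b ⇔ (x ∈ a × P (x ∷ ρ)))
    sep (dfn φ s) {ρ} vs {a} Va with separation φ ρ vs a Va
    ... | b , Vb , e = b , Vb , λ x → mk⇔
      (λ x∈ → let Vx = elemV Vb x∈ ; x∈a , q = to (e x Vx) x∈ in x∈a , from (s _ (Vx ∷ vs)) q)
      (λ (x∈a , p) → let Vx = elemV Va x∈a in from (e x Vx) (x∈a , to (s _ (Vx ∷ vs)) p))

  abstract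
    -- Replacement for a family given outside V: it suffices that one formula with parameters in V
    -- determines each `F i` from its key `c i`. Since keys are known only up to `≐`, `resp` moves
    -- the formula between representatives.
    imageV : (I : Set) (c : I → 𝕍) → V (sup I c) → (F : I → 𝕍) → (∀ i → V (F i)) →
             {P : Vec 𝕍 (suc (suc n)) → Set ℓ} → Dfn P → ∀ {ρ} → AllV ρ →
             (∀ i y → V y → P (y ∷ c i ∷ ρ) ⇔ y ≐ F i) → V (sup I F)
    imageV I c Vc F VF (dfn φ s) {ρ} vs func
      with replacement φ ρ vs (sup I c) Vc
             (λ { x Vx (i , e) → F i , VF i
                , resp satᴰ (VF i ∷ Vcᵢ i ∷ vs) (VF i ∷ Vx ∷ vs) (≐-refl _ ∷ ≐-sym e ∷ ≐*-refl)
                    (to (s _ (VF i ∷ Vcᵢ i ∷ vs)) (from (func i (F i) (VF i)) (≐-refl _)))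
                , λ y Vy q → to (func i y Vy) (from (s _ (Vy ∷ Vcᵢ i ∷ vs))
                    (resp satᴰ (Vy ∷ Vx ∷ vs) (Vy ∷ Vcᵢ i ∷ vs) (≐-refl _ ∷ e ∷ ≐*-refl) q)) })
      where
      satᴰ : Dfn (Sat V φ)
      satᴰ = dfn φ λ _ _ → mk⇔ id id
      Vcᵢ : ∀ i → V (c i)
      Vcᵢ i = elemV Vc (elem I c i)
    ... | b , Vb , e = respects _ _ (ext
      (λ y y∈ → let Vy = elemV Vb y∈ ; x , Vx , (i , x≐) , q = to (e y Vy) y∈ in
         i , to (func i y Vy) (from (s _ (Vy ∷ elemV Vc (elem I c i) ∷ vs))
               (resp (dfn φ λ _ _ → mk⇔ id id) (Vy ∷ Vx ∷ vs) (Vy ∷ elemV Vc (elem I c i) ∷ vs)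
                 (≐-refl _ ∷ x≐ ∷ ≐*-refl) q)))
      (λ { y (i , y≐) → let Vy = respects _ _ (≐-sym y≐) (VF i) in
         from (e y Vy) (c i , elemV Vc (elem I c i) , elem I c i
           , to (s _ (Vy ∷ elemV Vc (elem I c i) ∷ vs)) (from (func i y Vy) y≐)) })) Vb

  abstract
    powV : ∀ {a} → V a → ∃[ p ] V p × (∀ y → V y → y ⊆ a → y ∈ p)
    powV {a} Va with powerset a Va
    ... | p , Vp , e = p , Vp , λ y Vy y⊆ → from (e y Vy) λ z _ → y⊆ z

  prodV : ∀ {a b} → V a → V b → V (prod a b)
  prodV {a} {b} Va Vb with powV (∪V Va Vb)
  ... | p , Vp , inP with powV Vp
  ... | pp , Vpp , inPP
    with sep (∃∈ᴰ v1 (∃∈ᴰ v3 (v2 ≐⟨ v1 , v0 ⟩ᴰ))) (Va ∷ Vb ∷ []) Vpp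
  ... | c , Vc , e = respects _ _ (ext
    (λ z z∈ → let _ , x , x∈ , y , y∈ , z≐ = to (e z) z∈ in ∈-respˡ (≐-sym z≐) (∈-prod⁺ {a} {b} x∈ y∈))
    (λ z z∈ → let x , y , z≐ , x∈ , y∈ = ∈-prod⁻ a b z∈
                  Vx = elemV Va x∈ ; Vy = elemV Vb y∈
                  x∈∪ = ∈-∪ˡ {a} {b} x∈ ; y∈∪ = ∈-∪ʳ {a} {b} y∈
              in ∈-respˡ (≐-sym z≐) (from (e _)
       (inPP _ (⟨⟩V Vx Vy) (⁅⁆⊆ (inP _ (pairV Vx Vx) (⁅⁆⊆ x∈∪ x∈∪)) (inP _ (pairV Vx Vy) (⁅⁆⊆ x∈∪ y∈∪)))
       , x , x∈ , y , y∈ , ≐-refl _)))) Vc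

  abstract
    graphV : (I : Set) (c : I → 𝕍) → V (sup I c) → (F : I → 𝕍) → (∀ i → V (F i)) →
             {P : Vec 𝕍 (suc (suc n)) → Set ℓ} → Dfn P → ∀ {ρ} → AllV ρ →
             (∀ i y → V y → P (y ∷ c i ∷ ρ) ⇔ y ≐ F i) → V (graph I c F)
    graphV {n = n} I c Vc F VF {P} d {ρ} vs func =
      imageV I c Vc (λ i → ⟨ c i , F i ⟩) (λ i → ⟨⟩V (elemV Vc (elem I c i)) (VF i))
        (∃ᴰ (v1 ≐⟨ v2 , v0 ⟩ᴰ ∧ᴰ shiftᴰ 3 (v0 ∷ v2 ∷ []) d)) vs
        λ i z Vz → mk⇔
          (λ (y , Vy , e , q) → ≐-trans e (⟨⟩-cong (≐-refl _) (to (func i y Vy) q)))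
          (λ e → F i , VF i , e
              , from (func i (F i) (VF i)) (≐-refl _))

  sucV : ∀ {x} → V x → V (succ x)
  sucV {x} Vx = respects _ _ (ext
    (λ z z∈ → [ ∈-succˡ x , (λ q → ∈-succʳ x ([ id , id ]′ (∈⁅⁆⁻ q))) ]′ (∈-∪⁻ x ⁅ x , x ⁆ z∈))
    (λ z z∈ → [ ∈-∪ˡ {x} {⁅ x , x ⁆} , (λ e → ∈-∪ʳ {x} {⁅ x , x ⁆} (∈⁅⁆ˡ e)) ]′ (∈-succ⁻ x z∈))) (∪V Vx (pairV Vx Vx))

  infinityV : ∃[ w ] V w × (∀ n → V (num n) × num n ∈ w)
  infinityV with infinity
  ... | w , Vw , (e , Ve , e∈ , empty) , step = w , Vw , go
    where
    go : ∀ n → V (num n) × num n ∈ w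
    go zero = let q = ext (λ z z∈ → ⊥-elim (empty z (elemV Ve z∈) z∈)) (λ _ ()) in
              respects _ _ q Ve , ∈-respˡ q e∈
    go (suc n) with go n
    ... | Vn , n∈ with step _ Vn n∈
    ... | s , Vs , s∈ , q = let r = ext (λ z z∈ → [ ∈-succˡ (num n) , ∈-succʳ (num n) ]′ (to (q z (elemV Vs z∈)) z∈))
                                        (λ z z∈ → from (q z (elemV (sucV Vn) z∈)) (∈-succ⁻ (num n) z∈))
                            in respects _ _ r Vs , ∈-respˡ r s∈

  numV : ∀ n → V (num n)
  numV n = proj₁ (proj₂ (proj₂ infinityV) n)

  -- By ∈-induction, a transitive set is a numeral if it and its elements are transitive and each empty or a successor.
  ωV : V ω
  ωV with infinityV
  ... | w , Vw , nums
    with sep (tr v0 ∧ᴰ zs v0 ∧ᴰ ∀∈ᴰ v0 (tr v0 ∧ᴰ zs′ v0)) (numV 0 ∷ []) Vw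
    where
    tr : ∀ {n} (i : Fin n) → Dfn (λ ρ → ∀ y → y ∈ lookup ρ i → ∀ z → z ∈ y → z ∈ lookup ρ i)
    tr i = ∀∈ᴰ i (∀∈ᴰ v0 (v0 ∈ᴰ suc (suc i)))
    zs : (i : Fin 2) → Dfn (λ ρ → lookup ρ i ≐ lookup ρ v1 ⊎ (∃[ z ] z ∈ lookup ρ i × lookup ρ i ≐ succ z))
    zs i = i ≐ᴰ v1 ∨ᴰ ∃∈ᴰ i (succᴰ (suc i) v0)
    zs′ : (i : Fin 3) → Dfn (λ ρ → lookup ρ i ≐ lookup ρ v2 ⊎ (∃[ z ] z ∈ lookup ρ i × lookup ρ i ≐ succ z))
    zs′ i = i ≐ᴰ v2 ∨ᴰ ∃∈ᴰ i (succᴰ (suc i) v0)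
  ... | b , Vb , e = respects _ _ (ext
      (λ x x∈ → isNum x (proj₂ (to (e x) x∈)))
      (λ { x (n , x≐) → ∈-respˡ (≐-sym x≐) (from (e _) (proj₂ (nums n) , numTr n , numZS n , λ y y∈ →
          let m , _ , y≐ = ∈-num⁻ n y∈ in
          (λ u u∈ z z∈ → ∈-respʳ (≐-sym y≐) (numTr m u (∈-respʳ y≐ u∈) z z∈)) ,
          [ (λ q → inj₁ (≐-trans y≐ q)) , (λ (z , z∈ , q) → inj₂ (z , ∈-respʳ (≐-sym y≐) z∈ , ≐-trans y≐ q)) ]′ (numZS m))) })) Vb
    where
    Tr : 𝕍 → Set₁
    Tr x = ∀ y → y ∈ x → ∀ z → z ∈ y → z ∈ x
    ZS : 𝕍 → Set₁
    ZS x = x ≐ num 0 ⊎ (∃[ z ] z ∈ x × x ≐ succ z)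
    isNum : ∀ x → Tr x × ZS x × (∀ y → y ∈ x → Tr y × ZS y) → x ∈ ω
    isNum = ∈-induction _ λ { x ih (t , inj₁ q , h) → 0 , q
                            ; x ih (t , inj₂ (z , z∈ , q) , h) →
                                let n , z≐ = ih z z∈ (proj₁ (h z z∈) , proj₂ (h z z∈) , λ y y∈ → h y (t z z∈ y y∈)) in
                                suc n , ≐-trans q (succ-cong z≐) }
    numTr : ∀ n → Tr (num n)
    numTr n y y∈ z z∈ with ∈-num⁻ n y∈
    ... | m , m<n , y≐ with ∈-num⁻ m (∈-respʳ y≐ z∈)
    ... | k , k<m , z≐ = ∈-respˡ (≐-sym z≐) (num-∈ (ℕ.<-trans k<m m<n))
    numZS : ∀ n → ZS (num n)
    numZS zero    = inj₁ (≐-refl _)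
    numZS (suc n) = inj₂ (num n , num-∈ (ℕ.n<1+n n) , ≐-refl _)

  vecSetV : {xs : Vec 𝕍 n} → AllV xs → V (vecSet xs)
  vecSetV {xs = []} [] = respects _ _ ((λ ()) , (λ ())) (numV 0)
  vecSetV {xs = x ∷ xs} (v ∷ vs) = respects _ _ (ext
    (λ z z∈ → [ (λ q → zero , [ id , id ]′ (∈⁅⁆⁻ q)) , (λ (i , e) → suc i , e) ]′ (∈-∪⁻ ⁅ x , x ⁆ (vecSet xs) z∈))
    (λ { z (zero , e) → ∈-∪ˡ {⁅ x , x ⁆} {vecSet xs} (∈⁅⁆ˡ e)
       ; z (suc i , e) → ∈-∪ʳ {⁅ x , x ⁆} {vecSet xs} (i , e) })) (∪V (pairV v v) (vecSetV vs))

-- Enumeration of pairs of natural numbers.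

num² : ℕ × ℕ → 𝕍
num² (k , j) = ⟨ num k , num j ⟩

num²-inj : ∀ p q → num² p ≐ num² q → p ≡ q
num²-inj (k , j) (k′ , j′) e with num-inj {k} {k′} (⟨⟩-injˡ e) | num-inj {j} {j′} (⟨⟩-injʳ e)
... | refl | refl = refl

-- Enumeration of ℕ × ℕ along antidiagonals, given by a successor function so that it can be recovered by recursion inside a model.
next : ℕ × ℕ → ℕ × ℕ
next (k , suc j) = suc k , j
next (k , zero)  = zero , suc k

orbit : ℕ → ℕ × ℕ
orbit zero    = zero , zero
orbit (suc n) = next (orbit n)

next-inj : ∀ p q → next p ≡ next q → p ≡ q
next-inj (k , suc j) (.k , suc .j) refl = refl
next-inj (k , zero)  (.k , zero)   refl = refl

next≢0 : ∀ p → ¬ (next p ≡ (zero , zero))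
next≢0 (k , suc j) ()
next≢0 (k , zero)  ()

orbit-inj : ∀ m n → orbit m ≡ orbit n → m ≡ n
orbit-inj zero    zero    e = refl
orbit-inj zero    (suc n) e = ⊥-elim (next≢0 (orbit n) (sym e))
orbit-inj (suc m) zero    e = ⊥-elim (next≢0 (orbit m) e)
orbit-inj (suc m) (suc n) e = cong suc (orbit-inj m n (next-inj _ _ e))

private
  slide : ∀ k j → (∃[ n ] orbit n ≡ (zero , k ℕ.+ j)) → ∃[ n ] orbit n ≡ (k , j)
  slide zero    j r = r
  slide (suc k) j (n , e) =
    let n′ , e′ = slide k (suc j) (n , trans e (cong (zero ,_) (sym (ℕ.+-suc k j)))) in suc n′ , cong next e′

  reach₀ : ∀ s → ∃[ n ] orbit n ≡ (zero , s)
  reach₀ zero    = zero , refl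
  reach₀ (suc s) =
    let n , e = reach₀ s
        n′ , e′ = slide s zero (n , trans e (cong (zero ,_) (sym (ℕ.+-identityʳ s)))) in suc n′ , cong next e′

idx : ℕ → ℕ → ℕ
idx k j = proj₁ (slide k j (reach₀ (k ℕ.+ j)))

orbit-idx : ∀ k j → orbit (idx k j) ≡ (k , j)
orbit-idx k j = proj₂ (slide k j (reach₀ (k ℕ.+ j)))

idx-inj : ∀ {k j k′ j′} → idx k j ≡ idx k′ j′ → (k , j) ≡ (k′ , j′)
idx-inj {k} {j} {k′} {j′} e = trans (sym (orbit-idx k j)) (trans (cong orbit e) (orbit-idx k′ j′))

-- Recursion inside V, and sequences that belong to V.

module Recursion (V : Class) (isModel : IsTransitiveModel V) where
  open IsTransitiveModel isModel
  open Closure V isModel public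

  tabV : {f : Fin n → 𝕍} → (∀ i → V (f i)) → AllV (tabulate f)
  tabV {n = zero}  v = []
  tabV {n = suc n} v = v zero ∷ tabV (v ∘ suc)

  private
    initial : (F : ℕ → 𝕍) → ℕ → 𝕍
    initial F n = vecSet (tabulate {n = suc n} λ i → ⟨ num (toℕ i) , F (toℕ i) ⟩)

    initial⁻ : ∀ F n k y → ⟨ num k , y ⟩ ∈ initial F n → y ≐ F k
    initial⁻ F n k y (i , e) with ≐-trans e (≡⇒≐ (Vec.lookup∘tabulate (λ i → ⟨ num (toℕ i) , F (toℕ i) ⟩) i))
    ... | e′ with num-inj {k} {toℕ i} (⟨⟩-injˡ e′)
    ... | refl = ⟨⟩-injʳ e′

    initial⁺ : ∀ F n k → k ℕ.≤ n → ⟨ num k , F k ⟩ ∈ initial F n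
    initial⁺ F n k k≤n = i , ≡⇒≐ (sym (trans (Vec.lookup∘tabulate (λ i → ⟨ num (toℕ i) , F (toℕ i) ⟩) i)
                                         (cong (λ k → ⟨ num k , F k ⟩) (Fin.toℕ-fromℕ< (s≤s k≤n)))))
      where i = fromℕ< (s≤s k≤n)

  abstract
    recursionV : (F : ℕ → 𝕍) → (∀ n → V (F n)) →
      {P : Vec 𝕍 (suc (suc n)) → Set ℓ} → Dfn P → ∀ {ρ} → AllV ρ →
      (∀ n y → V y → P (y ∷ F n ∷ ρ) ⇔ y ≐ F (suc n)) → V (graph ℕ num F)
    recursionV {n = n} F VF {P} d {ρ} vs step =
      graphV ℕ num ωV F VF
        (∃ᴰ (∀ᴰ (⟨ v5 , v0 ⟩∈ᴰ v1 ⇒ᴰ v0 ≐ᴰ v4)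
            ∧ᴰ ∀∈ᴰ v2 (∀ᴰ (succᴰ v0 v1 ⇒ᴰ ∀ᴰ (⟨ v1 , v0 ⟩∈ᴰ v3 ⇒ᴰ ∃ᴰ (⟨ v3 , v0 ⟩∈ᴰ v4 ∧ᴰ shiftᴰ 9 (v1 ∷ v0 ∷ []) d))))
            ∧ᴰ ⟨ v2 , v1 ⟩∈ᴰ v0))
        (VF 0 ∷ numV 0 ∷ vs)
        λ k y Vy → mk⇔
          (λ (f , Vf , base , ind , y∈) → approximates f Vf base ind k ℕ.≤-refl y Vy y∈)
          (λ y≐ → initial F k , vecSetV (tabV {f = λ i → ⟨ num (toℕ i) , F (toℕ i) ⟩} λ i → ⟨⟩V (numV (toℕ i)) (VF (toℕ i)))
            , (λ u _ q → initial⁻ F k 0 u q)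
            , (λ i i∈ i′ _ i′≐ u _ q → let m , m<k , i≐ = ∈-num⁻ k i∈ in
                 F m , VF m , ∈-respˡ (⟨⟩-cong (≐-sym i≐) (≐-refl _)) (initial⁺ F k m (ℕ.<⇒≤ m<k))
                 , from (step m u (respects _ _ (≐-sym (next≐ k u q i≐ i′≐)) (VF (suc m)))) (next≐ k u q i≐ i′≐))
            , ∈-respˡ (⟨⟩-cong (≐-refl _) (≐-sym y≐)) (initial⁺ F k k ℕ.≤-refl))
      where
      next≐ : ∀ k u {m i i′} → ⟨ i′ , u ⟩ ∈ initial F k → i ≐ num m → i′ ≐ succ i → u ≐ F (suc m)
      next≐ k u {m} q i≐ i′≐ = initial⁻ F k (suc m) u (∈-respˡ (⟨⟩-cong (≐-trans i′≐ (succ-cong i≐)) (≐-refl _)) q)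
      approximates : ∀ {k} f (Vf : V f) → (∀ u → V u → ⟨ num 0 , u ⟩ ∈ f → u ≐ F 0) →
        (∀ i → i ∈ num k → ∀ i′ → V i′ → i′ ≐ succ i → ∀ u → V u → ⟨ i′ , u ⟩ ∈ f →
           ∃[ w ] V w × ⟨ i , w ⟩ ∈ f × P (u ∷ w ∷ ρ)) →
        ∀ i → i ℕ.≤ k → ∀ u → V u → ⟨ num i , u ⟩ ∈ f → u ≐ F i
      approximates f Vf base ind zero _ u Vu q = base u Vu q
      approximates f Vf base ind (suc i) i<k u Vu q =
        let w , Vw , w∈ , p = ind (num i) (num-∈ i<k) (num (suc i)) (numV (suc i)) (≐-refl _) u Vu q
            w≐ = approximates f Vf base ind i (ℕ.<⇒≤ i<k) w Vw w∈
        in to (step i u Vu) (resp d (Vu ∷ Vw ∷ vs) (Vu ∷ VF i ∷ vs)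
              (≐-refl _ ∷ w≐ ∷ ≐*-refl)
              p)

  module Families (I : Set) (c : I → 𝕍) (c-inj : ∀ i j → c i ≐ c j → i ≡ j) (Vc : V (sup I c)) where

    Fam : (I → 𝕍) → Set₁
    Fam F = V (graph I c F)

    private variable
      F G : I → 𝕍

    fam∈ : ∀ {F i y} → ⟨ c i , y ⟩ ∈ graph I c F ⇔ y ≐ F i
    fam∈ {F} {i} {y} = mk⇔ (λ (j , e) → there j e (c-inj i j (⟨⟩-injˡ e))) (λ e → i , ⟨⟩-cong (≐-refl _) e)
      where
      there : ∀ j → ⟨ c i , y ⟩ ≐ ⟨ c j , F j ⟩ → i ≡ j → y ≐ F i
      there j e refl = ⟨⟩-injʳ e

    famAt : ∀ {F k i y} → k ≐ c i → ⟨ k , y ⟩ ∈ graph I c F ⇔ y ≐ F i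
    famAt {F} {k} {i} {y} e = mk⇔ (λ p → to (fam∈ {F} {i} {y}) (pair-respˡ {k} {c i} {graph I c F} y e p))
                                  (λ q → pair-respˡ {c i} {k} {graph I c F} y (≐-sym e) (from (fam∈ {F} {i} {y}) q))

    famV : Fam F → ∀ i → V (F i)
    famV {F} g i = proj₂ (⟨⟩V⁻ (elemV g (elem I (λ i → ⟨ c i , F i ⟩) i)))

    rangeV : Fam F → V (sup I F)
    rangeV {F} g = imageV I c Vc F (famV g) (⟨ v1 , v0 ⟩∈ᴰ v2) (g ∷ []) λ i y _ → fam∈

    constFam : ∀ {a} → V a → Fam (λ _ → a)
    constFam Va = graphV I c Vc _ (λ _ → Va) (v0 ≐ᴰ v2) (Va ∷ []) λ i y _ → mk⇔ id id

    pairFam : Fam F → Fam G → Fam (λ i → ⟨ F i , G i ⟩)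
    pairFam {F} {G} f g = graphV I c Vc _ (λ i → ⟨⟩V (famV f i) (famV g i))
      (∃ᴰ ∃ᴰ (⟨ v3 , v1 ⟩∈ᴰ v4 ∧ᴰ ⟨ v3 , v0 ⟩∈ᴰ v5 ∧ᴰ v2 ≐⟨ v1 , v0 ⟩ᴰ)) (f ∷ g ∷ [])
      λ i y Vy → mk⇔
        (λ (a , _ , b , _ , p , q , e) → ≐-trans e (⟨⟩-cong (to fam∈ p) (to fam∈ q)))
        (λ e → F i , famV f i , G i , famV g i , from fam∈ (≐-refl _) , from fam∈ (≐-refl _) , e)

    tupleFam : ∀ {n} {Fs : Fin n → I → 𝕍} → (∀ j → Fam (Fs j)) → Fam (λ i → tuple (tabulate λ j → Fs j i))
    tupleFam {zero}  fs = constFam (numV 0)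
    tupleFam {suc n} fs = pairFam (fs zero) (tupleFam (fs ∘ suc))

  open Families ℕ num (λ i j → num-inj) ωV public
  cons : 𝕍 → (ℕ → 𝕍) → ℕ → 𝕍
  cons a F zero    = a
  cons a F (suc n) = F n

  consFam : ∀ {a F} → V a → Fam F → Fam (cons a F)
  consFam {a} {F} Va fam = graphV ℕ num ωV (cons a F) (λ { zero → Va ; (suc n) → famV fam n })
    (v1 ≐ᴰ v2 ∧ᴰ v0 ≐ᴰ v3 ∨ᴰ ∃ᴰ (succᴰ v2 v0 ∧ᴰ ⟨ v0 , v1 ⟩∈ᴰ v5)) (numV 0 ∷ Va ∷ fam ∷ [])
    λ { zero y _ → mk⇔ [ proj₂ , (λ (k , _ , e , _) → ⊥-elim (succ≢∅ {∅} {k} e (≐-refl ∅))) ]′ (λ e → inj₁ (≐-refl ∅ , e))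
      ; (suc n) y _ → mk⇔ [ (λ (e , _) → ⊥-elim (succ≢∅ (≐-refl (succ (num n))) e))
                          , (λ (k , _ , e , p) → to (famAt {F} {k} {n} (num-suc {n} e)) p) ]′
                          (λ e → inj₂ (num n , numV n , ≐-refl (succ (num n)) , from (fam∈ {F} {n}) e)) }

  module Fam² = Families (ℕ × ℕ) num² num²-inj (prodV ωV ωV)
  open Fam² using () renaming (Fam to Fam²; fam∈ to fam²∈; famAt to fam²At) public

  orbitFam : Fam (λ n → num² (orbit n))
  orbitFam = recursionV (λ n → num² (orbit n)) (λ n → num²V (orbit n))
    (∃ᴰ ∃ᴰ (v3 ≐⟨ v1 , v0 ⟩ᴰ ∧ᴰ
        ((∃ᴰ ∃ᴰ (succᴰ v2 v1 ∧ᴰ succᴰ v0 v3 ∧ᴰ v4 ≐⟨ v0 , v1 ⟩ᴰ))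
         ∨ᴰ (v0 ≐ᴰ v4 ∧ᴰ ∃ᴰ (succᴰ v0 v2 ∧ᴰ v3 ≐⟨ v5 , v0 ⟩ᴰ)))))
    (numV 0 ∷ [])
    λ n y Vy → step (orbit n) y
    where
    num²V : ∀ p → V (num² p)
    num²V (k , j) = ⟨⟩V (numV k) (numV j)
    Step : 𝕍 → 𝕍 → Set₁
    Step y p = ∃[ k ] V k × (∃[ j ] V j × p ≐ ⟨ k , j ⟩ ×
       ((∃[ j′ ] V j′ × (∃[ k′ ] V k′ × j ≐ succ j′ × k′ ≐ succ k × y ≐ ⟨ k′ , j′ ⟩))
        ⊎ (j ≐ num 0 × (∃[ k′ ] V k′ × k′ ≐ succ k × y ≐ ⟨ num 0 , k′ ⟩))))
    step : ∀ p y → Step y (num² p) ⇔ y ≐ num² (next p)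
    step (k , zero) y = mk⇔
      (λ { (a , _ , b , _ , e , inj₁ (j′ , _ , k′ , _ , p , _)) → ⊥-elim (succ≢∅ p (≐-sym (⟨⟩-injʳ e)))
         ; (a , _ , b , _ , e , inj₂ (_ , k′ , _ , p , q)) →
             ≐-trans q (⟨⟩-cong (≐-refl _) (≐-trans p (succ-cong (≐-sym (⟨⟩-injˡ e))))) })
      (λ e → num k , numV k , num 0 , numV 0 , ≐-refl _ , inj₂ (≐-refl _ , num (suc k) , numV (suc k) , ≐-refl _ , e))
    step (k , suc j) y = mk⇔
      (λ { (a , _ , b , _ , e , inj₁ (j′ , _ , k′ , _ , p , q , r)) →
             ≐-trans r (⟨⟩-cong (≐-trans q (succ-cong (≐-sym (⟨⟩-injˡ e)))) (num-suc {j} (≐-trans (⟨⟩-injʳ e) p)))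
         ; (a , _ , b , _ , e , inj₂ (p , _)) → ⊥-elim (succ≢∅ (≐-refl (succ (num j))) (≐-trans (⟨⟩-injʳ e) p)) })
      (λ e → num k , numV k , num (suc j) , numV (suc j) , ≐-refl _
           , inj₁ (num j , numV j , num (suc k) , numV (suc k) , ≐-refl _ , ≐-refl _ , e))

  idxNum : ℕ × ℕ → 𝕍
  idxNum (k , j) = num (idx k j)

  -- `idx` inverts `orbit`, which is injective, so its graph is the converse of the one already
  -- found in V.
  idxFam : Fam² idxNum
  idxFam = graphV (ℕ × ℕ) num² (prodV ωV ωV) _ (λ (k , j) → numV (idx k j)) (⟨ v0 , v1 ⟩∈ᴰ v2) (orbitFam ∷ [])
    λ { (k , j) y _ → mk⇔
      (λ (n , e) → ≐-trans (⟨⟩-injˡ e) (≡⇒≐ (cong num (orbit-inj n (idx k j)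
         (trans (sym (num²-inj (k , j) (orbit n) (⟨⟩-injʳ e))) (sym (orbit-idx k j)))))))
      (λ e → idx k j , ⟨⟩-cong e (≡⇒≐ (cong num² (sym (orbit-idx k j))))) }

-- Choice in V, and an array of distinct points of X.

module Choosing (em : ExcludedMiddle (lsuc 0ℓ)) (V : Class) (isModel : IsTransitiveModel V) where
  open IsTransitiveModel isModel
  open Recursion V isModel public

  -- Uniqueness is asked only among members of `S`, because a selector provided by the axiom of
  -- choice may contain unrelated elements.
  Choosing-from : 𝕍 → 𝕍 → Set₁
  Choosing-from a c = ∀ S → V S → S ⊆ a → (∃[ x ] x ∈ S) →
    ∃[ x ] x ∈ S × ⟨ S , x ⟩ ∈ c × (∀ y → y ∈ S → ⟨ S , y ⟩ ∈ c → y ≐ x)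

  abstract
    -- The axiom provides selectors for disjoint families only. Multiplying each nonempty subset `S`
    -- by its own singleton makes the family disjoint, and the selected pairs already form the graph
    -- of a choice function.
    choiceFunction : ∀ {a} → V a → ∃[ c ] V c × Choosing-from a c
    choiceFunction {a} Va with powV Va
    ... | p , Vp , inP with sep (∃∈ᴰ v0 (v0 ≐ᴰ v0)) [] Vp
    ... | sup I S , VI , eI = finish (choice family familyV nonempty disjoint)
      where
      cell : I → 𝕍
      cell i = prod ⁅ S i , S i ⁆ (S i)
      SV : ∀ i → V (S i)
      SV i = elemV VI (elem I S i)
      cell⁻ : ∀ i {t} → t ∈ cell i → ∃[ x ] x ∈ S i × t ≐ ⟨ S i , x ⟩
      cell⁻ i t∈ = let s , x , e , s∈ , x∈ = ∈-prod⁻ ⁅ S i , S i ⁆ (S i) t∈ in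
                   x , x∈ , ≐-trans e (⟨⟩-cong ([ id , id ]′ (∈⁅⁆⁻ s∈)) (≐-refl x))
      cell⁺ : ∀ i {x} → x ∈ S i → ⟨ S i , x ⟩ ∈ cell i
      cell⁺ i x∈ = ∈-prod⁺ {⁅ S i , S i ⁆} {S i} (∈⁅⁆ˡ (≐-refl _)) x∈
      family : 𝕍
      family = sup I cell
      cellV : ∀ i → V (cell i)
      cellV i = prodV (pairV (SV i) (SV i)) (SV i)
      familyV : V family
      familyV = imageV I S VI cell cellV
        (∀∈ᴰ v0 (∃∈ᴰ v2 (v1 ≐⟨ v3 , v0 ⟩ᴰ)) ∧ᴰ ∀∈ᴰ v1 (⟨ v2 , v0 ⟩∈ᴰ v1)) []
        λ i z Vz → mk⇔
          (λ (f , g) → ext {z} {cell i} (λ t t∈ → let q = proj₂ (f t t∈) in ∈-respˡ (≐-sym (proj₂ q)) (cell⁺ i (proj₁ q)))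
                           (λ t t∈ → let x , x∈ , e = cell⁻ i t∈ in ∈-respˡ (≐-sym e) (g x x∈)))
          (λ e → (λ t t∈ → cell⁻ i (∈-respʳ e t∈)) , λ x x∈ → ∈-respʳ (≐-sym e) (cell⁺ i x∈))
      nonempty : ∀ x → V x → x ∈ family → ∃[ y ] V y × y ∈ x
      nonempty x Vx (i , e) = let _ , y , y∈ , _ = to (eI (S i)) (elem I S i) in
        ⟨ S i , y ⟩ , ⟨⟩V (SV i) (elemV (SV i) y∈) , ∈-respʳ (≐-sym e) (cell⁺ i y∈)
      disjoint : ∀ x y z → V x → V y → V z → x ∈ family → y ∈ family → z ∈ x → z ∈ y → x ≐ y
      disjoint x y z _ _ _ (i , e) (j , e′) z∈x z∈y =
        let _ , _ , p = cell⁻ i (∈-respʳ e z∈x)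
            _ , _ , q = cell⁻ j (∈-respʳ e′ z∈y)
            s = ⟨⟩-injˡ (≐-trans (≐-sym p) q)
        in ≐-trans e (≐-trans (ext (half i j s) (half j i (≐-sym s))) (≐-sym e′))
        where
        half : ∀ i j → S i ≐ S j → ∀ t → t ∈ cell i → t ∈ cell j
        half i j s t t∈ = let x , x∈ , q = cell⁻ i t∈ in
          ∈-respˡ (≐-sym (≐-trans q (⟨⟩-cong s (≐-refl x)))) (cell⁺ j (∈-respʳ s x∈))
      finish : (∃[ c ] V c × (∀ x → V x → x ∈ family → ∃[ y ] V y × y ∈ x × y ∈ c
                 × (∀ y′ → V y′ → y′ ∈ x → y′ ∈ c → y′ ≐ y))) →
               ∃[ c ] V c × Choosing-from a c
      finish (c , Vc , pick) = c , Vc , λ T VT T⊆a (x₀ , x₀∈) →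
        let i , T≐ = from (eI T) (inP T VT T⊆a , x₀ , x₀∈ , ≐-refl x₀)
            y , _ , y∈ , y∈c , uniq = pick (cell i) (cellV i) (elem I cell i)
            x , x∈ , y≐ = cell⁻ i y∈
        in x , ∈-respʳ (≐-sym T≐) x∈ , ∈-respˡ (≐-trans y≐ (⟨⟩-cong (≐-sym T≐) (≐-refl x))) y∈c
           , λ w w∈ w∈c →
               let w∈S = ∈-respʳ T≐ w∈
               in ⟨⟩-injʳ (≐-trans (uniq ⟨ S i , w ⟩ (⟨⟩V (SV i) (elemV (SV i) w∈S)) (cell⁺ i w∈S)
                                       (∈-respˡ (⟨⟩-cong T≐ (≐-refl w)) w∈c)) y≐)

  module Sequence {X} (VX : V X) (infinite : Infinite V X) where
    private
      c  = proj₁ (choiceFunction VX)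
      Vc = proj₁ (proj₂ (choiceFunction VX))

      -- The points taken so far are recorded because an exhausted `S` would turn them into a
      -- bijection in V from a numeral onto X, against the infinity of X.
      record State (n : ℕ) : Set₁ where
        field
          S      : 𝕍
          S∈V    : V S
          S⊆X    : S ⊆ X
          used   : Fin n → 𝕍
          used∈X : ∀ i → used i ∈ X
          inj    : ∀ i j → used i ≐ used j → i ≡ j
          used∉S : ∀ i → ¬ (used i ∈ S)
          cover  : ∀ x → x ∈ X → x ∈ S ⊎ (∃[ i ] x ≐ used i)

        nonempty : ∃[ x ] x ∈ S
        nonempty with em {P = ∃[ x ] x ∈ S}
        ... | yes p = p
        ... | no ¬p = ⊥-elim (infinite (n , f , fV , (isMap , fInj) , (isMap , fSurj)))
          where
          f = vecSet (tabulate λ i → ⟨ num (toℕ i) , used i ⟩)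
          fV : V f
          fV = vecSetV (tabV {f = λ i → ⟨ num (toℕ i) , used i ⟩} λ i → ⟨⟩V (numV (toℕ i)) (elemV VX (used∈X i)))
          f⁻ : ∀ {z} → z ∈ f → ∃[ i ] z ≐ ⟨ num (toℕ i) , used i ⟩
          f⁻ (i , e) = i , ≐-trans e (≡⇒≐ (Vec.lookup∘tabulate _ i))
          f⁺ : ∀ i → ⟨ num (toℕ i) , used i ⟩ ∈ f
          f⁺ i = i , ≡⇒≐ (sym (Vec.lookup∘tabulate _ i))
          covered : ∀ y → y ∈ X → ∃[ i ] y ≐ used i
          covered y y∈ = [ (λ q → ⊥-elim (¬p (y , q))) , id ]′ (cover y y∈)
          isMap : IsMap f (num n) (_∈ X)
          isMap = (λ z z∈ → let i , e = f⁻ z∈ in num (toℕ i) , used i , e , num-∈ (Fin.toℕ<n i) , used∈X i)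
                , (λ x x∈ → let m , m<n , e = ∈-num⁻ n x∈ ; i = fromℕ< m<n in
                     used i , ∈-respˡ (⟨⟩-cong (≐-trans (≡⇒≐ (cong num (Fin.toℕ-fromℕ< m<n))) (≐-sym e)) (≐-refl _)) (f⁺ i))
                , (λ x y y′ p q → let i , e = f⁻ p ; j , e′ = f⁻ q
                                      i≡j = Fin.toℕ-injective (num-inj (≐-trans (≐-sym (⟨⟩-injˡ e)) (⟨⟩-injˡ e′))) in
                     ≐-trans (⟨⟩-injʳ e) (≐-trans (≡⇒≐ (cong used i≡j)) (≐-sym (⟨⟩-injʳ e′))))
          fInj : ∀ x x′ y → ⟨ x , y ⟩ ∈ f → ⟨ x′ , y ⟩ ∈ f → x ≐ x′
          fInj x x′ y p q = let i , e = f⁻ p ; j , e′ = f⁻ q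
                                i≡j = inj i j (≐-trans (≐-sym (⟨⟩-injʳ e)) (⟨⟩-injʳ e′)) in
            ≐-trans (⟨⟩-injˡ e) (≐-trans (≡⇒≐ (cong (λ i → num (toℕ i)) i≡j)) (≐-sym (⟨⟩-injˡ e′)))
          fSurj : ∀ y → y ∈ X → ∃[ x ] ⟨ x , y ⟩ ∈ f
          fSurj y y∈ = let i , e = covered y y∈ in num (toℕ i) , ∈-respˡ (⟨⟩-cong (≐-refl _) (≐-sym e)) (f⁺ i)

        chosen : ∃[ x ] x ∈ S × ⟨ S , x ⟩ ∈ c × (∀ y → y ∈ S → ⟨ S , y ⟩ ∈ c → y ≐ x)
        chosen = proj₂ (proj₂ (choiceFunction VX)) S S∈V S⊆X nonempty

        pt : 𝕍
        pt = proj₁ chosen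
        pt∈S : pt ∈ S
        pt∈S = proj₁ (proj₂ chosen)

        rest : ∃[ b ] V b × (∀ x → x ∈ b ⇔ (x ∈ S × ¬ (x ≐ pt)))
        rest = sep (¬ᴰ (v0 ≐ᴰ v1)) (elemV S∈V pt∈S ∷ []) S∈V

      open State

      initial : State 0
      initial = record { S = X ; S∈V = VX ; S⊆X = λ _ → id ; used = λ () ; used∈X = λ () ; inj = λ ()
                       ; used∉S = λ () ; cover = λ x → inj₁ }

      advance : ∀ {n} → State n → State (suc n)
      advance s = record
        { S = proj₁ (rest s) ; S∈V = proj₁ (proj₂ (rest s))
        ; S⊆X = λ z z∈ → S⊆X s z (proj₁ (to (e z) z∈))
        ; used = used′
        ; used∈X = λ { zero → S⊆X s _ (pt∈S s) ; (suc i) → used∈X s i }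
        ; inj = λ { zero zero _ → refl
                  ; zero (suc j) q → ⊥-elim (used∉S s j (∈-respˡ q (pt∈S s)))
                  ; (suc i) zero q → ⊥-elim (used∉S s i (∈-respˡ (≐-sym q) (pt∈S s)))
                  ; (suc i) (suc j) q → cong suc (inj s i j q) }
        ; used∉S = λ { zero q → proj₂ (to (e _) q) (≐-refl _)
                     ; (suc i) q → used∉S s i (proj₁ (to (e _) q)) }
        ; cover = cov }
        where
        e = proj₂ (proj₂ (rest s))
        used′ : Fin _ → 𝕍
        used′ zero    = pt s
        used′ (suc i) = used s i
        cov : ∀ x → x ∈ X → x ∈ proj₁ (rest s) ⊎ (∃[ i ] x ≐ used′ i)
        cov x x∈ with em {P = Lift (lsuc 0ℓ) (x ≐ pt s)}
        ... | yes (lift q) = inj₂ (zero , q)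
        ... | no ¬q with cover s x x∈
        ... | inj₁ r = inj₁ (from (e x) (r , ¬q ∘ lift))
        ... | inj₂ (i , q) = inj₂ (suc i , q)

      state : ∀ n → State n
      state zero    = initial
      state (suc n) = advance (state n)

      stage : ℕ → 𝕍
      stage n = S (state n)

      stage-suc : ∀ n x → x ∈ stage (suc n) ⇔ (x ∈ stage n × ¬ (x ≐ pt (state n)))
      stage-suc n = proj₂ (proj₂ (rest (state n)))

      -- The recursion runs on the sets of remaining points rather than on the points: the next set
      -- depends on the previous one and the choice function alone, whereas the next point depends
      -- on all earlier points.
      stageFam : Fam stage
      stageFam = recursionV stage (λ n → S∈V (state n))
        (∃∈ᴰ v1 (⟨ v2 , v0 ⟩∈ᴰ v3 ∧ᴰ ∀∈ᴰ v1 (v0 ∈ᴰ v3 ∧ᴰ ¬ᴰ (v0 ≐ᴰ v1))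
                ∧ᴰ ∀∈ᴰ v2 (¬ᴰ (v0 ≐ᴰ v1) ⇒ᴰ v0 ∈ᴰ v2))) (Vc ∷ [])
        λ n y Vy → mk⇔
          (λ (x , x∈ , x∈c , f , g) → let x≐ = proj₂ (proj₂ (proj₂ (chosen (state n)))) x x∈ x∈c in ext
            (λ z z∈ → from (stage-suc n z) (proj₁ (f z z∈) , λ q → proj₂ (f z z∈) (≐-trans q (≐-sym x≐))))
            (λ z z∈ → let p , q = to (stage-suc n z) z∈ in g z p λ r → q (≐-trans r x≐)))
          (λ e → pt (state n) , pt∈S (state n) , proj₁ (proj₂ (proj₂ (chosen (state n))))
            , (λ z z∈ → to (stage-suc n z) (∈-respʳ e z∈))
            , (λ z p q → ∈-respʳ (≐-sym e) (from (stage-suc n z) (p , q))))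

      stage-anti : ∀ {m n} → m ℕ.≤′ n → stage n ⊆ stage m
      stage-anti ℕ.≤′-refl x x∈ = x∈
      stage-anti (ℕ.≤′-step m≤n) x x∈ = stage-anti m≤n x (proj₁ (to (stage-suc _ x) x∈))

    point : ℕ → 𝕍
    point n = pt (state n)

    point∈X : ∀ n → point n ∈ X
    point∈X n = S⊆X (state n) _ (pt∈S (state n))

    private
      point≢ : ∀ {m n} → m ℕ.< n → ¬ (point m ≐ point n)
      point≢ {m} {n} m<n e =
        proj₂ (to (stage-suc m _) (stage-anti (ℕ.≤⇒≤′ m<n) _ (pt∈S (state n)))) (≐-sym e)

    point-inj : ∀ m n → point m ≐ point n → m ≡ n
    point-inj m n e with ℕ.<-cmp m n
    ... | tri< m<n _ _ = ⊥-elim (point≢ m<n e)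
    ... | tri≈ _ m≡n _ = m≡n
    ... | tri> _ _ n<m = ⊥-elim (point≢ n<m (≐-sym e))

    pointFam : Fam point
    pointFam = graphV ℕ num ωV point (λ n → elemV VX (point∈X n))
      (∃ᴰ (⟨ v2 , v0 ⟩∈ᴰ v3 ∧ᴰ v1 ∈ᴰ v0 ∧ᴰ ⟨ v0 , v1 ⟩∈ᴰ v4)) (stageFam ∷ Vc ∷ [])
      λ n y Vy → mk⇔
        (λ (T , _ , p , y∈ , q) → let T≐ = to (fam∈ {F = stage} {n}) p in
           proj₂ (proj₂ (proj₂ (chosen (state n)))) y (∈-respʳ T≐ y∈) (∈-respˡ (⟨⟩-cong T≐ (≐-refl y)) q))
        (λ e → stage n , S∈V (state n) , from (fam∈ {F = stage} {n}) (≐-refl _) , ∈-respˡ (≐-sym e) (pt∈S (state n))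
          , ∈-respˡ (⟨⟩-cong (≐-refl (stage n)) (≐-sym e)) (proj₁ (proj₂ (proj₂ (chosen (state n))))))

    grid : ℕ × ℕ → 𝕍
    grid (k , i) = point (idx k i)

    cells : 𝕍
    cells = graph (ℕ × ℕ) num² grid

    gridFam : Fam² grid
    gridFam = graphV (ℕ × ℕ) num² (prodV ωV ωV) grid (λ (k , i) → elemV VX (point∈X (idx k i)))
      (∃ᴰ (⟨ v2 , v0 ⟩∈ᴰ v3 ∧ᴰ ⟨ v0 , v1 ⟩∈ᴰ v4)) (idxFam ∷ pointFam ∷ [])
      λ { (k , i) y Vy → mk⇔
        (λ (n , _ , p , q) → to (fam∈ {i = idx k i}) (∈-respˡ (⟨⟩-cong (to (fam²∈ {i = k , i}) p) (≐-refl y)) q))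
        (λ e → num (idx k i) , numV (idx k i) , from (fam²∈ {i = k , i}) (≐-refl _) , from (fam∈ {i = idx k i}) e) }

    grid-inj : ∀ p q → grid p ≐ grid q → p ≡ q
    grid-inj (k , i) (k′ , i′) e = idx-inj (point-inj _ _ e)

-- Structures in V and strong amalgamation

MapsTo : 𝕍 → 𝕍 → 𝕍 → Set
MapsTo f a b = ⟨ a , b ⟩ ∈ f

pwExt : ∀ {R : 𝕍 → 𝕍 → Set ℓ} {v w : Vec 𝕍 n} → (∀ i → R (lookup v i) (lookup w i)) → Pointwise R v w
pwExt {v = []}     {[]}     r = []
pwExt {v = x ∷ v}  {y ∷ w}  r = r zero ∷ pwExt (r ∘ suc)

allExt : ∀ {P : 𝕍 → Set ℓ} {v : Vec 𝕍 n} → (∀ i → P (lookup v i)) → VecAll.All P v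
allExt {v = []}    p = []
allExt {v = x ∷ v} p = p zero ∷ allExt (p ∘ suc)

allLookup : ∀ {P : 𝕍 → Set ℓ} {v : Vec 𝕍 n} → VecAll.All P v → ∀ i → P (lookup v i)
allLookup (p ∷ ps) zero    = p
allLookup (p ∷ ps) (suc i) = allLookup ps i

holds⇔ : ∀ {M A I R} {v : Vec 𝕍 n} → M ≐ ⟨ A , I ⟩ → Holds M R v ⇔ ⟨ R , tuple v ⟩ ∈ I
holds⇔ {A = A} {I} e = mk⇔
  (λ (A′ , I′ , e′ , p) → ∈-respʳ (⟨⟩-injʳ {A′} {A} {I′} {I} (≐-trans (≐-sym e′) e)) p)
  (λ p → A , I , e , p)

carrier-unique : ∀ {L A B M} → IsStr L A M → IsStr L B M → A ≐ B
carrier-unique {A = A} {B} (I , e , _) (J , e′ , _) = ⟨⟩-injˡ {A} {B} {I} {J} (≐-trans (≐-sym e) e′)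

holds⇒∈ : ∀ {L A M R} {v : Vec 𝕍 n} → IsStr L A M → Holds M R v → VecAll.All (_∈ A) v
holds⇒∈ {A = A} {v = v} (I , e , f) h = case f _ (to (holds⇔ e) h) of λ (R′ , n′ , v′ , ar , v′∈ , z≐) →
  go v′ v′∈ (tuple-inj v v′ (⟨⟩-injʳ z≐))
  where
  go : ∀ {n′} (v′ : Vec 𝕍 n′) → VecAll.All (_∈ A) v′ →
       (Σ (_ ≡ n′) λ e → Pointwise _≐_ (subst (Vec 𝕍) e v) v′) → VecAll.All (_∈ A) v
  go v′ v′∈ (refl , es) = allExt λ i → ∈-respˡ (≐-sym (PW.lookup es i)) (allLookup v′∈ i)

mapVec : ∀ {f A B} → IsMap f A (_∈ B) → (v : Vec 𝕍 n) → VecAll.All (_∈ A) v →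
         ∃[ w ] Pointwise (MapsTo f) {n} {n} v w
mapVec f [] [] = [] , []
mapVec f@(_ , tot , _) (x ∷ v) (x∈ ∷ v∈) =
  let y , p = tot x x∈ ; w , ps = mapVec f v v∈ in y ∷ w , p ∷ ps

map-codomain : ∀ {f A B x y} → IsMap f A (_∈ B) → ⟨ x , y ⟩ ∈ f → x ∈ A × y ∈ B
map-codomain (g , _) p = let x′ , y′ , e , x∈ , y∈ = g _ p in
  ∈-respˡ (≐-sym (⟨⟩-injˡ e)) x∈ , ∈-respˡ (≐-sym (⟨⟩-injʳ e)) y∈

module Structures (V : Class) (isModel : IsTransitiveModel V) where
  open IsTransitiveModel isModel
  open Recursion V isModel public

  abstract
    unionV : ∀ {x} → V x → ∃[ u ] V u × (∀ z → z ∈ u ⇔ (∃[ y ] y ∈ x × z ∈ y))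
    unionV {x} Vx with union x Vx
    ... | u , Vu , e = u , Vu , λ z → mk⇔
      (λ z∈ → let y , _ , p = to (e z (elemV Vu z∈)) z∈ in y , p)
      (λ (y , y∈ , z∈) → let Vy = elemV Vx y∈ in from (e z (elemV Vy z∈)) (y , Vy , y∈ , z∈))

  abstract
    fieldV : ∀ {f} → V f → ∃[ D ] V D × (∀ x y → ⟨ x , y ⟩ ∈ f → x ∈ D × y ∈ D)
    fieldV Vf with unionV Vf
    ... | u , Vu , eu with unionV Vu
    ... | D , VD , eD = D , VD , λ x y p →
      let s∈ = from (eu ⁅ x , y ⁆) (⟨ x , y ⟩ , p , ∈⁅⁆ʳ (≐-refl _)) in
      from (eD x) (_ , s∈ , ∈⁅⁆ˡ (≐-refl x)) , from (eD y) (_ , s∈ , ∈⁅⁆ʳ (≐-refl y))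

  abstract
    relationV : {P : Vec 𝕍 (suc (suc n)) → Set ℓ} → Dfn P → ∀ {ρ} → AllV ρ → ∀ {A B} → V A → V B →
      ∃[ f ] V f × (∀ x y → ⟨ x , y ⟩ ∈ f ⇔ (x ∈ A × y ∈ B × P (x ∷ y ∷ ρ)))
                 × (∀ z → z ∈ f → ∃[ x ] ∃[ y ] z ≐ ⟨ x , y ⟩ × x ∈ A × y ∈ B)
    relationV {n = n} {P = P} d {ρ} vs {A} {B} VA VB = f , proj₁ (proj₂ all)
      , (λ x y → mk⇔ (fwd x y) (bwd x y)) , λ z z∈ → ∈-prod⁻ A B (proj₁ (to (f⇔ z) z∈))
      where
      all : ∃[ f ] V f × (∀ z → z ∈ f ⇔ (z ∈ prod A B × (∃[ y ] V y × (∃[ x ] V x × z ≐ ⟨ y , x ⟩ × P (y ∷ x ∷ ρ)))))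
      all = sep (∃ᴰ ∃ᴰ (v2 ≐⟨ v1 , v0 ⟩ᴰ ∧ᴰ shiftᴰ 3 (v1 ∷ v0 ∷ []) d)) vs (prodV VA VB)
      f : 𝕍
      f = proj₁ all
      f⇔ : ∀ z → z ∈ f ⇔ (z ∈ prod A B × (∃[ y ] V y × (∃[ x ] V x × z ≐ ⟨ y , x ⟩ × P (y ∷ x ∷ ρ))))
      f⇔ = proj₂ (proj₂ all)
      fwd : ∀ x y → ⟨ x , y ⟩ ∈ f → x ∈ A × y ∈ B × P (x ∷ y ∷ ρ)
      fwd x y p = case to (f⇔ ⟨ x , y ⟩) p of λ (q , x′ , Vx′ , y′ , Vy′ , r , s) →
                  case ∈-prod⁻ A B q of λ (a , b , t , a∈ , b∈) →
                    let x∈ = ∈-respˡ (≐-sym (⟨⟩-injˡ {x} {a} {y} {b} t)) a∈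
                        y∈ = ∈-respˡ (≐-sym (⟨⟩-injʳ {x} {a} {y} {b} t)) b∈
                    in x∈ , y∈ , resp d (Vx′ ∷ Vy′ ∷ vs) (elemV VA x∈ ∷ elemV VB y∈ ∷ vs)
                    (≐-sym (⟨⟩-injˡ {x} {x′} {y} {y′} r) ∷ ≐-sym (⟨⟩-injʳ {x} {x′} {y} {y′} r) ∷ ≐*-refl)
                    s
      bwd : ∀ x y → x ∈ A × y ∈ B × P (x ∷ y ∷ ρ) → ⟨ x , y ⟩ ∈ f
      bwd x y (x∈ , y∈ , p) = from (f⇔ ⟨ x , y ⟩) (∈-prod⁺ {A} {B} x∈ y∈ , x , elemV VA x∈ , y , elemV VB y∈ , ≐-refl _
             , p)

  private
    module TupleMap {I : Set} {a b : I → 𝕍} (Vh : V (sup I λ i → ⟨ a i , b i ⟩)) where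
      code : Vec I n → 𝕍
      code is = ⟨ tuple (Vec.map a is) , tuple (Vec.map b is) ⟩

      T : ℕ → 𝕍
      T n = sup (Vec I n) code

      pt : I → 𝕍
      pt i = ⟨ a i , b i ⟩

      -- Says that `z` arises from the pair of tuples `q` by prepending the two coordinates of `p`
      -- to its two components. Every intermediate set is named so that a formula can speak of it.
      link : 𝕍 → 𝕍 → 𝕍 → Set₁
      link z p q = ∃[ x ] V x × (∃[ y ] V y × (∃[ s ] V s × (∃[ t ] V t ×
        (∃[ xs ] V xs × (∃[ yt ] V yt × p ≐ ⟨ x , y ⟩ × q ≐ ⟨ s , t ⟩ × xs ≐ ⟨ x , s ⟩ × yt ≐ ⟨ y , t ⟩ × z ≐ ⟨ xs , yt ⟩)))))
      linkᴰ : (i j k : Fin n) → Dfn (λ ρ → link (lookup ρ i) (lookup ρ j) (lookup ρ k))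
      linkᴰ i j k = ∃ᴰ ∃ᴰ ∃ᴰ ∃ᴰ ∃ᴰ ∃ᴰ (up j ≐⟨ v5 , v4 ⟩ᴰ ∧ᴰ up k ≐⟨ v3 , v2 ⟩ᴰ ∧ᴰ v1 ≐⟨ v5 , v3 ⟩ᴰ
                      ∧ᴰ v0 ≐⟨ v4 , v2 ⟩ᴰ ∧ᴰ up i ≐⟨ v1 , v0 ⟩ᴰ)
        where
        up : Fin n → Fin (suc (suc (suc (suc (suc (suc n))))))
        up i = suc (suc (suc (suc (suc (suc i)))))
      stepᴰ : Dfn {n = 3} (λ ρ → (∀ z → z ∈ lookup ρ v0 → ∃[ p ] p ∈ lookup ρ v2 × (∃[ q ] q ∈ lookup ρ v1 × link z p q))
                       × (∀ p → p ∈ lookup ρ v2 → ∀ q → q ∈ lookup ρ v1 → ∃[ z ] z ∈ lookup ρ v0 × link z p q))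
      stepᴰ = ∀∈ᴰ v0 (∃∈ᴰ v3 (∃∈ᴰ v3 (linkᴰ v2 v1 v0))) ∧ᴰ ∀∈ᴰ v2 (∀∈ᴰ v2 (∃∈ᴰ v2 (linkᴰ v0 v2 v1)))

      aV : ∀ i → V (a i)
      aV i = proj₁ (⟨⟩V⁻ (elemV Vh (elem I pt i)))
      bV : ∀ i → V (b i)
      bV i = proj₂ (⟨⟩V⁻ (elemV Vh (elem I pt i)))
      tupV : {f : I → 𝕍} → (∀ i → V (f i)) → (is : Vec I n) → V (tuple (Vec.map f is))
      tupV fV []       = numV 0
      tupV fV (i ∷ is) = ⟨⟩V (fV i) (tupV fV is)

      link⁻ : ∀ {z p q i} {is : Vec I n} → link z p q → p ≐ pt i → q ≐ code is → z ≐ code (i ∷ is)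
      link⁻ (x , _ , y , _ , s , _ , t , _ , xs , _ , yt , _ , p≐ , q≐ , e₁ , e₂ , e) p≐′ q≐′ =
        let p′ = ≐-trans (≐-sym p≐) p≐′ ; q′ = ≐-trans (≐-sym q≐) q≐′ in
        ≐-trans e (⟨⟩-cong (≐-trans e₁ (⟨⟩-cong (⟨⟩-injˡ p′) (⟨⟩-injˡ q′)))
                           (≐-trans e₂ (⟨⟩-cong (⟨⟩-injʳ p′) (⟨⟩-injʳ q′))))
      link⁺ : ∀ {z p q i} {is : Vec I n} → p ≐ pt i → q ≐ code is → z ≐ code (i ∷ is) → link z p q
      link⁺ {i = i} {is} p≐ q≐ z≐ = a i , aV i , b i , bV i , tuple (Vec.map a is) , tupV aV is , tuple (Vec.map b is) , tupV bV is
        , ⟨ a i , tuple (Vec.map a is) ⟩ , tupV aV (i ∷ is) , ⟨ b i , tuple (Vec.map b is) ⟩ , tupV bV (i ∷ is) , p≐ , q≐ , ≐-refl _ , ≐-refl _ , z≐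

      TV : ∀ n → V (T n)
      TV zero = respects _ _ (ext
        (λ z z∈ → [] , [ id , id ]′ (∈⁅⁆⁻ z∈)) (λ { z ([] , e) → ∈⁅⁆ˡ e })) (pairV (numV-pair) (numV-pair))
        where numV-pair = ⟨⟩V (numV 0) (numV 0)
      TV (suc n) = respects (sup (I × Vec I n) λ (i , is) → code (i ∷ is)) _
        (ext (λ { z ((i , is) , e) → i ∷ is , e }) (λ { z (i ∷ is , e) → (i , is) , e }))
        (imageV (I × Vec I n) (λ (i , is) → ⟨ pt i , code is ⟩) (prodV Vh (TV n)) (λ (i , is) → code (i ∷ is))
          (λ (i , is) → ⟨⟩V (tupV aV (i ∷ is)) (tupV bV (i ∷ is)))
          (∃ᴰ ∃ᴰ (v3 ≐⟨ v1 , v0 ⟩ᴰ ∧ᴰ linkᴰ v2 v1 v0)) []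
          λ (i , is) z Vz → mk⇔
            (λ (p , _ , q , _ , e , l) → link⁻ {is = is} l (≐-sym (⟨⟩-injˡ e)) (≐-sym (⟨⟩-injʳ e)))
            (λ e → pt i , elemV Vh (elem I pt i) , code is , elemV (TV n) (elem (Vec I n) code is) , ≐-refl _
                 , link⁺ {is = is} (≐-refl _) (≐-refl _) e))

      TFam : Fam T
      TFam = recursionV T TV stepᴰ (Vh ∷ []) λ n y Vy → mk⇔
        (λ (f , g) → ext {y} {T (suc n)}
          (λ z z∈ → fwd n z (f z z∈))
          (λ { z (i ∷ is , e) → let q = g (pt i) (elem I pt i) (code is) (elem (Vec I n) code is) in
                 ∈-respˡ (≐-trans (link⁻ {is = is} (proj₂ (proj₂ q)) (≐-refl _) (≐-refl _)) (≐-sym e)) (proj₁ (proj₂ q)) }))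
        (λ e → (λ z z∈ → bwd n z (∈-respʳ e z∈))
             , λ { p (i , p≐) q (is , q≐) → code (i ∷ is) , ∈-respʳ (≐-sym e) (elem (Vec I (suc n)) code (i ∷ is))
                                          , link⁺ {is = is} p≐ q≐ (≐-refl _) })
        where
        fwd : ∀ n z → (∃[ p ] p ∈ sup I pt × (∃[ q ] q ∈ T n × link z p q)) → z ∈ T (suc n)
        fwd n z (p , (i , p≐) , q , (is , q≐) , l) = i ∷ is , link⁻ {is = is} l p≐ q≐
        bwd : ∀ n z → z ∈ T (suc n) → ∃[ p ] p ∈ sup I pt × (∃[ q ] q ∈ T n × link z p q)
        bwd n z (i ∷ is , e) = pt i , elem I pt i , code is , elem (Vec I n) code is , link⁺ {is = is} (≐-refl _) (≐-refl _) e

      all : ∃[ t ] V t × (∀ z → z ∈ t ⇔ (∃[ s ] s ∈ sup ℕ T × z ∈ s))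
      all = unionV (rangeV TFam)

  -- L may have relations of unbounded arity, so transporting a structure along h in V needs all tuples at once.
  tupleMap : ∀ {h A B} → V h → IsMap h A (_∈ B) → ∃[ t ] V t ×
    (∀ {n} (v w : Vec 𝕍 n) → Pointwise (MapsTo h) v w → ⟨ tuple v , tuple w ⟩ ∈ t) ×
    (∀ z → z ∈ t → Σ ℕ λ n → ∃[ v ] ∃[ w ] z ≐ ⟨ tuple v , tuple w ⟩ × Pointwise (MapsTo h) {n} {n} v w)
  tupleMap {sup I h} {A} {B} Vh (pairs , _) = t , Vt , mem , dec
    where
    a b : I → 𝕍
    a i = proj₁ (pairs (h i) (elem I h i))
    b i = proj₁ (proj₂ (pairs (h i) (elem I h i)))
    h≐ : ∀ i → h i ≐ ⟨ a i , b i ⟩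
    h≐ i = proj₁ (proj₂ (proj₂ (pairs (h i) (elem I h i))))
    open TupleMap {I} {a} {b} (respects _ _ ((λ i → i , h≐ i) , (λ i → i , h≐ i)) Vh)
    t  = proj₁ all
    Vt = proj₁ (proj₂ all)
    mem : ∀ {n} (v w : Vec 𝕍 n) → Pointwise (MapsTo (sup I h)) v w → ⟨ tuple v , tuple w ⟩ ∈ t
    mem {n} v w ps = from (proj₂ (proj₂ all) _) (T n , elem ℕ T n , find v w ps)
      where
      find : ∀ {n} (v w : Vec 𝕍 n) → Pointwise (MapsTo (sup I h)) v w → ⟨ tuple v , tuple w ⟩ ∈ T n
      find [] [] [] = [] , ≐-refl _
      find (x ∷ v) (y ∷ w) ((i , e) ∷ ps) = let is , e′ = find v w ps ; e″ = ≐-trans {⟨ x , y ⟩} {h i} {⟨ a i , b i ⟩} e (h≐ i) in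
        i ∷ is , ⟨⟩-cong (⟨⟩-cong (⟨⟩-injˡ {x} {a i} {y} {b i} e″) (⟨⟩-injˡ {tuple v} {tuple (Vec.map a is)} {tuple w} {tuple (Vec.map b is)} e′))
                         (⟨⟩-cong (⟨⟩-injʳ {x} {a i} {y} {b i} e″) (⟨⟩-injʳ {tuple v} {tuple (Vec.map a is)} {tuple w} {tuple (Vec.map b is)} e′))
    dec : ∀ z → z ∈ t → Σ ℕ λ n → ∃[ v ] ∃[ w ] z ≐ ⟨ tuple v , tuple w ⟩ × Pointwise (MapsTo (sup I h)) {n} {n} v w
    dec z z∈ = case to (proj₂ (proj₂ all) z) z∈ of λ { (s , (n , s≐) , z∈s) →
      case ∈-respʳ s≐ z∈s of λ (is , e) → n , Vec.map a is , Vec.map b is , e , ps is }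
      where
      ps : ∀ {n} (is : Vec I n) → Pointwise (MapsTo (sup I h)) (Vec.map a is) (Vec.map b is)
      ps []       = []
      ps (i ∷ is) = (i , ≐-sym (h≐ i)) ∷ ps is

  strV : ∀ {L A M} → IsStr L A M → V M → V A
  strV (I , e , _) VM = proj₁ (⟨⟩V⁻ (respects _ _ e VM))

  -- The interpretation is that of `N` composed with the map that `h` induces on tuples. This single
  -- construction provides restrictions, the empty substructure, preimages under permutations, and
  -- amalgams relocated to prescribed points.
  pullback : ∀ {L h A B N} → V h → V A → V N → IsMap h A (_∈ B) → IsStr L B N →
    ∃[ M ] V M × IsStr L A M × Preserves L h M N
  pullback {L} {h} {A} {B} {N} Vh VA VN hm (J , N≐ , strN) = ⟨ A , I ⟩ , ⟨⟩V VA VI , (I , ≐-refl _ , isStr) , preserves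
    where
    VJ : V J
    VJ = proj₂ (⟨⟩V⁻ (respects _ _ N≐ VN))
    tm = tupleMap Vh hm
    T  = proj₁ tm
    VT : V T
    VT = proj₁ (proj₂ tm)
    T⁺ : ∀ {n} (v w : Vec 𝕍 n) → Pointwise (MapsTo h) v w → ⟨ tuple v , tuple w ⟩ ∈ T
    T⁺ = proj₁ (proj₂ (proj₂ tm))
    T⁻ : ∀ z → z ∈ T → Σ ℕ λ n → ∃[ v ] ∃[ w ] z ≐ ⟨ tuple v , tuple w ⟩ × Pointwise (MapsTo h) {n} {n} v w
    T⁻ = proj₂ (proj₂ (proj₂ tm))
    DJ = fieldV VJ
    DT = fieldV VT
    inD : ∀ x y → ⟨ x , y ⟩ ∈ J → x ∈ proj₁ DJ × y ∈ proj₁ DJ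
    inD = proj₂ (proj₂ DJ)
    inE : ∀ x y → ⟨ x , y ⟩ ∈ T → x ∈ proj₁ DT × y ∈ proj₁ DT
    inE = proj₂ (proj₂ DT)
    I-exists = relationV (∃ᴰ (⟨ v2 , v0 ⟩∈ᴰ v3 ∧ᴰ ⟨ v1 , v0 ⟩∈ᴰ v4)) (VT ∷ VJ ∷ []) (proj₁ (proj₂ DJ)) (proj₁ (proj₂ DT))
    I  = proj₁ I-exists
    VI : V I
    VI = proj₁ (proj₂ I-exists)
    I⇔ : ∀ R s → ⟨ R , s ⟩ ∈ I ⇔ (R ∈ proj₁ DJ × s ∈ proj₁ DT × (∃[ t ] V t × ⟨ s , t ⟩ ∈ T × ⟨ R , t ⟩ ∈ J))
    I⇔ = proj₁ (proj₂ (proj₂ I-exists))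
    isStr : ∀ z → z ∈ I → ∃[ R ] ∃[ n ] ∃[ v ] Arity L R n × VecAll.All (_∈ A) {n} v × z ≐ ⟨ R , tuple v ⟩
    isStr z z∈ =
      case proj₂ (proj₂ (proj₂ I-exists)) z z∈ of λ (R , s , z≐ , _) →
      case to (I⇔ R s) (∈-respˡ z≐ z∈) of λ (_ , _ , t , _ , st∈ , Rt∈) →
      case T⁻ _ st∈ of λ (n , v , w , e , ps) →
      case strN _ Rt∈ of λ (R′ , n′ , w′ , ar , _ , e′) →
      -- The arity of `R` is known from `N`: `w` and `w′` code the same set, hence have the same
      -- length, which is also the length of `v`.
      let n≡n′ = proj₁ (tuple-inj w w′ (≐-trans (≐-sym (⟨⟩-injʳ {s} {tuple v} {t} {tuple w} e))
                                               (⟨⟩-injʳ {R} {R′} {t} {tuple w′} e′))) in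
      R , n , v , subst (Arity L R) (sym n≡n′) (∈-respˡ (⟨⟩-cong (≐-sym (⟨⟩-injˡ {R} {R′} {t} {tuple w′} e′)) (≐-refl (num n′))) ar)
        , allExt (λ i → proj₁ (map-codomain hm (PW.lookup ps i)))
        , ≐-trans z≐ (⟨⟩-cong (≐-refl R) (⟨⟩-injˡ {s} {tuple v} {t} {tuple w} e))
    preserves : Preserves L h ⟨ A , I ⟩ N
    preserves R {n} v w ar ps = mk⇔ fwd bwd
      where
      tuple≐ : ∀ {n′} (v′ w′ : Vec 𝕍 n′) → Pointwise (MapsTo h) v′ w′ →
               (Σ (n ≡ n′) λ e → Pointwise _≐_ (subst (Vec 𝕍) e v) v′) → tuple w′ ≐ tuple w
      tuple≐ v′ w′ ps′ (refl , es) = tuple-cong {xs = w′} {w} (pwExt λ i → proj₂ (proj₂ hm) _ _ _ (PW.lookup ps′ i)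
        (pair-respˡ {f = h} (lookup w i) (PW.lookup es i) (PW.lookup ps i)))
      fwd : Holds ⟨ A , I ⟩ R v → Holds N R w
      fwd hv = case to (I⇔ R (tuple v)) (to (holds⇔ {A = A} {I} {R} {v} (≐-refl ⟨ A , I ⟩)) hv) of λ (_ , _ , t , _ , st∈ , Rt∈) →
        case T⁻ ⟨ tuple v , t ⟩ st∈ of λ (n , v′ , w′ , e , ps′) →
        from (holds⇔ {M = N} {B} {J} {R} {w} N≐) (pair-respʳ {t} {tuple w} {J} R
          (≐-trans (⟨⟩-injʳ {tuple v} {tuple v′} {t} {tuple w′} e)
                   (tuple≐ v′ w′ ps′ (tuple-inj v v′ (⟨⟩-injˡ {tuple v} {tuple v′} {t} {tuple w′} e)))) Rt∈)
      bwd : Holds N R w → Holds ⟨ A , I ⟩ R v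
      bwd hw = let Rw∈ = to (holds⇔ {M = N} {B} {J} {R} {w} N≐) hw ; vw∈ = T⁺ v w ps in
        from (holds⇔ {A = A} {I} {R} {v} (≐-refl ⟨ A , I ⟩)) (from (I⇔ R (tuple v))
          (proj₁ (inD R (tuple w) Rw∈) , proj₁ (inE (tuple v) (tuple w) vw∈)
          , tuple w , elemV (proj₁ (proj₂ DT)) (proj₂ (inE (tuple v) (tuple w) vw∈)) , vw∈ , Rw∈))

⇔-trans : ∀ {a b c} {P : Set a} {Q : Set b} {R : Set c} → P ⇔ Q → Q ⇔ R → P ⇔ R
⇔-trans e f = mk⇔ (to f ∘ to e) (from e ∘ from f)

-- Extending a member of K by prescribed fresh points.

module Amalgamation (V : Class) (isModel : IsTransitiveModel V)
                    {L : 𝕍} {K : Class} (fraisse : IsStrongFraisse V L K) where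
  open IsTransitiveModel isModel
  open Structures V isModel public
  open IsStrongFraisse fraisse

  K⇒V : ∀ {M} → K M → V M
  K⇒V {M} k = let _ , _ , _ , _ , e = definable in proj₁ (to (e M) k)

  -- `M` is isomorphic to the substructure of `N` on the image of `h`. Heredity puts that
  -- substructure into K, and the inverse of `h` is the isomorphism along which K is closed.
  K-reflects : ∀ {h A B M N} → V h → V M → K N → IsStr L A M → IsStr L B N →
    IsInjection h A B → Preserves L h M N → K M
  K-reflects {h} {A} {B} {M} {N} Vh VM KN strM strN (hm@(_ , hTot , hFun) , hInj) pres =
    isoClosed N′ M KN′ VM (g , Vg , C , A , strN′ , strM , ((gMap , gInj) , gMap , gSurj) , gPres)
    where
    VN = K⇒V KN
    VA = strV strM VM
    VB = strV strN VN
    image = sep (∃ᴰ (⟨ v0 , v1 ⟩∈ᴰ v2)) (Vh ∷ []) VB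
    C = proj₁ image
    VC : V C
    VC = proj₁ (proj₂ image)
    C⁺ : ∀ {x y} → ⟨ x , y ⟩ ∈ h → y ∈ C
    C⁺ {x} {y} p = let x∈ , y∈ = map-codomain hm p in from (proj₂ (proj₂ image) y) (y∈ , x , elemV VA x∈ , p)
    C⊆B : C ⊆ B
    C⊆B y y∈ = proj₁ (to (proj₂ (proj₂ image) y) y∈)
    idC = relationV (v0 ≐ᴰ v1) [] VC VB
    i  = proj₁ idC
    i⇔ : ∀ x y → ⟨ x , y ⟩ ∈ i ⇔ (x ∈ C × y ∈ B × x ≐ y)
    i⇔ = proj₁ (proj₂ (proj₂ idC))
    iMap : IsMap i C (_∈ B)
    iMap = proj₂ (proj₂ (proj₂ idC))
         , (λ x x∈ → x , from (i⇔ x x) (x∈ , C⊆B x x∈ , ≐-refl x))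
         , (λ x y y′ p q → ≐-trans (≐-sym (proj₂ (proj₂ (to (i⇔ x y) p)))) (proj₂ (proj₂ (to (i⇔ x y′) q))))
    restriction = pullback {L} (proj₁ (proj₂ idC)) VC VN iMap strN
    N′ = proj₁ restriction
    strN′ : IsStr L C N′
    strN′ = proj₁ (proj₂ (proj₂ restriction))
    N′⇔N : ∀ R {n} (v : Vec 𝕍 n) → Arity L R n → VecAll.All (_∈ C) v → Holds N′ R v ⇔ Holds N R v
    N′⇔N R v ar v∈ = proj₂ (proj₂ (proj₂ restriction)) R v v ar
      (pwExt λ j → from (i⇔ (lookup v j) (lookup v j)) (allLookup v∈ j , C⊆B _ (allLookup v∈ j) , ≐-refl _))
    KN′ : K N′
    KN′ = hereditary N′ N KN (proj₁ (proj₂ restriction)) (C , B , strN′ , strN , C⊆B , N′⇔N)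
    inverse = relationV (⟨ v1 , v0 ⟩∈ᴰ v2) (Vh ∷ []) VC VA
    g  = proj₁ inverse
    Vg : V g
    Vg = proj₁ (proj₂ inverse)
    g⇔ : ∀ y x → ⟨ y , x ⟩ ∈ g ⇔ (y ∈ C × x ∈ A × ⟨ x , y ⟩ ∈ h)
    g⇔ = proj₁ (proj₂ (proj₂ inverse))
    g⁻ : ∀ {y x} → ⟨ y , x ⟩ ∈ g → ⟨ x , y ⟩ ∈ h
    g⁻ {y} {x} p = proj₂ (proj₂ (to (g⇔ y x) p))
    g⁺ : ∀ {y x} → ⟨ x , y ⟩ ∈ h → ⟨ y , x ⟩ ∈ g
    g⁺ {y} {x} p = from (g⇔ y x) (C⁺ p , proj₁ (map-codomain hm p) , p)
    gMap : IsMap g C (_∈ A)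
    gMap = proj₂ (proj₂ (proj₂ inverse))
         , (λ y y∈ → let _ , x , _ , p = to (proj₂ (proj₂ image) y) y∈ in x , g⁺ p)
         , (λ y x x′ p q → hInj x x′ y (g⁻ p) (g⁻ q))
    gInj : ∀ y y′ x → ⟨ y , x ⟩ ∈ g → ⟨ y′ , x ⟩ ∈ g → y ≐ y′
    gInj y y′ x p q = hFun x y y′ (g⁻ p) (g⁻ q)
    gSurj : ∀ x → x ∈ A → ∃[ y ] ⟨ y , x ⟩ ∈ g
    gSurj x x∈ = let y , p = hTot x x∈ in y , g⁺ p
    gPres : Preserves L g N′ M
    gPres R v w ar ps = ⇔-trans (N′⇔N R v ar (allExt λ j → C⁺ (g⁻ (PW.lookup ps j))))
                                (⇔-sym (pres R w v ar (pwExt λ j → g⁻ (PW.lookup ps j))))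

  ∅-map : ∀ {B} → IsMap ∅ ∅ (_∈ B)
  ∅-map = (λ z ()) , (λ x ()) , (λ x y y′ ())

  -- All members of K agree on relations of arity zero, hence have a common empty substructure; strong amalgamation over it is free of overlaps.
  nullary : ∀ {M N} → K M → K N → ∀ R → Arity L R 0 → Holds M R [] ⇔ Holds N R []
  nullary {M} {N} KM KN R ar =
    let P , _ , (f , _ , _ , _ , _ , _ , _ , fp) , (g , _ , _ , _ , _ , _ , _ , gp) = jointEmbedding M N KM KN in
    ⇔-trans (fp R [] [] ar []) (⇔-sym (gp R [] [] ar []))

  record Extension (p D N : 𝕍) {m} (v u : Vec 𝕍 m) : Set₁ where
    field
      q D′     : 𝕍
      inK      : K q
      isStr    : IsStr L D′ q
      extends  : IsSubstructure L p q
      old      : ∀ x → x ∈ D → x ∈ D′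
      new      : ∀ i → lookup u i ∈ D′
      only     : ∀ x → x ∈ D′ → x ∈ D ⊎ (∃[ i ] x ≐ lookup u i)
      realizes : ∀ R → Arity L R m → Holds q R u ⇔ Holds N R v

  -- The amalgam of `p` and `N` may live anywhere, so it is pulled back to `D` and `u` along the map
  -- `h` that is `j₁` on `D` and sends `u` to the image of `v`. The two images do not overlap, so
  -- `h` is injective and K contains the result. Pulling back, instead of renaming the amalgam, also
  -- discards the points of `N` outside `v`.
  extend : ∀ {p D N B} → K p → IsStr L D p → K N → IsStr L B N → ∀ {m} (v u : Vec 𝕍 m) →
    VecAll.All (_∈ B) v → AllV u → (∀ i j → lookup u i ≐ lookup u j ⇔ lookup v i ≐ lookup v j) →
    (∀ i → ¬ (lookup u i ∈ D)) → Extension p D N v u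
  extend {p} {D} {N} {B} Kp strp KN strN {m} v u v∈B Vu pattern≐ fresh = build
    (strongAmalgamation M₀ p N ∅ ∅ KM₀ Kp KN (numV 0) (numV 0)
      (∅ , D , strM₀ , strp , (∅-map , λ x x′ y ()) , M₀-p)
      (∅ , B , strM₀ , strN , (∅-map , λ x x′ y ()) , M₀-N))
    where
    Vp = K⇒V Kp
    empty = pullback {L} {∅} {∅} {D} {p} (numV 0) (numV 0) Vp ∅-map strp
    M₀ = proj₁ empty
    strM₀ : IsStr L ∅ M₀
    strM₀ = proj₁ (proj₂ (proj₂ empty))
    M₀-p : Preserves L ∅ M₀ p
    M₀-p = proj₂ (proj₂ (proj₂ empty))
    KM₀ : K M₀
    KM₀ = hereditary M₀ p Kp (proj₁ (proj₂ empty)) (∅ , D , strM₀ , strp , (λ z ()) , λ { R [] ar [] → M₀-p R [] [] ar [] })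
    M₀-N : Preserves L ∅ M₀ N
    M₀-N R [] [] ar [] = ⇔-trans (M₀-p R [] [] ar []) (nullary Kp KN R ar)

    build : (∃[ M₃ ] ∃[ j₁ ] ∃[ j₂ ] K M₃ × V j₁ × V j₂
        × IsEmbedding L j₁ p M₃ × IsEmbedding L j₂ N M₃
        × (∀ w x y z z′ → ⟨ w , x ⟩ ∈ ∅ → ⟨ x , z ⟩ ∈ j₁ → ⟨ w , y ⟩ ∈ ∅ → ⟨ y , z′ ⟩ ∈ j₂ → z ≐ z′)
        × (∀ z → ((∃[ x ] ⟨ x , z ⟩ ∈ j₁) × (∃[ y ] ⟨ y , z ⟩ ∈ j₂))
                   ⇔ (∃[ w ] ∃[ x ] ⟨ w , x ⟩ ∈ ∅ × ⟨ x , z ⟩ ∈ j₁))) → Extension p D N v u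
    build (M₃ , j₁ , j₂ , KM₃ , Vj₁ , Vj₂
          , (A₁ , B₃ , strp′ , strM₃ , (j₁m@(_ , _ , j₁Fun) , j₁Inj) , j₁Pres)
          , (A₂ , _ , strN′ , strM₃′ , (j₂m@(_ , _ , j₂Fun) , j₂Inj) , j₂Pres) , _ , overlap⇔) =
      record { q = q ; D′ = D′
             ; inK = K-reflects Vh Vq KM₃ strq strM₃ (hMap , hInj) hPres
             ; isStr = strq
             ; extends = A₁ , D′ , strp′ , strq , (λ x → ∈-∪ˡ {A₁} {U}) , agree
             ; old = λ x x∈ → ∈-∪ˡ {A₁} {U} (∈-respʳ D≐A₁ x∈)
             ; new = λ i → ∈-∪ʳ {A₁} {U} (U⁺ i)
             ; only = λ x x∈ → [ (λ r → inj₁ (∈-respʳ (≐-sym D≐A₁) r)) , inj₂ ]′ (∈-∪⁻ A₁ U x∈)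
             ; realizes = λ R ar → ⇔-trans (hPres R u y ar (pwExt h⁺ᵘ)) (⇔-sym (j₂Pres R v y ar ps)) }
      where
      D≐A₁ : D ≐ A₁
      D≐A₁ = carrier-unique strp strp′
      VA₁ : V A₁
      VA₁ = strV strp′ Vp
      v∈A₂ : VecAll.All (_∈ A₂) v
      v∈A₂ = VecAll.map (∈-respʳ (carrier-unique strN strN′)) v∈B
      y  = proj₁ (mapVec j₂m v v∈A₂)
      ps : Pointwise (MapsTo j₂) v y
      ps = proj₂ (mapVec j₂m v v∈A₂)
      U = vecSet u
      D′ = A₁ ∪ U
      U⁺ : ∀ i → lookup u i ∈ U
      U⁺ i = elem (Fin m) (lookup u) i
      y∈B₃ : ∀ i → lookup y i ∈ B₃
      y∈B₃ i = ∈-respʳ (carrier-unique strM₃′ strM₃) (proj₂ (map-codomain j₂m (PW.lookup ps i)))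
      VB₃ : V B₃
      VB₃ = strV strM₃ (K⇒V KM₃)
      e : Fin m → 𝕍
      e i = ⟨ lookup u i , lookup y i ⟩
      E = vecSet (tabulate e)
      VE : V E
      VE = vecSetV (tabV {f = e} λ i → ⟨⟩V (lookupV Vu i) (elemV VB₃ (y∈B₃ i)))
      h = j₁ ∪ E
      Vh : V h
      Vh = ∪V Vj₁ VE
      h⁺ : ∀ {x z} → ⟨ x , z ⟩ ∈ j₁ → ⟨ x , z ⟩ ∈ h
      h⁺ = ∈-∪ˡ {j₁} {E}
      h⁺ᵘ : ∀ i → ⟨ lookup u i , lookup y i ⟩ ∈ h
      h⁺ᵘ i = ∈-∪ʳ {j₁} {E} (i , ≡⇒≐ (sym (Vec.lookup∘tabulate e i)))
      h⁻′ : ∀ z → z ∈ h → z ∈ j₁ ⊎ (∃[ i ] z ≐ e i)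
      h⁻′ z z∈ = [ inj₁ , (λ (i , q) → inj₂ (i , ≐-trans q (≡⇒≐ (Vec.lookup∘tabulate e i)))) ]′ (∈-∪⁻ j₁ E z∈)
      Glued : 𝕍 → 𝕍 → Set
      Glued x z = ⟨ x , z ⟩ ∈ j₁ ⊎ (∃[ i ] x ≐ lookup u i × z ≐ lookup y i)
      h⁻ : ∀ x z → ⟨ x , z ⟩ ∈ h → Glued x z
      h⁻ x z p = [ inj₁ , (λ (i , q) → inj₂ (i , ⟨⟩-injˡ {x} {lookup u i} {z} {lookup y i} q
                                              , ⟨⟩-injʳ {x} {lookup u i} {z} {lookup y i} q)) ]′ (h⁻′ ⟨ x , z ⟩ p)
      notNew : ∀ {x z i} → ⟨ x , z ⟩ ∈ j₁ → ¬ (x ≐ lookup u i)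
      notNew {x} {z} {i} p q = fresh i (∈-respʳ (≐-sym D≐A₁) (∈-respˡ q (proj₁ (map-codomain j₁m p))))
      -- A common value would come from a point of the empty structure.
      noOverlap : ∀ {x z i} → ⟨ x , z ⟩ ∈ j₁ → ¬ (z ≐ lookup y i)
      noOverlap {x} {z} {i} p q =
        case to (overlap⇔ z) ((x , p) , lookup v i , pair-respʳ {f = j₂} (lookup v i) (≐-sym q) (PW.lookup ps i)) of λ { (_ , _ , () , _) }
      hFun : ∀ x z z′ → ⟨ x , z ⟩ ∈ h → ⟨ x , z′ ⟩ ∈ h → z ≐ z′
      hFun x z z′ p p′ = go (h⁻ x z p) (h⁻ x z′ p′)
        where
        go : Glued x z → Glued x z′ → z ≐ z′
        go (inj₁ r) (inj₁ r′) = j₁Fun x z z′ r r′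
        go (inj₁ r) (inj₂ (i , q , _)) = ⊥-elim (notNew {x} {z} {i} r q)
        go (inj₂ (i , q , _)) (inj₁ r) = ⊥-elim (notNew {x} {z′} {i} r q)
        -- Entries of `u` may repeat; `pattern≐` makes the repetitions match those of `v`.
        go (inj₂ (i , q , r)) (inj₂ (j , q′ , r′)) = ≐-trans r (≐-trans (j₂Fun (lookup v i) _ _ (PW.lookup ps i)
          (pair-respˡ {f = j₂} (lookup y j) (≐-sym (to (pattern≐ i j) (≐-trans (≐-sym q) q′))) (PW.lookup ps j))) (≐-sym r′))
      hInj : ∀ x x′ z → ⟨ x , z ⟩ ∈ h → ⟨ x′ , z ⟩ ∈ h → x ≐ x′
      hInj x x′ z p p′ = go (h⁻ x z p) (h⁻ x′ z p′)
        where
        go : Glued x z → Glued x′ z → x ≐ x′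
        go (inj₁ r) (inj₁ r′) = j₁Inj x x′ z r r′
        go (inj₁ r) (inj₂ (i , _ , q)) = ⊥-elim (noOverlap {x} {z} {i} r q)
        go (inj₂ (i , _ , q)) (inj₁ r) = ⊥-elim (noOverlap {x′} {z} {i} r q)
        go (inj₂ (i , r , q)) (inj₂ (j , r′ , q′)) = ≐-trans r (≐-trans (from (pattern≐ i j)
          (j₂Inj (lookup v i) (lookup v j) (lookup y i) (PW.lookup ps i)
            (pair-respʳ {f = j₂} (lookup v j) (≐-trans (≐-sym q′) q) (PW.lookup ps j)))) (≐-sym r′))
      hMap : IsMap h D′ (_∈ B₃)
      hMap = (λ z z∈ → pairs z (h⁻′ z z∈)) , (λ x x∈ → total x (∈-∪⁻ A₁ U x∈)) , hFun
        where
        pairs : ∀ z → z ∈ j₁ ⊎ (∃[ i ] z ≐ e i) → ∃[ x ] ∃[ y ] z ≐ ⟨ x , y ⟩ × x ∈ D′ × y ∈ B₃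
        pairs z (inj₁ r) = let x , y , q , x∈ , y∈ = proj₁ j₁m z r in x , y , q , ∈-∪ˡ {A₁} {U} x∈ , y∈
        pairs z (inj₂ (i , q)) = lookup u i , lookup y i , q , ∈-∪ʳ {A₁} {U} (U⁺ i) , y∈B₃ i
        total : ∀ x → x ∈ A₁ ⊎ x ∈ U → ∃[ z ] ⟨ x , z ⟩ ∈ h
        total x (inj₁ x∈) = let z , r = proj₁ (proj₂ j₁m) x x∈ in z , h⁺ {x} {z} r
        total x (inj₂ (i , q)) = lookup y i , pair-respˡ {lookup u i} {x} {h} (lookup y i) (≐-sym q) (h⁺ᵘ i)
      pb = pullback {L} {h} {D′} {B₃} {M₃} Vh (∪V VA₁ (vecSetV Vu)) (K⇒V KM₃) hMap strM₃
      q = proj₁ pb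
      Vq : V q
      Vq = proj₁ (proj₂ pb)
      strq : IsStr L D′ q
      strq = proj₁ (proj₂ (proj₂ pb))
      hPres : Preserves L h q M₃
      hPres = proj₂ (proj₂ (proj₂ pb))
      agree : ∀ R {n} (w : Vec 𝕍 n) → Arity L R n → VecAll.All (_∈ A₁) w → Holds p R w ⇔ Holds q R w
      agree R w ar w∈ =
        let t , ts = mapVec j₁m w w∈ in
        ⇔-trans (j₁Pres R w t ar ts) (⇔-sym (hPres R w t ar (pwExt λ i → h⁺ {lookup w i} {lookup t i} (PW.lookup ts i))))

-- Classical reasoning: equality patterns, a separating relation, and ω inside infinite ordinals.

module Classical (em : ExcludedMiddle (lsuc 0ℓ)) where

  em₀ : (P : Set) → Dec P
  em₀ P with em {P = Lift (lsuc 0ℓ) P}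
  ... | yes (lift p) = yes p
  ... | no ¬p = no (¬p ∘ lift)

  dne : {P : Set₁} → ¬ ¬ P → P
  dne {P} ¬¬p with em {P = P}
  ... | yes p = p
  ... | no ¬p = ⊥-elim (¬¬p ¬p)

  -- Labels the equality classes of the entries by indices. Distinct points of X, repeated according
  -- to the labels, then form a tuple with the equality pattern of `v`.
  pattern-index : ∀ {n} (v : Vec 𝕍 n) → Σ (Fin n → Fin n) λ r → ∀ i j → r i ≡ r j ⇔ lookup v i ≐ lookup v j
  pattern-index [] = (λ ()) , λ ()
  pattern-index {suc n} (x ∷ v) with pattern-index v
  ... | r , e with em₀ (∃[ i ] x ≐ lookup v i)
  ... | yes (i , x≐) = r′ , λ
    { zero zero → mk⇔ (λ _ → ≐-refl x) (λ _ → refl)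
    ; zero (suc j) → mk⇔ (λ q → ≐-trans x≐ (to (e i j) (Fin.suc-injective q)))
                         (λ q → cong suc (from (e i j) (≐-trans (≐-sym x≐) q)))
    ; (suc j) zero → mk⇔ (λ q → ≐-trans (to (e j i) (Fin.suc-injective q)) (≐-sym x≐))
                         (λ q → cong suc (from (e j i) (≐-trans q x≐)))
    ; (suc j) (suc k) → mk⇔ (λ q → to (e j k) (Fin.suc-injective q)) (λ q → cong suc (from (e j k) q)) }
    where
    r′ : Fin (suc n) → Fin (suc n)
    r′ zero    = suc (r i)
    r′ (suc j) = suc (r j)
  ... | no ¬x = r′ , λ
    { zero zero → mk⇔ (λ _ → ≐-refl x) (λ _ → refl)
    ; zero (suc j) → mk⇔ (λ ()) (λ q → ⊥-elim (¬x (j , q)))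
    ; (suc j) zero → mk⇔ (λ ()) (λ q → ⊥-elim (¬x (j , ≐-sym q)))
    ; (suc j) (suc k) → mk⇔ (λ q → to (e j k) (Fin.suc-injective q)) (λ q → cong suc (from (e j k) q)) }
    where
    r′ : Fin (suc n) → Fin (suc n)
    r′ zero    = zero
    r′ (suc j) = suc (r j)

  record Separation (L : 𝕍) (K : Class) : Set₁ where
    field
      {m}     : ℕ
      R       : 𝕍
      arity   : Arity L R m
      N⁺ N⁻   : 𝕍
      B⁺ B⁻   : 𝕍
      inK⁺    : K N⁺
      inK⁻    : K N⁻
      isStr⁺  : IsStr L B⁺ N⁺
      isStr⁻  : IsStr L B⁻ N⁻
      v⁺ v⁻   : Vec 𝕍 m
      v⁺∈     : VecAll.All (_∈ B⁺) v⁺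
      v⁻∈     : VecAll.All (_∈ B⁻) v⁻
      same    : ∀ i j → lookup v⁺ i ≐ lookup v⁺ j ⇔ lookup v⁻ i ≐ lookup v⁻ j
      holds⁺  : Holds N⁺ R v⁺
      ¬holds⁻ : ¬ Holds N⁻ R v⁻

  -- If no relation separated two members of K, every bijection in V between members would preserve
  -- all relations and so be an isomorphism. Preservation can fail in either direction, so the two
  -- structures may trade roles.
  separation : ∀ {V L K} → ¬ IsHighlyHomogeneous V L K → Separation L K
  separation {V} {L} {K} ¬hh = dne λ none → ¬hh
    λ { M N A B KM KN strM strN (f , Vf , bij@((fm@(_ , _ , fun) , inj) , _)) →
      f , Vf , A , B , strM , strN , bij , λ R v w ar ps →
        let same = λ i j → mk⇔
              (λ q → fun (lookup v i) (lookup w i) (lookup w j) (PW.lookup ps i)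
                (pair-respˡ {f = f} (lookup w j) (≐-sym q) (PW.lookup ps j)))
              (λ q → inj (lookup v i) (lookup v j) (lookup w i) (PW.lookup ps i)
                (pair-respʳ {f = f} (lookup v j) (≐-sym q) (PW.lookup ps j)))
            v∈ = allExt λ i → proj₁ (map-codomain fm (PW.lookup ps i))
            w∈ = allExt λ i → proj₂ (map-codomain fm (PW.lookup ps i))
        in mk⇔
          (λ hv → dne λ ¬hw → none record
            { R = R ; arity = ar ; inK⁺ = KM ; inK⁻ = KN ; isStr⁺ = strM ; isStr⁻ = strN ; v⁺ = v ; v⁻ = w
            ; v⁺∈ = v∈ ; v⁻∈ = w∈ ; same = same ; holds⁺ = hv ; ¬holds⁻ = ¬hw })
          (λ hw → dne λ ¬hv → none record
            { R = R ; arity = ar ; inK⁺ = KN ; inK⁻ = KM ; isStr⁺ = strN ; isStr⁻ = strM ; v⁺ = w ; v⁻ = v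
            ; v⁺∈ = w∈ ; v⁻∈ = v∈ ; same = λ i j → ⇔-sym (same i j) ; holds⁺ = hw ; ¬holds⁻ = ¬hv }) }

  minimal : (P : 𝕍 → Set₁) → (∃[ x ] P x) → ∃[ x ] P x × (∀ y → y ∈ x → ¬ P y)
  minimal P (x , p) = dne λ none → ∈-induction (λ x → ¬ P x) (λ x ih p → none (x , p , ih)) x p

  transitive-in-num : ∀ n {z} → IsTransitive z → (∀ y → y ∈ z → y ∈ num n) → ∃[ i ] i ℕ.≤ n × z ≐ num i
  transitive-in-num zero tr sub = zero , z≤n , ext (λ y → sub y) (λ y ())
  transitive-in-num (suc n) {z} tr sub with em₀ (num n ∈ z)
  ... | yes n∈ = suc n , ℕ.≤-refl , ext sub λ y y∈ →
        [ (λ q → tr (num n) n∈ y q) , (λ q → ∈-respˡ (≐-sym q) n∈) ]′ (∈-succ⁻ (num n) y∈)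
  ... | no n∉ with transitive-in-num n tr (λ y y∈ → [ id , (λ q → ⊥-elim (n∉ (∈-respˡ q y∈))) ]′ (∈-succ⁻ (num n) (sub y y∈)))
  ... | i , i≤n , e = i , ℕ.m≤n⇒m≤1+n i≤n , e

  module _ (V : Class) (isModel : IsTransitiveModel V) where
    open IsTransitiveModel isModel
    open Structures V isModel

    num-finite : ∀ n {A} → num n ≐ A → Finite V A
    num-finite n {A} e = n , proj₁ identity , proj₁ (proj₂ identity)
      , (isMap , λ x x′ y p q → ≐-trans (i⁻ p) (≐-sym (i⁻ q)))
      , (isMap , λ y y∈ → y , i⁺ (∈-respʳ (≐-sym e) y∈))
      where
      abstract
        identity : ∃[ i ] V i × (∀ x y → ⟨ x , y ⟩ ∈ i ⇔ (x ∈ num n × y ∈ A × x ≐ y))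
                              × (∀ z → z ∈ i → ∃[ x ] ∃[ y ] z ≐ ⟨ x , y ⟩ × x ∈ num n × y ∈ A)
        identity = relationV (v0 ≐ᴰ v1) [] (numV n) (respects _ _ e (numV n))
      i⁺ : ∀ {x} → x ∈ num n → ⟨ x , x ⟩ ∈ proj₁ identity
      i⁺ {x} x∈ = from (proj₁ (proj₂ (proj₂ identity)) x x) (x∈ , ∈-respʳ e x∈ , ≐-refl x)
      i⁻ : ∀ {x y} → ⟨ x , y ⟩ ∈ proj₁ identity → x ≐ y
      i⁻ {x} {y} p = proj₂ (proj₂ (to (proj₁ (proj₂ (proj₂ identity)) x y) p))
      isMap : IsMap (proj₁ identity) (num n) (_∈ A)
      isMap = proj₂ (proj₂ (proj₂ identity)) , (λ x x∈ → x , i⁺ x∈) , (λ x y y′ p q → ≐-trans (≐-sym (i⁻ p)) (i⁻ q))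

    -- Avoids the general comparison of ordinals. Once `num n` is included in κ, infinity of κ gives
    -- an element outside `num n`. A minimal one is a transitive subset of `num n`, hence a numeral
    -- `num i` with `i ≤ n`, and only `i = n` is left.
    ω⊆ordinal : ∀ {κ} → IsOrdinal κ → Infinite V κ → ∀ n → num n ∈ κ
    ω⊆ordinal {κ} (κtr , eltr) inf = λ n → below (suc n) n (ℕ.n<1+n n)
      where
      below : ∀ n m → m ℕ.< n → num m ∈ κ
      below (suc n) m (s≤s m≤n) with ℕ.m≤n⇒m<n∨m≡n m≤n
      ... | inj₁ m<n = below n m m<n
      ... | inj₂ refl = n∈
        where
        sub : ∀ y → y ∈ num n → y ∈ κ
        sub y y∈ = let i , i<n , e = ∈-num⁻ n y∈ in ∈-respˡ (≐-sym e) (below n i i<n)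
        stable : ∀ {y} → ¬ ¬ (y ∈ num n) → y ∈ num n
        stable {y} ¬¬p = lower (dne λ ¬p → ¬¬p (¬p ∘ lift))
        outside : ∃[ z ] z ∈ κ × ¬ (z ∈ num n)
        outside = dne λ none → inf (num-finite n (ext {num n} {κ} sub λ y y∈ → stable λ ¬q → none (y , y∈ , ¬q)))
        n∈ : num n ∈ κ
        n∈ = case minimal (λ z → Lift _ (z ∈ κ × ¬ (z ∈ num n))) (let z , p = outside in z , lift p) of
          λ { (z , lift (z∈ , z∉) , least) →
            case transitive-in-num n (eltr z z∈) (λ y y∈ → stable λ ¬q → least y y∈ (lift (κtr z z∈ y y∈ , ¬q))) of
            λ { (i , i≤n , e) → [ (λ i<n → ⊥-elim (z∉ (∈-respˡ (≐-sym e) (num-∈ i<n))))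
                                , (λ i≡n → subst (λ i → num i ∈ κ) i≡n (∈-respˡ e z∈)) ]′ (ℕ.m≤n⇒m<n∨m≡n i≤n) } }

-- Measures in V

infixr 7 _•_
_•_ : ℕ → ℚ → ℚ
zero  • q = 0ℚ
suc n • q = q ℚ.+ n • q

archimedean : ∀ q → 0ℚ ℚ.< q → ∀ r → ∃[ n ] r ℚ.< n • q
archimedean q@(mkℚ (+ suc a) d _) _ r@(mkℚ b e _) = N , ℚ.toℚᵘ-cancel-< (ℚᵘ.<-respʳ-≃ {mkℚᵘ b e} (ℚᵘ.≃-sym (multiple N)) (*<* below))
  where
  D = + suc d
  -- Denominators are stored minus one: `q = (a+1)/(d+1)` and `r = b/(e+1)`, so `r < N q` amounts to
  -- `b (d+1) < N (a+1) (e+1)`, and any `N` above `∣b∣ (d+1)` works.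
  N = suc (ℤ.∣ b ∣ ℕ.* suc d)
  multiple : ∀ n → toℚᵘ (n • q) ℚᵘ.≃ mkℚᵘ (+ n ℤ.* + suc a) d
  multiple zero    = *≡* refl
  multiple (suc n) = ℚᵘ.≃-trans (ℚ.toℚᵘ-homo-+ q (n • q))
    (ℚᵘ.≃-trans (ℚᵘ.+-congʳ (mkℚᵘ (+ suc a) d) (multiple n)) (*≡* (ring (+ n) (+ suc a) D)))
    where
    ring : ∀ n a d → (a ℤ.* d ℤ.+ (n ℤ.* a) ℤ.* d) ℤ.* d ≡ ((+ 1 ℤ.+ n) ℤ.* a) ℤ.* (d ℤ.* d)
    ring = solve-∀
  below : b ℤ.* D ℤ.< (+ N ℤ.* + suc a) ℤ.* + suc e
  below = ℤ.≤-<-trans (ℤ.*-monoʳ-≤-nonNeg D (i≤∣i∣ b)) (subst₂ ℤ._<_ (ℤ.pos-* ℤ.∣ b ∣ (suc d)) pos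
    (ℤ.+<+ (ℕ.≤-trans (ℕ.m≤m*n N (suc a)) (ℕ.m≤m*n (N ℕ.* suc a) (suc e)))))
    where
    i≤∣i∣ : ∀ i → i ℤ.≤ + ℤ.∣ i ∣
    i≤∣i∣ (+ n)    = ℤ.≤-refl
    i≤∣i∣ -[1+ n ] = ℤ.-≤+
    pos : + (N ℕ.* suc a ℕ.* suc e) ≡ (+ N ℤ.* + suc a) ℤ.* + suc e
    pos = trans (ℤ.pos-* (N ℕ.* suc a) (suc e)) (cong (ℤ._* + suc e) (ℤ.pos-* N (suc a)))
archimedean (mkℚ (+ zero) d _) (ℚ.*<* (ℤ.+<+ ())) r
archimedean (mkℚ -[1+ a ] d _) (ℚ.*<* ()) r

p+[q-p] : ∀ p q → p ℚ.+ (q ℚ.- p) ≡ q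
p+[q-p] p q = trans (cong (p ℚ.+_) (ℚ.+-comm q (ℚ.- p)))
  (trans (sym (ℚ.+-assoc p (ℚ.- p) q)) (trans (cong (ℚ._+ q) (ℚ.+-inverseʳ p)) (ℚ.+-identityˡ q)))

p<q⇒p-q<0 : ∀ {p q} → p ℚ.< q → p ℚ.- q ℚ.< 0ℚ
p<q⇒p-q<0 {p} {q} p<q = subst (p ℚ.- q ℚ.<_) (ℚ.+-inverseʳ q) (ℚ.+-monoˡ-< (ℚ.- q) p<q)

negative-+ : ∀ {p} q → p ℚ.< 0ℚ → p ℚ.+ q ℚ.< q
negative-+ {p} q p<0 = subst (p ℚ.+ q ℚ.<_) (ℚ.+-identityˡ q) (ℚ.+-monoˡ-< q p<0)

positive-+ : ∀ {p} q → 0ℚ ℚ.< p → q ℚ.< p ℚ.+ q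
positive-+ {p} q 0<p = subst (ℚ._< p ℚ.+ q) (ℚ.+-identityˡ q) (ℚ.+-monoˡ-< q 0<p)

module Measure (em : ExcludedMiddle (lsuc 0ℓ)) (V : Class) (isModel : IsTransitiveModel V)
               {κ X L ν : 𝕍} (ω⊆κ : ∀ n → num n ∈ κ) (pm : IsProbabilityMeasure V κ L X ν) where
  open IsTransitiveModel isModel
  open Structures V isModel public
  open Classical em
  open IsProbabilityMeasure pm

  private variable
    A B U : 𝕍
    F G Y Z : ℕ → 𝕍

  V𝒮 : V 𝒮
  V𝒮 = proj₁ isSigma

  𝒮⇒V : ∀ {A} → A ∈ 𝒮 → V A
  𝒮⇒V = elemV V𝒮

  𝒰 : 𝕍
  𝒰 = proj₁ total

  𝒰⇔ : ∀ M → M ∈ 𝒰 ⇔ Str V L X M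
  𝒰⇔ = proj₁ (proj₂ (proj₂ total))

  ν⇒𝒮 : ∀ {A r} → ⟨ A , r ⟩ ∈ ν → A ∈ 𝒮
  ν⇒𝒮 {A} {r} p = let A′ , r′ , e , A∈ , _ = proj₁ isMap _ p in ∈-respˡ (≐-sym (⟨⟩-injˡ {A} {A′} {r} {r′} e)) A∈

  𝒰∈𝒮 : 𝒰 ∈ 𝒮
  𝒰∈𝒮 = ν⇒𝒮 {𝒰} (proj₁ (proj₂ (proj₂ (proj₂ total))))

  V𝒰 : V 𝒰
  V𝒰 = 𝒮⇒V 𝒰∈𝒮

  ⊆𝒰 : A ∈ 𝒮 → A ⊆ 𝒰
  ⊆𝒰 A∈ M M∈ = from (𝒰⇔ M) (proj₁ (proj₁ (proj₂ isSigma)) _ A∈ M M∈)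

  abstract
    -- Countable unions and sums are available only for sequences that belong to V; a definition
    -- uniform in the index turns separation into such a sequence.
    setFamily : {P : Vec 𝕍 (suc (suc n)) → Set ℓ} → Dfn P → ∀ {ρ} → AllV ρ →
      ∃[ F ] Fam F × (∀ k M → M ∈ F k ⇔ (M ∈ 𝒰 × P (M ∷ num k ∷ ρ)))
    setFamily {n = n} {P = P} d {ρ} vs = H , graphV ℕ num ωV H (λ k → proj₁ (proj₂ (set k)))
        (∀∈ᴰ v0 (v0 ∈ᴰ v3 ∧ᴰ shiftᴰ 4 (v0 ∷ v2 ∷ []) d) ∧ᴰ ∀∈ᴰ v2 (shiftᴰ 4 (v0 ∷ v2 ∷ []) d ⇒ᴰ v0 ∈ᴰ v1)) (V𝒰 ∷ vs)
        (λ k y Vy → mk⇔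
          (λ (f , g) → ext
            (λ M M∈ → from (H⇔ k M) (proj₁ (f M M∈) , (proj₂ (f M M∈))))
            (λ M M∈ → let M∈𝒰 , p = to (H⇔ k M) M∈ in
               g M M∈𝒰 p))
          (λ e → (λ M M∈ → let M∈𝒰 , p = to (H⇔ k M) (∈-respʳ e M∈) in
                    M∈𝒰 , p)
               , (λ M M∈𝒰 p → ∈-respʳ (≐-sym e) (from (H⇔ k M)
                    (M∈𝒰 , p)))))
      , H⇔
      where
      set : ∀ k → ∃[ b ] V b × (∀ M → M ∈ b ⇔ (M ∈ 𝒰 × P (M ∷ num k ∷ ρ)))
      set k = sep d (numV k ∷ vs) V𝒰
      H : ℕ → 𝕍
      H k = proj₁ (set k)
      H⇔ : ∀ k M → M ∈ H k ⇔ (M ∈ 𝒰 × P (M ∷ num k ∷ ρ))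
      H⇔ k = proj₂ (proj₂ (set k))

  Member : (ℕ → 𝕍) → 𝕍 → 𝕍 → Set₁
  Member F k M = ∃[ A ] V A × ⟨ k , A ⟩ ∈ graph ℕ num F × M ∈ A

  member-sound : ∀ F {k M} n → k ≐ num n → Member F k M → M ∈ F n
  member-sound F {k} {M} n k≐ (A , _ , p , M∈) = ∈-respʳ {M} {A} {F n} (to (famAt {F} {k} {n} k≐) p) M∈

  member-complete : Fam F → ∀ {k M} n → k ≐ num n → M ∈ F n → Member F k M
  member-complete {F} fam {k} n k≐ M∈ = F n , famV fam n , from (famAt {F} {k} {n} k≐) (≐-refl (F n)) , M∈

  ≤⇔∉ : ∀ m n → m ℕ.≤ n ⇔ (¬ (num n ∈ num m))
  ≤⇔∉ m n = mk⇔ (λ m≤n n∈m → ℕ.<⇒≱ (num-∈⁻ {n} {m} n∈m) m≤n) (λ n∉m → ℕ.≮⇒≥ λ n<m → n∉m (num-∈ {n} {m} n<m))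

  -- Closure of `𝒮` under unions asks for an injection of the family into κ. The inclusion of ω in κ
  -- supplies it once repeated members of the sequence are identified.
  union∈𝒮 : Fam F → (∀ n → F n ∈ 𝒮) → V U → (∀ M → M ∈ U ⇔ (∃[ n ] M ∈ F n)) → U ∈ 𝒮
  union∈𝒮 {F} {U} fam F∈ VU U⇔ = proj₂ (proj₂ (proj₂ (proj₁ (proj₂ isSigma)))) (sup ℕ F) U (rangeV fam) VU
    (λ { A (n , e) → ∈-respˡ (≐-sym e) (F∈ n) })
    (proj₁ least , proj₁ (proj₂ least) , (leastPairs , leastTotal , leastFun) , leastInj)
    λ M → mk⇔ (λ M∈ → let n , p = to (U⇔ M) M∈ in F n , elem ℕ F n , p)
              (λ { (A , (n , e) , M∈) → from (U⇔ M) (n , ∈-respʳ e M∈) })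
    where
    -- Each set is sent to its least index.
    least = relationV (⟨ v1 , v0 ⟩∈ᴰ v2 ∧ᴰ ∀∈ᴰ v1 (¬ᴰ (⟨ v0 , v1 ⟩∈ᴰ v3))) (fam ∷ []) (rangeV fam) ωV
    i = proj₁ least
    i⇔ : ∀ A n → ⟨ A , n ⟩ ∈ i ⇔ (A ∈ sup ℕ F × n ∈ ω × ⟨ n , A ⟩ ∈ graph ℕ num F × (∀ m → m ∈ n → ¬ (⟨ m , A ⟩ ∈ graph ℕ num F)))
    i⇔ = proj₁ (proj₂ (proj₂ least))
    leastPairs : ∀ z → z ∈ i → ∃[ x ] ∃[ y ] z ≐ ⟨ x , y ⟩ × x ∈ sup ℕ F × y ∈ κ
    leastPairs z z∈ = let x , y , e , x∈ , (n , y≐) = proj₂ (proj₂ (proj₂ least)) z z∈ in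
      x , y , e , x∈ , ∈-respˡ (≐-sym y≐) (ω⊆κ n)
    leastTotal : ∀ A → A ∈ sup ℕ F → ∃[ n ] ⟨ A , n ⟩ ∈ i
    leastTotal A A∈@(n₀ , e₀) =
      let z , lift (n , z≐ , A≐) , min = minimal (λ z → Lift (lsuc 0ℓ) (∃[ n ] z ≐ num n × A ≐ F n))
                                                  (num n₀ , lift (n₀ , ≐-refl _ , e₀))
      in z , from (i⇔ A z) (A∈ , (n , z≐)
           , from (famAt {F} {z} {n} z≐) A≐
           , λ m m∈ (k , q) → min m m∈ (lift (k , ⟨⟩-injˡ {m} {num k} {A} {F k} q , ⟨⟩-injʳ {m} {num k} {A} {F k} q)))
    leastFun : ∀ A n n′ → ⟨ A , n ⟩ ∈ i → ⟨ A , n′ ⟩ ∈ i → n ≐ n′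
    leastFun A n n′ p q =
      let _ , (k , e) , r , f = to (i⇔ A n) p
          _ , (k′ , e′) , r′ , f′ = to (i⇔ A n′) q
      in case ℕ.<-cmp k k′ of λ
        { (tri< k<k′ _ _) → ⊥-elim (f′ n (∈-respˡ (≐-sym e) (∈-respʳ (≐-sym e′) (num-∈ k<k′))) r)
        ; (tri≈ _ k≡k′ _) → ≐-trans e (≐-trans (≡⇒≐ (cong num k≡k′)) (≐-sym e′))
        ; (tri> _ _ k′<k) → ⊥-elim (f n′ (∈-respˡ (≐-sym e′) (∈-respʳ (≐-sym e) (num-∈ k′<k))) r′) }
    leastInj : ∀ A B n → ⟨ A , n ⟩ ∈ i → ⟨ B , n ⟩ ∈ i → A ≐ B
    leastInj A B n p q =
      let _ , _ , (k , r) , _ = to (i⇔ A n) p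
          _ , _ , (k′ , r′) , _ = to (i⇔ B n) q
          k≡k′ = num-inj (≐-trans (≐-sym (⟨⟩-injˡ {n} {num k} {A} {F k} r)) (⟨⟩-injˡ {n} {num k′} {B} {F k′} r′))
      in ≐-trans (⟨⟩-injʳ {n} {num k} {A} {F k} r)
           (≐-trans (≡⇒≐ (cong F k≡k′)) (≐-sym (⟨⟩-injʳ {n} {num k′} {B} {F k′} r′)))

  -- Events are predicates of arbitrary sets, because they are later evaluated at a generic
  -- structure; only their trace on the structures of V is measured.
  Meas : (𝕍 → Set ℓ) → Set (lsuc 0ℓ ⊔ ℓ)
  Meas P = ∃[ A ] A ∈ 𝒮 × (∀ M → M ∈ A ⇔ (M ∈ 𝒰 × P M))

  Describes : 𝕍 → (𝕍 → Set ℓ) → Set (lsuc 0ℓ ⊔ ℓ)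
  Describes A P = ∀ M → M ∈ A ⇔ (M ∈ 𝒰 × P M)

  meas⇒𝒮 : {P : 𝕍 → Set ℓ} → Meas P → Describes B P → B ∈ 𝒮
  meas⇒𝒮 (A , A∈ , A⇔) B⇔ = ∈-respˡ (ext (λ M M∈ → from (B⇔ M) (to (A⇔ M) M∈)) (λ M M∈ → from (A⇔ M) (to (B⇔ M) M∈))) A∈

  meas-resp : {P : 𝕍 → Set ℓ} {Q : 𝕍 → Set ℓ′} → (∀ M → M ∈ 𝒰 → P M ⇔ Q M) → Meas P → Meas Q
  meas-resp e (A , A∈ , A⇔) = A , A∈ , λ M → mk⇔
    (λ M∈ → let u , p = to (A⇔ M) M∈ in u , to (e M u) p) (λ (u , q) → from (A⇔ M) (u , from (e M u) q))

  meas-∈ : A ∈ 𝒮 → Meas (_∈ A)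
  meas-∈ {A} A∈ = A , A∈ , λ M → mk⇔ (λ p → ⊆𝒰 A∈ M p , p) proj₂

  meas-¬ : {P : 𝕍 → Set ℓ} → Meas P → Meas (λ M → ¬ P M)
  meas-¬ (A , A∈ , A⇔) = C , compl∈ , λ M → mk⇔
      (λ M∈ → let u , ∉A = to (C⇔ M) M∈ in u , λ p → ∉A (from (A⇔ M) (u , p)))
      (λ (u , ¬p) → from (C⇔ M) (u , λ q → ¬p (proj₂ (to (A⇔ M) q))))
    where
    complement = sep (¬ᴰ (v0 ∈ᴰ v1)) (𝒮⇒V A∈ ∷ []) V𝒰
    C = proj₁ complement
    C⇔ : ∀ M → M ∈ C ⇔ (M ∈ 𝒰 × ¬ (M ∈ A))
    C⇔ = proj₂ (proj₂ complement)
    compl∈ : C ∈ 𝒮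
    compl∈ = proj₁ (proj₂ (proj₂ (proj₁ (proj₂ isSigma)))) A C (proj₁ (proj₂ complement)) A∈
      λ M → mk⇔ (λ M∈ → let u , q = to (C⇔ M) M∈ in to (𝒰⇔ M) u , q)
                (λ (s , q) → from (C⇔ M) (from (𝒰⇔ M) s , q))

  meas-∃ : {P : ℕ → 𝕍 → Set ℓ} → Fam F → (∀ n → Meas (P n)) → (∀ n → Describes (F n) (P n)) → Meas (λ M → ∃[ n ] P n M)
  meas-∃ {F = F} {P = P} fam meas F⇔ = W , union∈𝒮 fam (λ n → meas⇒𝒮 (meas n) (F⇔ n)) (proj₁ (proj₂ all)) (λ M → mk⇔
      (λ M∈ → let _ , _ , (n , k≐) , p = to (W⇔ M) M∈ in n , member-sound F n k≐ p)
      (λ (n , M∈) → from (W⇔ M) (proj₁ (to (F⇔ n M) M∈) , num n , num-∈ω n , member-complete fam n (≐-refl (num n)) M∈)))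
    , λ M → mk⇔
      (λ M∈ → let u , _ , (n , k≐) , p = to (W⇔ M) M∈ in u , n , proj₂ (to (F⇔ n M) (member-sound F n k≐ p)))
      (λ (u , n , p) → from (W⇔ M) (u , num n , num-∈ω n , member-complete fam n (≐-refl (num n)) (from (F⇔ n M) (u , p))))
    where
    all : ∃[ W ] V W × (∀ M → M ∈ W ⇔ (M ∈ 𝒰 × (∃[ k ] k ∈ ω × Member F k M)))
    all = sep (∃∈ᴰ v1 (∃ᴰ (⟨ v1 , v0 ⟩∈ᴰ v4 ∧ᴰ v2 ∈ᴰ v0))) (ωV ∷ fam ∷ []) V𝒰
    W : 𝕍
    W = proj₁ all
    W⇔ : ∀ M → M ∈ W ⇔ (M ∈ 𝒰 × (∃[ k ] k ∈ ω × Member F k M))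
    W⇔ = proj₂ (proj₂ all)

-- Calculus of lower cuts for the measure, and the Borel-Cantelli lemma.

module BorelCantelli (em : ExcludedMiddle (lsuc 0ℓ)) (V : Class) (isModel : IsTransitiveModel V)
                     {κ X L ν : 𝕍} (ω⊆κ : ∀ n → num n ∈ κ) (pm : IsProbabilityMeasure V κ L X ν) where
  open IsTransitiveModel isModel
  open Measure em V isModel ω⊆κ pm public
  open Classical em
  open IsProbabilityMeasure pm

  private variable
    A B : 𝕍
    F Y Z : ℕ → 𝕍
    p q : ℚ
    ns : List ℕ

  infix 4 _<μ_
  _<μ_ : ℚ → 𝕍 → Set₁
  q <μ A = ∃[ r ] ⟨ A , r ⟩ ∈ ν × q <ᴿ r

  measure : A ∈ 𝒮 → ∃[ r ] ⟨ A , r ⟩ ∈ ν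
  measure {A} A∈ = proj₁ (proj₂ isMap) A A∈

  measure-unique : ∀ {A r s} → ⟨ A , r ⟩ ∈ ν → ⟨ A , s ⟩ ∈ ν → r ≐ s
  measure-unique = proj₂ (proj₂ isMap) _ _ _

  isReal : ∀ {A r} → ⟨ A , r ⟩ ∈ ν → ∃[ s ] r ≐ s × IsReal s
  isReal {A} {r} p = let A′ , s , e , _ , real = proj₁ isMap ⟨ A , r ⟩ p in s , ⟨⟩-injʳ {A} {A′} {r} {s} e , real

  μ-down : p ℚ.< q → q <μ A → p <μ A
  μ-down {p} {q} p<q (r , Ar , q<r) = let s , e , _ , _ , _ , down , _ = isReal Ar in
    r , Ar , ∈-respʳ (≐-sym e) (down p q p<q (∈-respʳ e q<r))

  μ-open : q <μ A → ∃[ p ] q ℚ.< p × p <μ A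
  μ-open {q} (r , Ar , q<r) =
    let s , e , _ , _ , _ , _ , opn = isReal Ar ; p , q<p , p<s = opn q (∈-respʳ e q<r) in
    p , q<p , r , Ar , ∈-respʳ (≐-sym e) p<s

  μ-bounded : A ∈ 𝒮 → ∃[ q ] ¬ (q <μ A)
  μ-bounded A∈ =
    let r , Ar = measure A∈ ; s , e , _ , _ , (q , q≮s) , _ = isReal Ar in
    q , λ (r′ , Ar′ , q<r′) → q≮s (∈-respʳ (≐-trans (measure-unique Ar′ Ar) e) q<r′)

  μ-resp : A ≐ B → q <μ A → q <μ B
  μ-resp {A} {B} e (r , Ar , q<r) = r , pair-respˡ {A} {B} {ν} r e Ar , q<r

  -- Reals are lower cuts and measures are nonnegative, so measure zero means that nothing but
  -- negative rationals lies below.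
  Null : 𝕍 → Set₁
  Null A = ∀ q → q <μ A → q ℚ.< 0ℚ

  ¬positive⇒null : (∀ q → 0ℚ ℚ.< q → ¬ (q <μ A)) → Null A
  ¬positive⇒null {A} np q q<μ = case μ-open {q} {A} q<μ of λ { (p , q<p , p<μ) → negative p q<p p<μ (ℚ.<-cmp p 0ℚ) }
    where
    negative : ∀ p → q ℚ.< p → p <μ A → _ → q ℚ.< 0ℚ
    negative p q<p p<μ (tri< p<0 _ _) = ℚ.<-trans q<p p<0
    negative p q<p p<μ (tri≈ _ p≡0 _) = subst (q ℚ.<_) p≡0 q<p
    negative p q<p p<μ (tri> _ _ 0<p) = ⊥-elim (np p 0<p p<μ)

  Distinct : List ℕ → Set
  Distinct = AllPairs λ m n → ¬ (m ≡ n)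

  Below : (ℕ → 𝕍) → List ℕ → ℚ → Set₁
  Below F []       q = Lift _ (q ℚ.< 0ℚ)
  Below F (n ∷ ns) q = ∃[ s ] ∃[ t ] s <μ F n × Below F ns t × q ≡ s ℚ.+ t

  private
    index : ∀ {is} → ListAll.All (_∈ ω) is → List ℕ
    index []             = []
    index ((n , _) ∷ is) = n ∷ index is

    index-distinct : ∀ {is} (is∈ : ListAll.All (_∈ ω) is) → AllPairs (λ i j → ¬ (i ≐ j)) is → Distinct (index is∈)
    index-distinct [] [] = []
    index-distinct {i ∷ _} ((n , e) ∷ is∈) (d ∷ ds) = go is∈ d ∷ index-distinct is∈ ds
      where
      go : ∀ {is} (is∈ : ListAll.All (_∈ ω) is) → ListAll.All (λ j → ¬ (i ≐ j)) is →
           ListAll.All (λ m → ¬ (n ≡ m)) (index is∈)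
      go [] [] = []
      go ((m , e′) ∷ is∈) (d ∷ ds) = (λ n≡m → d (≐-trans e (≐-trans (≡⇒≐ (cong num n≡m)) (≐-sym e′)))) ∷ go is∈ ds

    index-below : ∀ {is} F (is∈ : ListAll.All (_∈ ω) is) q → BelowSum ν (graph ℕ num F) is q → Below F (index is∈) q
    index-below F [] q b = b
    index-below {i ∷ _} F ((n , e) ∷ is∈) q (A , r , s , t , iA , Ar , s<r , b , q≡) =
      s , t , μ-resp {A} {F n} {s} (to (famAt {F} {i} {n} e) iA)
                     (r , Ar , s<r)
            , index-below F is∈ t b , q≡

    below-num : ∀ F ns q → Below F ns q → BelowSum ν (graph ℕ num F) (List.map num ns) q
    below-num F [] q b = b
    below-num F (n ∷ ns) q (s , t , (r , Fr , s<r) , b , q≡) =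
      F n , r , s , t , from (fam∈ {F} {n}) (≐-refl (F n)) , Fr , s<r , below-num F ns t b , q≡

  additive : Fam F → (∀ n → F n ∈ 𝒮) → (∀ m n M → M ∈ F m → M ∈ F n → m ≡ n) → A ∈ 𝒮 →
    (∀ M → M ∈ A ⇔ (∃[ n ] M ∈ F n)) → ∀ q → q <μ A ⇔ (∃[ ns ] Distinct ns × Below F ns q)
  additive {F} {A} fam F∈ disjoint A∈ A⇔ q = mk⇔
    (λ (r , Ar , q<r) → let is , is∈ , d , b = to (sum r Ar q) q<r in
       index is∈ , index-distinct is∈ d , index-below F is∈ q b)
    (λ (ns , d , b) → let r , Ar = measure A∈ in r , Ar , from (sum r Ar q)
       (List.map num ns , nums∈ ns , AllPairs.map⁺ (AllPairs.map (λ m≢n e → m≢n (num-inj e)) d) , below-num F ns q b))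
    where
    nums∈ : ∀ ns → ListAll.All (_∈ ω) (List.map num ns)
    nums∈ []       = []
    nums∈ (n ∷ ns) = num-∈ω n ∷ nums∈ ns
    f = graph ℕ num F
    f⁻ : ∀ {i B} → ⟨ i , B ⟩ ∈ f → ∃[ n ] i ≐ num n × B ≐ F n
    f⁻ {i} {B} (n , e) = n , ⟨⟩-injˡ {i} {num n} {B} {F n} e , ⟨⟩-injʳ {i} {num n} {B} {F n} e
    fMap : IsMap f ω (_∈ 𝒮)
    fMap = (λ z (n , e) → num n , F n , e , num-∈ω n , F∈ n)
         , (λ { x (n , e) → F n , n , ⟨⟩-cong e (≐-refl (F n)) })
         , λ x B B′ p q → let n , e , B≐ = f⁻ {x} {B} p ; n′ , e′ , B′≐ = f⁻ {x} {B′} q in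
             ≐-trans B≐ (≐-trans (≡⇒≐ (cong F (num-inj (≐-trans (≐-sym e) e′)))) (≐-sym B′≐))
    sum : ∀ r → ⟨ A , r ⟩ ∈ ν → ∀ q → q <ᴿ r ⇔
      (∃[ is ] ListAll.All (_∈ ω) is × AllPairs (λ i j → ¬ (i ≐ j)) is × BelowSum ν f is q)
    sum r = ω-additive f A r fam fMap
      (λ i j B C M iB jC i≢j M∈B M∈C →
        let n , i≐ , B≐ = f⁻ {i} {B} iB ; n′ , j≐ , C≐ = f⁻ {j} {C} jC in
        i≢j (≐-trans i≐ (≐-trans (≡⇒≐ (cong num (disjoint n n′ M (∈-respʳ B≐ M∈B) (∈-respʳ C≐ M∈C)))) (≐-sym j≐))))
      (𝒮⇒V A∈)
      λ M → mk⇔ (λ M∈ → let n , p = to (A⇔ M) M∈ in num n , F n , from (fam∈ {F} {n}) (≐-refl (F n)) , p)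
                (λ (i , B , iB , M∈) → let n , _ , B≐ = f⁻ {i} {B} iB in from (A⇔ M) (n , ∈-respʳ B≐ M∈))

  below-down : ∀ F ns {p q} → p ℚ.< q → Below F ns q → Below F ns p
  below-down F [] p<q (lift q<0) = lift (ℚ.<-trans p<q q<0)
  below-down F (n ∷ ns) {p} p<q (s , t , s<μ , b , refl) = s , p ℚ.- s , s<μ
    , below-down F ns (subst (p ℚ.- s ℚ.<_) (trans (cong (ℚ._- s) (ℚ.+-comm s t))
        (trans (ℚ.+-assoc t s (ℚ.- s)) (trans (cong (t ℚ.+_) (ℚ.+-inverseʳ s)) (ℚ.+-identityʳ t)))) (ℚ.+-monoˡ-< (ℚ.- s) p<q)) b
    , sym (p+[q-p] s p)

  below-++ : ∀ F ms ns {p q} → Below F ms p → Below F ns q → Below F (ms ++ ns) (p ℚ.+ q)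
  below-++ F [] ns {p} {q} (lift p<0) b = below-down F ns (negative-+ q p<0) b
  below-++ F (m ∷ ms) ns {q = q} (s , t , s<μ , b , refl) b′ =
    s , t ℚ.+ q , s<μ , below-++ F ms ns b b′ , ℚ.+-assoc s t q

  null-sum : (∀ n → Null (F n)) → Below F ns q → q ℚ.< 0ℚ
  null-sum {ns = []} null (lift q<0) = q<0
  null-sum {F = F} {ns = n ∷ ns} null (s , t , s<μ , b , refl) =
    ℚ.<-trans (negative-+ t (null n s s<μ)) (null-sum {F = F} {ns = ns} null b)

  -- The sum of the disjoint Z n would be infinite.
  no-divergence : Fam Z → (∀ n → Z n ∈ 𝒮) → (∀ m n M → M ∈ Z m → M ∈ Z n → m ≡ n) → 0ℚ ℚ.< q →
    ¬ (∀ N → ∃[ ns ] ListAll.All (N ℕ.≤_) ns × Distinct ns × Below Z ns q)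
  no-divergence {Z} {q} fam Z∈ disjoint 0<q tails =
    let U , U∈ , U⇔ = meas-∃ fam (λ n → meas-∈ (Z∈ n)) (λ n M → mk⇔ (λ p → ⊆𝒰 (Z∈ n) M p , p) proj₂)
        b , ¬b = μ-bounded U∈
        n , b<nq = archimedean q 0<q b
        ns , d , below = many n
    in ¬b (μ-down {b} {suc n • q} {U} (ℚ.<-trans b<nq (positive-+ (n • q) 0<q))
         (from (additive fam Z∈ disjoint U∈ (λ M → mk⇔ (λ M∈ → proj₂ (to (U⇔ M) M∈))
            (λ (k , p) → from (U⇔ M) (⊆𝒰 (Z∈ k) M p , k , p))) (suc n • q)) (ns , d , below)))
    where
    bound : ∀ ns → ∃[ N ] ListAll.All (ℕ._< N) ns
    bound [] = 0 , []
    bound (n ∷ ns) = let N , ns<N = bound ns in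
      suc n ℕ.⊔ N , ℕ.m≤m⊔n (suc n) N ∷ ListAll.map (λ k<N → ℕ.≤-trans k<N (ℕ.m≤n⊔m (suc n) N)) ns<N
    -- Each further list of indices is taken beyond the bound of the earlier ones, so the
    -- concatenation stays distinct and contributes another `q`.
    many : ∀ n → ∃[ ns ] Distinct ns × Below Z ns (suc n • q)
    many zero = let ns , _ , d , b = tails 0 in ns , d , subst (Below Z ns) (sym (ℚ.+-identityʳ q)) b
    many (suc n) =
      let ns , d , b = many n ; N , ns<N = bound ns ; ms , N≤ms , d′ , b′ = tails N in
      ms ++ ns , AllPairs.++⁺ d′ d (ListAll.map (λ N≤m → ListAll.map (λ k<N m≡k → ℕ.<-irrefl (sym m≡k) (ℕ.≤-trans k<N N≤m)) ns<N) N≤ms)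
      , below-++ Z ms ns b′ b

  ∅-family : Fam λ _ → ∅
  ∅-family = constFam (numV 0)

  ∅∈𝒮 : ∅ ∈ 𝒮
  ∅∈𝒮 = meas⇒𝒮 (meas-¬ (meas-∈ 𝒰∈𝒮)) λ M → mk⇔ (λ ()) (λ (u , ¬u) → ⊥-elim (¬u u))

  -- Only additivity over infinite index sets is given, so this comes before finite additivity: the
  -- constant sequence `∅` is pairwise disjoint, and a positive value would make its sum diverge.
  -- Finite additivity then follows by padding with `∅`.
  null-∅ : Null ∅
  -- The empty remainder of a sum exceeds only negative rationals, so the amount `p` to be reached
  -- must lie strictly below `q`.
  null-∅ = ¬positive⇒null λ q 0<q q<μ → let p , 0<p , p<q = ℚ.<-dense 0<q in
    no-divergence ∅-family (λ _ → ∅∈𝒮) (λ m n M ()) 0<p λ N →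
      N ∷ [] , ℕ.≤-refl ∷ [] , [] ∷ [] , q , p ℚ.- q , q<μ , lift (p<q⇒p-q<0 p<q) , sym (p+[q-p] q p)

  private
    pair : 𝕍 → 𝕍 → ℕ → 𝕍
    pair A B = cons A (cons B λ _ → ∅)

    pairFamily : V A → V B → Fam (pair A B)
    pairFamily VA VB = consFam VA (consFam VB ∅-family)

    pair∈𝒮 : A ∈ 𝒮 → B ∈ 𝒮 → ∀ n → pair A B n ∈ 𝒮
    pair∈𝒮 A∈ B∈ 0 = A∈
    pair∈𝒮 A∈ B∈ 1 = B∈
    pair∈𝒮 A∈ B∈ (suc (suc _)) = ∅∈𝒮

  meas-∨ : {P : 𝕍 → Set ℓ} {Q : 𝕍 → Set ℓ′} → Meas P → Meas Q → Meas (λ M → P M ⊎ Q M)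
  meas-∨ (A , A∈ , A⇔) (B , B∈ , B⇔) = meas-resp
    (λ M u → mk⇔ (λ { (0 , p) → inj₁ (proj₂ (to (A⇔ M) p)) ; (1 , p) → inj₂ (proj₂ (to (B⇔ M) p)) ; (suc (suc _) , ()) })
                 [ (λ p → 0 , from (A⇔ M) (u , p)) , (λ p → 1 , from (B⇔ M) (u , p)) ]′)
    (meas-∃ {F = pair A B} {P = λ n M → M ∈ pair A B n} (pairFamily (𝒮⇒V A∈) (𝒮⇒V B∈)) (λ n → meas-∈ (pair∈𝒮 A∈ B∈ n))
            (λ n M → mk⇔ (λ p → ⊆𝒰 (pair∈𝒮 A∈ B∈ n) M p , p) proj₂))

  -- `P` may live in any universe, but on `𝒰` it is equivalent to membership in a set, to which the
  -- available excluded middle applies.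
  meas-dec : {P : 𝕍 → Set ℓ} → Meas P → ∀ M → M ∈ 𝒰 → Dec (P M)
  meas-dec (A , _ , A⇔) M u with em₀ (M ∈ A)
  ... | yes p = yes (proj₂ (to (A⇔ M) p))
  ... | no ¬p = no λ p → ¬p (from (A⇔ M) (u , p))

  meas-∧ : {P : 𝕍 → Set ℓ} {Q : 𝕍 → Set ℓ′} → Meas P → Meas Q → Meas (λ M → P M × Q M)
  meas-∧ {P = P} {Q} p q = meas-resp
    (λ M u → mk⇔ (λ ¬∨ → both M (meas-dec p M u) (meas-dec q M u) ¬∨) (λ (a , b) → [ (λ ¬a → ¬a a) , (λ ¬b → ¬b b) ]′))
    (meas-¬ (meas-∨ (meas-¬ p) (meas-¬ q)))
    where
    both : ∀ M → Dec (P M) → Dec (Q M) → ¬ (¬ P M ⊎ ¬ Q M) → P M × Q M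
    both M (yes a) (yes b) _ = a , b
    both M (no ¬a) _       f = ⊥-elim (f (inj₁ ¬a))
    both M (yes _) (no ¬b) f = ⊥-elim (f (inj₂ ¬b))

  meas-const : {P : Set ℓ} → Dec P → Meas (λ _ → P)
  meas-const (yes p) = meas-resp (λ M u → mk⇔ (λ _ → p) (λ _ → u)) (meas-∈ 𝒰∈𝒮)
  meas-const (no ¬p) = meas-resp (λ M u → mk⇔ (λ ()) (λ p → ⊥-elim (¬p p))) (meas-∈ ∅∈𝒮)

  meas-∀< : {P : ℕ → 𝕍 → Set ℓ} → (∀ j → Meas (P j)) → ∀ n → Meas (λ M → ∀ j → j ℕ.< n → P j M)
  meas-∀< meas zero    = meas-resp (λ M _ → mk⇔ (λ { _ _ () }) λ _ → refl) (meas-const (yes (refl {A = ℕ} {x = 0})))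
  meas-∀< {P = P} meas (suc n) = meas-resp
    (λ M _ → mk⇔ (λ (p , f) j j<n → [ f j , (λ e → subst (λ j → P j M) (sym e) p) ]′ (ℕ.m≤n⇒m<n∨m≡n (ℕ.s≤s⁻¹ j<n)))
                 (λ f → f n ℕ.≤-refl , λ j j<n → f j (ℕ.m≤n⇒m≤1+n j<n)))
    (meas-∧ (meas n) (meas-∀< meas n))

  binary : ∀ {A B C} → A ∈ 𝒮 → B ∈ 𝒮 → C ∈ 𝒮 → (∀ M → M ∈ A → ¬ (M ∈ B)) → (∀ M → M ∈ C ⇔ (M ∈ A ⊎ M ∈ B)) →
    ∀ q → q <μ C ⇔ (∃[ ns ] Distinct ns × Below (pair A B) ns q)
  binary {A} {B} A∈ B∈ C∈ disjoint C⇔ = additive (pairFamily (𝒮⇒V A∈) (𝒮⇒V B∈)) (pair∈𝒮 A∈ B∈)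
    (λ { 0 0 M _ _ → refl ; 0 1 M p q → ⊥-elim (disjoint M p q) ; 1 0 M p q → ⊥-elim (disjoint M q p) ; 1 1 M _ _ → refl
       ; 0 (suc (suc _)) M _ () ; 1 (suc (suc _)) M _ () ; (suc (suc _)) _ M () _ }) C∈
    λ M → mk⇔ (λ M∈ → [ (0 ,_) , (1 ,_) ]′ (to (C⇔ M) M∈))
              (λ { (0 , p) → from (C⇔ M) (inj₁ p) ; (1 , p) → from (C⇔ M) (inj₂ p) ; (suc (suc _) , ()) })

  μ-mono : A ∈ 𝒮 → B ∈ 𝒮 → A ⊆ B → q <μ A → q <μ B
  μ-mono {A} {B} {q} A∈ B∈ A⊆B q<μ =
    let E , E∈ , E⇔ = difference
        p , q<p , p<μ = μ-open {q} {A} q<μ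
    in from (binary A∈ E∈ B∈ (λ M p q → proj₂ (proj₂ (to (E⇔ M) q)) p)
         (λ M → mk⇔ (λ M∈ → case em₀ (M ∈ A) of λ { (yes p) → inj₁ p ; (no ¬p) → inj₂ (from (E⇔ M) (⊆𝒰 B∈ M M∈ , M∈ , ¬p)) })
                    [ A⊆B M , (λ p → proj₁ (proj₂ (to (E⇔ M) p))) ]′) q)
       (0 ∷ [] , [] ∷ [] , p , q ℚ.- p , p<μ , lift (p<q⇒p-q<0 q<p) , sym (p+[q-p] p q))
    where
    difference : Meas λ M → M ∈ B × ¬ (M ∈ A)
    difference = meas-∧ (meas-∈ B∈) (meas-¬ (meas-∈ A∈))

  null-mono : A ∈ 𝒮 → B ∈ 𝒮 → A ⊆ B → Null B → Null A
  null-mono A∈ B∈ A⊆B null q q<μ = null q (μ-mono {q = q} A∈ B∈ A⊆B q<μ)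

  null⇒0 : ∀ {A r} → ⟨ A , r ⟩ ∈ ν → Null A → IsRational r 0ℚ
  null⇒0 {A} {r} Ar null q = mk⇔ (λ q<r → null q (r , Ar , q<r)) (nonNegative A r q Ar)

  -- Otherwise the whole space, of measure one, would be a disjoint union of two null sets.
  co-null-positive : A ∈ 𝒮 → Null A → B ∈ 𝒮 → Describes B (λ M → ¬ (M ∈ A)) → 0ℚ <μ B
  co-null-positive {A} {B} A∈ null B∈ B⇔ = dne λ ¬pos →
    let nullB = ¬positive⇒null λ q 0<q q<μ → ¬pos (μ-down {0ℚ} {q} {B} 0<q q<μ)
        r , u , 1r = proj₂ total
        ns , _ , b = to (binary A∈ B∈ 𝒰∈𝒮 (λ M p q → proj₂ (to (B⇔ M) q) p)
           (λ M → mk⇔ (λ u → case em₀ (M ∈ A) of λ { (yes p) → inj₁ p ; (no ¬p) → inj₂ (from (B⇔ M) (u , ¬p)) })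
                      [ ⊆𝒰 A∈ M , (λ p → proj₁ (to (B⇔ M) p)) ]′) 0ℚ)
           (r , proj₁ 1r , from (proj₂ 1r 0ℚ) (ℚ.positive⁻¹ 1ℚ))
    in ℚ.<-irrefl refl (null-sum {F = pair A B} {ns = ns} (λ { 0 → null ; 1 → nullB ; (suc (suc _)) → null-∅ }) b)

  private
    least : (P : ℕ → Set) → ∀ k → P k → ∃[ n ] P n × (∀ j → j ℕ.< n → ¬ P j)
    least P k p = lower′ (em₀ (∃[ n ] P n × (∀ j → j ℕ.< n → ¬ P j)))
      where
      none : ¬ (∃[ n ] P n × (∀ j → j ℕ.< n → ¬ P j)) → ∀ n j → j ℕ.< n → ¬ P j
      none ¬least (suc n) j (s≤s j≤n) p = ¬least (j , p , λ i i<j → none ¬least n i (ℕ.≤-trans i<j j≤n))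
      lower′ : Dec (∃[ n ] P n × (∀ j → j ℕ.< n → ¬ P j)) → ∃[ n ] P n × (∀ j → j ℕ.< n → ¬ P j)
      lower′ (yes q) = q
      lower′ (no ¬q) = ⊥-elim (none ¬q (suc k) k ℕ.≤-refl p)

    -- Null terms contribute only negative amounts to a finite subsum, so dropping them does not
    -- lower it; the other terms are dominated by `Z`. The last component carries the distinctness
    -- of the surviving indices through the induction.
    keep : ∀ {N F Z} → (∀ n → (N ℕ.≤ n × (∀ q → q <μ F n → q <μ Z n)) ⊎ Null (F n)) → ∀ ns q → Distinct ns → Below F ns q →
      ∃[ ms ] ListAll.All (N ℕ.≤_) ms × Distinct ms × Below Z ms q
                × (∀ k → ListAll.All (λ n → ¬ (k ≡ n)) ns → ListAll.All (λ n → ¬ (k ≡ n)) ms)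
    keep dich [] q [] b = [] , [] , [] , b , λ k → id
    keep {N} {F} {Z} dich (n ∷ ns) q (d ∷ ds) (s , t , s<μ , b , refl) =
      let ms , N≤ms , ds′ , b′ , sub = keep {N} {F} {Z} dich ns t ds b in
      [ (λ (N≤n , le) → n ∷ ms , N≤n ∷ N≤ms , sub n d ∷ ds′ , (s , t , le s s<μ , b′ , refl) , λ { k (x ∷ xs) → x ∷ sub k xs })
      , (λ null → ms , N≤ms , ds′ , below-down Z ms (negative-+ t (null s s<μ)) b′ , λ { k (x ∷ xs) → sub k xs }) ]′ (dich n)

  -- Cutting `S` by the first index `n ≥ N` with `M` in `Y n` replaces countable subadditivity: the
  -- slices are disjoint, and each is bounded by `Y n` and hence by `Z n`. If `S` had measure above
  -- some `q > 0`, then for every `N` finitely many of the `Z n` with `n ≥ N` would sum to more than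
  -- `q`, although the `Z n` are disjoint.
  borel-cantelli : ∀ {S} → Fam Y → (∀ n → Y n ∈ 𝒮) → Fam Z → (∀ n → Z n ∈ 𝒮) →
    (∀ m n M → M ∈ Z m → M ∈ Z n → m ≡ n) → (∀ n q → q <μ Y n → q <μ Z n) →
    S ∈ 𝒮 → (∀ M → M ∈ S → ∀ N → ∃[ k ] N ℕ.≤ k × M ∈ Y k) → Null S
  borel-cantelli {Y} {Z} {S} famY Y∈ famZ Z∈ disjoint Y≤Z S∈ limsup = ¬positive⇒null λ q 0<q q<μ →
    no-divergence famZ Z∈ disjoint 0<q λ N → tail N q q<μ
    where
    module Tail (N : ℕ) where
      Slice : ℕ → 𝕍 → Set₁
      Slice n M = M ∈ S × ¬ (num n ∈ num N) × Member Y (num n) M × (∀ j → j ∈ num n → ¬ (j ∈ num N) → ¬ Member Y j M)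
      abstract
        slice : ∃[ G ] Fam G × (∀ n → Describes (G n) (Slice n))
        slice = setFamily (v0 ∈ᴰ v4 ∧ᴰ ¬ᴰ (v1 ∈ᴰ v2) ∧ᴰ (∃ᴰ (⟨ v2 , v0 ⟩∈ᴰ v4 ∧ᴰ v1 ∈ᴰ v0))
                           ∧ᴰ ∀∈ᴰ v1 (¬ᴰ (v0 ∈ᴰ v3) ⇒ᴰ ¬ᴰ (∃ᴰ (⟨ v1 , v0 ⟩∈ᴰ v5 ∧ᴰ v2 ∈ᴰ v0))))
                          (numV N ∷ famY ∷ 𝒮⇒V S∈ ∷ [])
      G : ℕ → 𝕍
      G = proj₁ slice
      famG : Fam G
      famG = proj₁ (proj₂ slice)
      slice⇔ : ∀ n → Describes (G n) (Slice n)
      slice⇔ = proj₂ (proj₂ slice)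
      FirstAt : ℕ → 𝕍 → Set
      FirstAt n M = M ∈ S × N ℕ.≤ n × M ∈ Y n × (∀ j → j ℕ.< n → N ℕ.≤ j → ¬ (M ∈ Y j))
      G⁻ : ∀ n M → M ∈ G n → FirstAt n M
      G⁻ n M M∈ = case to (slice⇔ n M) M∈ of λ (u , M∈S , n∉N , M∈Y , first) →
        M∈S , from (≤⇔∉ N n) n∉N , member-sound Y n (≐-refl (num n)) M∈Y
            , λ j j<n N≤j M∈Yj → first (num j) (num-∈ {j} {n} j<n) (to (≤⇔∉ N j) N≤j) (member-complete famY j (≐-refl (num j)) M∈Yj)
      G⁺ : ∀ n M → M ∈ 𝒰 → FirstAt n M → M ∈ G n
      G⁺ n M u (M∈S , N≤n , M∈Y , first) = from (slice⇔ n M)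
        (u , M∈S , to (≤⇔∉ N n) N≤n , member-complete famY n (≐-refl (num n)) M∈Y , later)
        where
        later : ∀ k → k ∈ num n → ¬ (k ∈ num N) → ¬ Member Y k M
        later k k∈n k∉N M∈Yk = case ∈-num⁻ n k∈n of λ (j , j<n , k≐) →
          first j j<n (from (≤⇔∉ N j) λ j∈N → k∉N (∈-respˡ {num j} {k} {num N} (≐-sym k≐) j∈N)) (member-sound Y j k≐ M∈Yk)
      G⇔ : ∀ n → Describes (G n) (FirstAt n)
      G⇔ n M = mk⇔ (λ M∈ → proj₁ (to (slice⇔ n M) M∈) , G⁻ n M M∈) (λ (u , p) → G⁺ n M u p)
      G∈ : ∀ n → G n ∈ 𝒮
      G∈ n = meas⇒𝒮 (meas-∧ (meas-∈ S∈) (meas-∧ (meas-const (N ℕ.≤? n)) (meas-∧ (meas-∈ (Y∈ n))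
        (meas-resp (λ M _ → mk⇔ (λ f j j<n N≤j M∈ → f j j<n (N≤j , M∈)) (λ f j j<n (N≤j , M∈) → f j j<n N≤j M∈))
          (meas-∀< (λ j → meas-¬ (meas-∧ (meas-const (N ℕ.≤? j)) (meas-∈ (Y∈ j)))) n))))) (G⇔ n)
      G-disjoint : ∀ m n M → M ∈ G m → M ∈ G n → m ≡ n
      G-disjoint m n M p q =
        let _ , _ , N≤m , M∈m , firstm = to (G⇔ m M) p
            _ , _ , N≤n , M∈n , firstn = to (G⇔ n M) q
        in case ℕ.<-cmp m n of λ { (tri< m<n _ _) → ⊥-elim (firstn m m<n N≤m M∈m)
                                 ; (tri≈ _ m≡n _) → m≡n
                                 ; (tri> _ _ n<m) → ⊥-elim (firstm n n<m N≤n M∈n) }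
      S⇔ : ∀ M → M ∈ S ⇔ (∃[ n ] M ∈ G n)
      S⇔ M = mk⇔
        (λ M∈ → let k , p = limsup M M∈ N
                    n , (N≤n , M∈n) , first = least (λ k → N ℕ.≤ k × M ∈ Y k) k p
                in n , from (G⇔ n M) (⊆𝒰 S∈ M M∈ , M∈ , N≤n , M∈n , λ j j<n N≤j M∈j → first j j<n (N≤j , M∈j)))
        (λ (n , p) → proj₁ (proj₂ (to (G⇔ n M) p)))
      dichotomy : ∀ n → (N ℕ.≤ n × (∀ q → q <μ G n → q <μ Z n)) ⊎ Null (G n)
      dichotomy n = case N ℕ.≤? n of λ
        { (yes N≤n) → inj₁ (N≤n , λ q q<μ → Y≤Z n q (μ-mono {q = q} (G∈ n) (Y∈ n)
            (λ M p → proj₁ (proj₂ (proj₂ (proj₂ (to (G⇔ n M) p))))) q<μ))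
        ; (no N≰n) → inj₂ (null-mono (G∈ n) ∅∈𝒮 (λ M p → ⊥-elim (N≰n (proj₁ (proj₂ (proj₂ (to (G⇔ n M) p)))))) null-∅) }
    tail : ∀ N q → q <μ S → ∃[ ns ] ListAll.All (N ℕ.≤_) ns × Distinct ns × Below Z ns q
    tail N q q<μ =
      let open Tail N
          ns , d , b = to (additive famG G∈ G-disjoint S∈ S⇔ q) q<μ
          ms , N≤ms , d′ , b′ , _ = keep {N} {G} {Z} dichotomy ns q d b
      in ms , N≤ms , d′ , b′

-- Rows, blocks and runs

module Events (em : ExcludedMiddle (lsuc 0ℓ)) (V : Class) (isModel : IsTransitiveModel V)
              {X L R : 𝕍} (VX : V X) (infinite : Infinite V X) (VR : V R)
              {m : ℕ} (arity : Arity L R m) (r : Fin m → Fin m) where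
  open IsTransitiveModel isModel
  open Structures V isModel
  open Choosing em V isModel using (module Sequence)
  open Sequence VX infinite public using (grid; gridFam; cells; grid-inj; point∈X)

  grid∈X : ∀ p → grid p ∈ X
  grid∈X (k , i) = point∈X (idx k i)

  -- A second use of the pairing: `idx` has cut the points into rows, and now cuts each row into
  -- disjoint blocks indexed by `j`, with coordinate `c` inside a block.
  block : ℕ → ℕ → Fin m → 𝕍
  block k j c = grid (k , idx j (toℕ c))

  args : ℕ → ℕ → Vec 𝕍 m
  args k j = tabulate (block k j)

  -- The arguments of R in block j of row k, with repetitions prescribed by r.
  site : ℕ → ℕ → Vec 𝕍 m
  site k j = tabulate (block k j ∘ r)

  -- In a literal the repetitions are carried by the variables of the atomic formula, whose
  -- parameters are the distinct points `args`.
  args-site : ∀ k j → Vec.map (lookup (args k j)) (tabulate r) ≡ site k j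
  args-site k j = trans (sym (Vec.tabulate-∘ (lookup (args k j)) r))
                        (Vec.tabulate-cong (λ i → Vec.lookup∘tabulate (block k j) (r i)))

  lookup-site : ∀ k j i → lookup (site k j) i ≡ block k j (r i)
  lookup-site k j i = Vec.lookup∘tabulate (block k j ∘ r) i

  args∈X : ∀ k j → VecAll.All (_∈ X) (args k j)
  args∈X k j = allExt λ i → subst (_∈ X) (sym (Vec.lookup∘tabulate (block k j) i)) (grid∈X (k , idx j (toℕ i)))

  -- Two table lookups: the table of `idx` at `j` and `c` gives the position in the row, and the
  -- grid at `k` and that position gives the point.
  blockFam : ∀ c → Fam² (λ (k , j) → block k j c)
  blockFam c = graphV (ℕ × ℕ) num² (prodV ωV ωV) _ (λ (k , j) → elemV VX (grid∈X (k , idx j (toℕ c))))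
    (∃ᴰ ∃ᴰ ∃ᴰ ∃ᴰ ∃ᴰ (v6 ≐⟨ v4 , v3 ⟩ᴰ ∧ᴰ v2 ≐⟨ v3 , v7 ⟩ᴰ ∧ᴰ ⟨ v2 , v1 ⟩∈ᴰ v8 ∧ᴰ v0 ≐⟨ v4 , v1 ⟩ᴰ ∧ᴰ ⟨ v0 , v5 ⟩∈ᴰ v9))
    (numV (toℕ c) ∷ idxFam ∷ gridFam ∷ [])
    λ { (k , j) y Vy → mk⇔ (fwd k j y) (bwd k j y) }
    where
    Link : ℕ → ℕ → 𝕍 → Set₁
    Link k j y = ∃[ k′ ] V k′ × (∃[ j′ ] V j′ × (∃[ p ] V p × (∃[ n ] V n × (∃[ q ] V q ×
      num² (k , j) ≐ ⟨ k′ , j′ ⟩ × p ≐ ⟨ j′ , num (toℕ c) ⟩ × ⟨ p , n ⟩ ∈ graph (ℕ × ℕ) num² idxNum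
      × q ≐ ⟨ k′ , n ⟩ × ⟨ q , y ⟩ ∈ cells))))
    fwd : ∀ k j y → Link k j y → y ≐ block k j c
    fwd k j y (k′ , _ , j′ , _ , p , _ , n , _ , q , _ , e , p≐ , pn , q≐ , qy) =
      let k≐ = ⟨⟩-injˡ {num k} {k′} {num j} {j′} e
          j≐ = ⟨⟩-injʳ {num k} {k′} {num j} {j′} e
          n≐ : n ≐ num (idx j (toℕ c))
          n≐ = to (fam²At {idxNum} {p} {j , toℕ c}
                 (≐-trans p≐ (⟨⟩-cong (≐-sym j≐) (≐-refl (num (toℕ c)))))) pn
      in to (fam²At {grid} {q} {k , idx j (toℕ c)} (≐-trans q≐ (⟨⟩-cong (≐-sym k≐) n≐))) qy
    bwd : ∀ k j y → y ≐ block k j c → Link k j y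
    bwd k j y e = num k , numV k , num j , numV j , num² (j , toℕ c) , ⟨⟩V (numV j) (numV (toℕ c))
      , num (idx j (toℕ c)) , numV (idx j (toℕ c)) , num² (k , idx j (toℕ c)) , ⟨⟩V (numV k) (numV (idx j (toℕ c)))
      , ≐-refl (num² (k , j)) , ≐-refl (num² (j , toℕ c))
      , from (fam²∈ {idxNum} {j , toℕ c}) (≐-refl (num (idx j (toℕ c))))
      , ≐-refl (num² (k , idx j (toℕ c))) , from (fam²∈ {grid} {k , idx j (toℕ c)} {y}) e

  argsFam : Fam² (λ (k , j) → tuple (args k j))
  argsFam = Fam².tupleFam blockFam

  fact : ℕ × ℕ → 𝕍
  fact (k , j) = ⟨ R , tuple (site k j) ⟩

  factFam : Fam² fact
  factFam = Fam².pairFam {λ _ → R} {λ (k , j) → tuple (site k j)} (Fam².constFam VR) (Fam².tupleFam (blockFam ∘ r))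

  facts : 𝕍
  facts = graph (ℕ × ℕ) num² fact

  Ev : ℕ → ℕ → 𝕍 → Set₁
  Ev k j M = Holds M R (site k j)

  Run : ℕ → ℕ → 𝕍 → Set₁
  Run k n M = (∀ j → j ℕ.< n → Ev k j M) × ¬ Ev k n M

  -- `Ev` in a form that a formula can express: the indices are elements of ω, and the table of
  -- facts is a parameter in place of the tuples.
  At : 𝕍 → 𝕍 → 𝕍 → 𝕍 → Set₁
  At S M k j = ∃[ p ] V p × (∃[ s ] V s × (∃[ A ] V A × (∃[ J ] V J ×
    p ≐ ⟨ k , j ⟩ × ⟨ p , s ⟩ ∈ S × M ≐ ⟨ A , J ⟩ × s ∈ J)))

  atᴰ : ∀ {n} (S M k j : Fin n) → Dfn (λ ρ → At (lookup ρ S) (lookup ρ M) (lookup ρ k) (lookup ρ j))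
  atᴰ {n} S M k j = ∃ᴰ ∃ᴰ ∃ᴰ ∃ᴰ (v3 ≐⟨ up k , up j ⟩ᴰ ∧ᴰ ⟨ v3 , v2 ⟩∈ᴰ up S ∧ᴰ up M ≐⟨ v1 , v0 ⟩ᴰ ∧ᴰ v2 ∈ᴰ v0)
    where
    up : Fin n → Fin (suc (suc (suc (suc n))))
    up i = suc (suc (suc (suc i)))

  at-sound : ∀ M {k j} a b → k ≐ num a → j ≐ num b → At facts M k j → Ev a b M
  at-sound M {k} {j} a b k≐ j≐ (p , _ , s , _ , A , _ , J , _ , p≐ , ps , M≐ , s∈) =
    let s≐ = to (fam²At {fact} {p} {a , b} (≐-trans p≐ (⟨⟩-cong k≐ j≐))) ps
    in A , J , M≐ , ∈-respˡ {s} {fact (a , b)} {J} s≐ s∈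

  at-complete : ∀ M {k j} a b → V M → k ≐ num a → j ≐ num b → Ev a b M → At facts M k j
  at-complete M {k} {j} a b VM k≐ j≐ (A , J , M≐ , s∈) =
    let VA , VJ = ⟨⟩V⁻ {A} {J} (respects M ⟨ A , J ⟩ M≐ VM) in
    num² (a , b) , ⟨⟩V (numV a) (numV b) , fact (a , b) , Fam².famV {fact} factFam (a , b) , A , VA , J , VJ
    , ⟨⟩-cong (≐-sym k≐) (≐-sym j≐) , from (fam²∈ {fact} {a , b}) (≐-refl (fact (a , b))) , M≐ , s∈

  module RowSwap (k : ℕ) where
    Swapped : 𝕍 → 𝕍 → Set
    Swapped x y = (∃[ i ] x ≐ grid (0 , i) × y ≐ grid (k , i))
                ⊎ (∃[ i ] x ≐ grid (k , i) × y ≐ grid (0 , i))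
                ⊎ (x ≐ y × (∀ i → ¬ (x ≐ grid (0 , i)) × ¬ (x ≐ grid (k , i))))

    swapped-sym : ∀ {x y} → Swapped x y → Swapped y x
    swapped-sym (inj₁ (i , p , q))        = inj₂ (inj₁ (i , q , p))
    swapped-sym (inj₂ (inj₁ (i , p , q))) = inj₁ (i , q , p)
    swapped-sym (inj₂ (inj₂ (e , f)))     = inj₂ (inj₂ (≐-sym e ,
      λ i → proj₁ (f i) ∘ ≐-trans e , proj₂ (f i) ∘ ≐-trans e))

    private
      same : ∀ {x a i b j} → x ≐ grid (a , i) → x ≐ grid (b , j) → (a , i) ≡ (b , j)
      same p q = grid-inj _ _ (≐-trans (≐-sym p) q)

    swapped-fun : ∀ {x y y′} → Swapped x y → Swapped x y′ → y ≐ y′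
    swapped-fun {x} (inj₁ (i , p , q)) (inj₁ (j , p′ , q′)) =
      ≐-trans q (≐-trans (≡⇒≐ (cong (λ z → grid (k , proj₂ z)) (same {x} {0} {i} {0} {j} p p′))) (≐-sym q′))
    -- Distinct rows are disjoint, so both clauses can apply only when `k = 0`, and then they give
    -- the same value.
    swapped-fun {x} (inj₁ (i , p , q)) (inj₂ (inj₁ (j , p′ , q′))) =
      let e = same {x} {0} {i} {k} {j} p p′ in
      ≐-trans q (≐-trans (≡⇒≐ (cong grid (cong₂ _,_ (sym (cong proj₁ e)) (cong proj₂ e)))) (≐-sym q′))
    swapped-fun (inj₁ (i , p , q)) (inj₂ (inj₂ (_ , f))) = ⊥-elim (proj₁ (f i) p)
    swapped-fun {x} (inj₂ (inj₁ (i , p , q))) (inj₁ (j , p′ , q′)) =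
      let e = same {x} {k} {i} {0} {j} p p′ in
      ≐-trans q (≐-trans (≡⇒≐ (cong grid (cong₂ _,_ (sym (cong proj₁ e)) (cong proj₂ e)))) (≐-sym q′))
    swapped-fun {x} (inj₂ (inj₁ (i , p , q))) (inj₂ (inj₁ (j , p′ , q′))) =
      ≐-trans q (≐-trans (≡⇒≐ (cong (λ z → grid (0 , proj₂ z)) (same {x} {k} {i} {k} {j} p p′))) (≐-sym q′))
    swapped-fun (inj₂ (inj₁ (i , p , q))) (inj₂ (inj₂ (_ , f))) = ⊥-elim (proj₂ (f i) p)
    swapped-fun (inj₂ (inj₂ (_ , f))) (inj₁ (i , p , q)) = ⊥-elim (proj₁ (f i) p)
    swapped-fun (inj₂ (inj₂ (_ , f))) (inj₂ (inj₁ (i , p , q))) = ⊥-elim (proj₂ (f i) p)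
    swapped-fun (inj₂ (inj₂ (e , _))) (inj₂ (inj₂ (e′ , _))) = ≐-trans (≐-sym e) e′

    private
      RowPair : 𝕍 → 𝕍 → 𝕍 → 𝕍 → Set₁
      RowPair a b x y = ∃[ i ] i ∈ ω × (∃[ p ] V p × (∃[ q ] V q × p ≐ ⟨ a , i ⟩ × q ≐ ⟨ b , i ⟩ ×
                          ⟨ p , x ⟩ ∈ cells × ⟨ q , y ⟩ ∈ cells))

      in-row : ∀ {a i p x} n j → p ≐ ⟨ a , i ⟩ → a ≐ num n → i ≐ num j →
               ⟨ p , x ⟩ ∈ cells → x ≐ grid (n , j)
      in-row {a} {i} {p} {x} n j p≐ a≐ i≐ px = to (fam²At {grid} {p} {n , j} (≐-trans p≐ (⟨⟩-cong a≐ i≐))) px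

      rowPair⇔ : ∀ a b x y → RowPair (num a) (num b) x y ⇔ (∃[ i ] x ≐ grid (a , i) × y ≐ grid (b , i))
      rowPair⇔ a b x y = mk⇔
        (λ { (i , (n , i≐) , p , _ , q , _ , p≐ , q≐ , px , qy) →
             n , in-row {num a} {i} {p} {x} a n p≐ (≐-refl (num a)) i≐ px , in-row {num b} {i} {q} {y} b n q≐ (≐-refl (num b)) i≐ qy })
        (λ (i , x≐ , y≐) → num i , num-∈ω i , num² (a , i) , ⟨⟩V (numV a) (numV i) , num² (b , i) , ⟨⟩V (numV b) (numV i)
          , ≐-refl (num² (a , i)) , ≐-refl (num² (b , i)) , from (fam²∈ {grid} {a , i} {x}) x≐ , from (fam²∈ {grid} {b , i} {y}) y≐)

      rowPairᴰ : ∀ {n} (a b x y w g : Fin n) → Dfn (λ ρ → ∃[ i ] i ∈ lookup ρ w × (∃[ p ] V p × (∃[ q ] V q ×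
        p ≐ ⟨ lookup ρ a , i ⟩ × q ≐ ⟨ lookup ρ b , i ⟩ × ⟨ p , lookup ρ x ⟩ ∈ lookup ρ g × ⟨ q , lookup ρ y ⟩ ∈ lookup ρ g)))
      rowPairᴰ {n} a b x y w g = ∃∈ᴰ w (∃ᴰ ∃ᴰ (v1 ≐⟨ up a , v2 ⟩ᴰ ∧ᴰ v0 ≐⟨ up b , v2 ⟩ᴰ ∧ᴰ ⟨ v1 , up x ⟩∈ᴰ up g ∧ᴰ ⟨ v0 , up y ⟩∈ᴰ up g))
        where
        up : Fin n → Fin (suc (suc (suc n)))
        up i = suc (suc (suc i))

      -- `RowPair a a x x` expresses that `x` lies in row `a`, so the last clause fixes the points
      -- outside both rows.
      SwapAt : 𝕍 → 𝕍 → Set₁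
      SwapAt x y = RowPair (num 0) (num k) x y ⊎ RowPair (num k) (num 0) x y
                 ⊎ (x ≐ y × ¬ RowPair (num 0) (num 0) x x × ¬ RowPair (num k) (num k) x x)

      abstract
        relation : ∃[ f ] V f × (∀ x y → ⟨ x , y ⟩ ∈ f ⇔ (x ∈ X × y ∈ X × SwapAt x y))
            × (∀ z → z ∈ f → ∃[ x ] ∃[ y ] z ≐ ⟨ x , y ⟩ × x ∈ X × y ∈ X)
        relation = relationV
          (rowPairᴰ v2 v3 v0 v1 v4 v5 ∨ᴰ rowPairᴰ v3 v2 v0 v1 v4 v5
            ∨ᴰ (v0 ≐ᴰ v1 ∧ᴰ ¬ᴰ rowPairᴰ v2 v2 v0 v0 v4 v5 ∧ᴰ ¬ᴰ rowPairᴰ v3 v3 v0 v0 v4 v5))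
          (numV 0 ∷ numV k ∷ ωV ∷ gridFam ∷ []) VX VX

    swap : 𝕍
    swap = proj₁ relation

    swapV : V swap
    swapV = proj₁ (proj₂ relation)

    private
      raw : ∀ x y → ⟨ x , y ⟩ ∈ swap ⇔ (x ∈ X × y ∈ X × SwapAt x y)
      raw = proj₁ (proj₂ (proj₂ relation))

    swap⇔ : ∀ x y → ⟨ x , y ⟩ ∈ swap ⇔ (x ∈ X × y ∈ X × Swapped x y)
    swap⇔ x y = mk⇔
      (λ p → let x∈ , y∈ , c = to (raw x y) p in x∈ , y∈ ,
        [ (λ q → inj₁ (to (rowPair⇔ 0 k x y) q)) , [ (λ q → inj₂ (inj₁ (to (rowPair⇔ k 0 x y) q)))
        , (λ (e , n , n′) → inj₂ (inj₂ (e , λ i → (λ q → n (from (rowPair⇔ 0 0 x x) (i , q , q)))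
                                                , (λ q → n′ (from (rowPair⇔ k k x x) (i , q , q)))))) ]′ ]′ c)
      (λ (x∈ , y∈ , c) → from (raw x y) (x∈ , y∈ ,
        [ (λ q → inj₁ (from (rowPair⇔ 0 k x y) q)) , [ (λ q → inj₂ (inj₁ (from (rowPair⇔ k 0 x y) q)))
        , (λ (e , f) → inj₂ (inj₂ (e , (λ q → let i , p , _ = to (rowPair⇔ 0 0 x x) q in proj₁ (f i) p)
                                     , (λ q → let i , p , _ = to (rowPair⇔ k k x x) q in proj₂ (f i) p)))) ]′ ]′ c))

    open Classical em

    swap-total : ∀ x → x ∈ X → ∃[ y ] ⟨ x , y ⟩ ∈ swap
    swap-total x x∈ = go (em₀ (∃[ i ] x ≐ grid (0 , i))) (em₀ (∃[ i ] x ≐ grid (k , i)))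
      where
      go : Dec (∃[ i ] x ≐ grid (0 , i)) → Dec (∃[ i ] x ≐ grid (k , i)) → ∃[ y ] ⟨ x , y ⟩ ∈ swap
      go (yes (i , p)) _ = grid (k , i) , from (swap⇔ x (grid (k , i))) (x∈ , grid∈X (k , i) , inj₁ (i , p , ≐-refl (grid (k , i))))
      go (no _) (yes (i , p)) = grid (0 , i) , from (swap⇔ x (grid (0 , i))) (x∈ , grid∈X (0 , i) , inj₂ (inj₁ (i , p , ≐-refl (grid (0 , i)))))
      go (no n) (no n′) = x , from (swap⇔ x x) (x∈ , x∈ , inj₂ (inj₂ (≐-refl x , λ i → (λ p → n (i , p)) , (λ p → n′ (i , p)))))

    swap-map : IsMap swap X (_∈ X)
    swap-map = proj₂ (proj₂ (proj₂ relation)) , swap-total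
             , λ x y y′ p q → swapped-fun (proj₂ (proj₂ (to (swap⇔ x y) p))) (proj₂ (proj₂ (to (swap⇔ x y′) q)))

    -- The exchange of two rows is an involution, so injectivity and surjectivity both reduce to its
    -- being a total function.
    swap-sym : ∀ x y → ⟨ x , y ⟩ ∈ swap → ⟨ y , x ⟩ ∈ swap
    swap-sym x y p = let x∈ , y∈ , s = to (swap⇔ x y) p in from (swap⇔ y x) (y∈ , x∈ , swapped-sym s)

    swap-bijection : IsBijection swap X X
    swap-bijection = (swap-map , λ x x′ y p q → proj₂ (proj₂ swap-map) y x x′ (swap-sym x y p) (swap-sym x′ y q))
                   , (swap-map , λ y y∈ → let x , p = swap-total y y∈ in x , swap-sym y x p)

    swap-site : ∀ j → Pointwise (MapsTo swap) (site 0 j) (site k j)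
    swap-site j = pwExt λ i → let x = block 0 j (r i) ; y = block k j (r i) in
      subst₂ (MapsTo swap) (sym (lookup-site 0 j i)) (sym (lookup-site k j i))
        (from (swap⇔ x y) (grid∈X (0 , idx j (toℕ (r i))) , grid∈X (k , idx j (toℕ (r i))) , inj₁ (idx j (toℕ (r i)) , ≐-refl x , ≐-refl y)))

-- The limit superior of the diagonal runs is null for an invariant measure.

module NullRuns (em : ExcludedMiddle (lsuc 0ℓ)) (V : Class) (isModel : IsTransitiveModel V)
                {κ X L R ν : 𝕍} (VX : V X) (infinite : Infinite V X) (VR : V R)
                {m : ℕ} (arity : Arity L R m) (r : Fin m → Fin m)
                (ω⊆κ : ∀ n → num n ∈ κ) (im : IsInvariantMeasure V κ L X ν) where
  open IsTransitiveModel isModel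
  open IsInvariantMeasure im
  open IsProbabilityMeasure isProbabilityMeasure
  open BorelCantelli em V isModel ω⊆κ isProbabilityMeasure public
  open Events em V isModel VX infinite VR {m} arity r public
  open Classical em

  private
    vM : ∀ {M} → M ∈ 𝒰 → V M
    vM = elemV V𝒰

  measEv : ∀ k j → Meas (Ev k j)
  measEv k j = A , proj₁ (proj₂ (proj₁ (proj₂ isSigma))) (atom (rel R m arity (tabulate r))) (args k j) (args∈X k j) A
      (proj₁ (proj₂ set)) (λ M → mk⇔
        (λ M∈ → let u , e = to (A⇔ M) M∈ in to (𝒰⇔ M) u , subst (Holds M R) (sym (args-site k j)) e)
        (λ (s , e) → from (A⇔ M) (from (𝒰⇔ M) s , subst (Holds M R) (args-site k j) e)))
    , A⇔
    where
    abstract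
      set : ∃[ A ] V A × Describes A (λ M → At facts M (num k) (num j))
      set = sep (atᴰ v3 v0 v1 v2) (numV k ∷ numV j ∷ factFam ∷ []) V𝒰
    A : 𝕍
    A = proj₁ set
    A⇔ : Describes A (Ev k j)
    A⇔ M = mk⇔
      (λ M∈ → let u , p = to (proj₂ (proj₂ set) M) M∈ in u , at-sound M k j (≐-refl (num k)) (≐-refl (num j)) p)
      (λ (u , e) → from (proj₂ (proj₂ set) M) (u , at-complete M k j (vM u) (≐-refl (num k)) (≐-refl (num j)) e))

  measRun : ∀ k n → Meas (Run k n)
  measRun k n = meas-∧ (meas-∀< (measEv k) n) (meas-¬ (measEv k n))

  private
    RunAt : 𝕍 → 𝕍 → 𝕍 → Set₁
    RunAt M a n = (∀ j → j ∈ n → At facts M a j) × ¬ At facts M a n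

    run-sound : ∀ M {a} k n → V M → a ≐ num k → RunAt M a (num n) → Run k n M
    run-sound M {a} k n VM a≐ (f , g) =
      (λ j j<n → at-sound M {a} {num j} k j a≐ (≐-refl (num j)) (f (num j) (num-∈ {j} {n} j<n)))
      , λ e → g (at-complete M {a} {num n} k n VM a≐ (≐-refl (num n)) e)

    run-complete : ∀ M {a} k n → V M → a ≐ num k → Run k n M → RunAt M a (num n)
    run-complete M {a} k n VM a≐ (f , g) =
      (λ j j∈ → let i , i<n , j≐ = ∈-num⁻ n j∈ in at-complete M {a} {j} k i VM a≐ j≐ (f i i<n))
      , λ e → g (at-sound M {a} {num n} k n a≐ (≐-refl (num n)) e)

    runs : (row : ℕ → ℕ) → (∃[ F ] Fam F × (∀ n → Describes (F n) (λ M → RunAt M (num (row n)) (num n)))) →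
           ∃[ F ] Fam F × (∀ n → Describes (F n) (Run (row n) n))
    runs row (F , fam , F⇔) = F , fam , λ n M → mk⇔
      (λ M∈ → let u , p = to (F⇔ n M) M∈ in u , run-sound M (row n) n (vM u) (≐-refl (num (row n))) p)
      (λ (u , q) → from (F⇔ n M) (u , run-complete M (row n) n (vM u) (≐-refl (num (row n))) q))

  abstract
    diagonal : ∃[ Y ] Fam Y × (∀ n → Describes (Y n) (Run n n))
    diagonal = runs id (setFamily (∀∈ᴰ v1 (atᴰ v3 v1 v2 v0) ∧ᴰ ¬ᴰ atᴰ v2 v0 v1 v1) (factFam ∷ []))

    zeroth : ∃[ Z ] Fam Z × (∀ n → Describes (Z n) (Run 0 n))
    zeroth = runs (λ _ → 0) (setFamily (∀∈ᴰ v1 (atᴰ v4 v1 v3 v0) ∧ᴰ ¬ᴰ atᴰ v3 v0 v2 v1) (numV 0 ∷ factFam ∷ []))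

  Y Z : ℕ → 𝕍
  Y = proj₁ diagonal
  Z = proj₁ zeroth

  famY : Fam Y
  famY = proj₁ (proj₂ diagonal)

  famZ : Fam Z
  famZ = proj₁ (proj₂ zeroth)

  Y⇔ : ∀ n → Describes (Y n) (Run n n)
  Y⇔ = proj₂ (proj₂ diagonal)

  Z⇔ : ∀ n → Describes (Z n) (Run 0 n)
  Z⇔ = proj₂ (proj₂ zeroth)

  Y∈ : ∀ n → Y n ∈ 𝒮
  Y∈ n = meas⇒𝒮 (measRun n n) (Y⇔ n)

  Z∈ : ∀ n → Z n ∈ 𝒮
  Z∈ n = meas⇒𝒮 (measRun 0 n) (Z⇔ n)

  Z-disjoint : ∀ m n M → M ∈ Z m → M ∈ Z n → m ≡ n
  Z-disjoint m n M p q =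
    let _ , f , ¬f = to (Z⇔ m M) p ; _ , g , ¬g = to (Z⇔ n M) q in
    case ℕ.<-cmp m n of λ { (tri< m<n _ _) → ⊥-elim (¬f (g m m<n))
                          ; (tri≈ _ m≡n _) → m≡n
                          ; (tri> _ _ n<m) → ⊥-elim (¬g (f n n<m)) }

  -- Row 0 can be moved to row n, so both runs have the same measure.
  Y≤Z : ∀ n q → q <μ Y n → q <μ Z n
  Y≤Z n q (s , Ys , q<s) = t , Zt , ∈-respʳ (measure-unique Ys Yt) q<s
    where
    open RowSwap n
    t = proj₁ (measure (Z∈ n))
    Zt : ⟨ Z n , t ⟩ ∈ ν
    Zt = proj₂ (measure (Z∈ n))
    moved : ∀ M N → Preserves L swap M N → ∀ j → Ev 0 j M ⇔ Ev n j N
    moved M N pres j = pres R (site 0 j) (site n j) arity (swap-site j)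
    forth : ∀ M N → Preserves L swap M N → Run 0 n M → Run n n N
    forth M N pres (f , g) = (λ j j<n → to (moved M N pres j) (f j j<n)) , λ e → g (from (moved M N pres n) e)
    back : ∀ M N → Preserves L swap M N → Run n n N → Run 0 n M
    back M N pres (f , g) = (λ j j<n → from (moved M N pres j) (f j j<n)) , λ e → g (to (moved M N pres n) e)
    -- Invariance speaks of the image of `Z n`, so each `N` in `Y n` needs a preimage in V: its
    -- pullback along `swap`.
    source : ∀ N → N ∈ Y n → Str V L X N × (∃[ M ] M ∈ Z n × Preserves L swap M N)
    source N N∈ = strN , M , from (Z⇔ n M) (from (𝒰⇔ M) (proj₁ (proj₂ pb) , proj₁ (proj₂ (proj₂ pb))) , back M N pres run) , pres
      where
      run : Run n n N
      run = proj₂ (to (Y⇔ n N) N∈)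
      strN : Str V L X N
      strN = to (𝒰⇔ N) (proj₁ (to (Y⇔ n N) N∈))
      pb : ∃[ M ] V M × IsStr L X M × Preserves L swap M N
      pb = pullback {L} {swap} {X} {X} {N} swapV VX (proj₁ strN) swap-map (proj₂ strN)
      M : 𝕍
      M = proj₁ pb
      pres : Preserves L swap M N
      pres = proj₂ (proj₂ (proj₂ pb))
    target : ∀ N → Str V L X N × (∃[ M ] M ∈ Z n × Preserves L swap M N) → N ∈ Y n
    target N (str , M , M∈ , pres) = from (Y⇔ n N) (from (𝒰⇔ N) str , forth M N pres (proj₂ (to (Z⇔ n M) M∈)))
    Yt : ⟨ Y n , t ⟩ ∈ ν
    Yt = invariant swap (Z n) (Y n) t swapV swap-bijection Zt (𝒮⇒V (Y∈ n)) λ N → mk⇔ (source N) (target N)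

  Limsup : 𝕍 → Set₁
  Limsup M = ∀ N → ∃[ k ] N ℕ.≤ k × Run k k M

  private
    Late : ℕ → 𝕍 → Set
    Late N M = ∃[ k ] N ℕ.≤ k × M ∈ Y k

    LateAt NotLate : 𝕍 → 𝕍 → Set₁
    LateAt N M = ∃[ k ] k ∈ ω × ¬ (k ∈ N) × Member Y k M
    NotLate N M = ¬ LateAt N M

    abstract
      lateSet : ∀ N → ∃[ F ] Fam F × (∀ n → Describes (F n) (λ M → ¬ (num n ∈ num N) × Member Y (num n) M))
      lateSet N = setFamily (¬ᴰ (v1 ∈ᴰ v2) ∧ᴰ ∃ᴰ (⟨ v2 , v0 ⟩∈ᴰ v4 ∧ᴰ v1 ∈ᴰ v0)) (numV N ∷ famY ∷ [])

      notLateSet : ∃[ F ] Fam F × (∀ N → Describes (F N) (NotLate (num N)))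
      notLateSet = setFamily (¬ᴰ ∃∈ᴰ v2 (¬ᴰ (v0 ∈ᴰ v2) ∧ᴰ ∃ᴰ (⟨ v1 , v0 ⟩∈ᴰ v5 ∧ᴰ v2 ∈ᴰ v0))) (ωV ∷ famY ∷ [])

    late⇔ : ∀ N n → Describes (proj₁ (lateSet N) n) (λ M → N ℕ.≤ n × M ∈ Y n)
    late⇔ N n M = mk⇔
      (λ M∈ → let u , n∉N , p = to (proj₂ (proj₂ (lateSet N)) n M) M∈ in
         u , from (≤⇔∉ N n) n∉N , member-sound Y n (≐-refl (num n)) p)
      (λ (u , N≤n , p) → from (proj₂ (proj₂ (lateSet N)) n M)
         (u , to (≤⇔∉ N n) N≤n , member-complete famY n (≐-refl (num n)) p))

    notLate⇔ : ∀ N → Describes (proj₁ notLateSet N) (λ M → ¬ Late N M)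
    notLate⇔ N M = mk⇔
      (λ M∈ → let u , none = to (proj₂ (proj₂ notLateSet) N M) M∈ in u , λ (k , N≤k , p) →
         none (num k , num-∈ω k , to (≤⇔∉ N k) N≤k , member-complete famY k (≐-refl (num k)) p))
      (λ (u , none) → from (proj₂ (proj₂ notLateSet) N M) (u , λ { (a , (k , a≐) , a∉N , p) →
         none (k , from (≤⇔∉ N k) (λ k∈N → a∉N (∈-respˡ {num k} {a} {num N} (≐-sym a≐) k∈N)) , member-sound Y k a≐ p) }))

  measLate : ∀ N → Meas (Late N)
  measLate N =
      meas-∃ (proj₁ (proj₂ (lateSet N))) (λ n → meas-∧ (meas-const (N ℕ.≤? n)) (meas-∈ (Y∈ n))) (late⇔ N)

  measLimsup : Meas Limsup
  measLimsup = meas-resp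
    (λ M u → mk⇔
      (λ ¬¬late N → case em₀ (Late N M) of λ
        { (yes (k , N≤k , p)) → k , N≤k , proj₂ (to (Y⇔ k M) p) ; (no ¬late) → ⊥-elim (¬¬late (N , ¬late)) })
      (λ limsup (N , ¬late) → let k , N≤k , run = limsup N in ¬late (k , N≤k , from (Y⇔ k M) (u , run))))
    (meas-¬ (meas-∃ (proj₁ (proj₂ notLateSet)) (λ N → meas-¬ (measLate N)) notLate⇔))

  null-limsup : Null (proj₁ measLimsup)
  null-limsup = borel-cantelli famY Y∈ famZ Z∈ Z-disjoint Y≤Z (proj₁ (proj₂ measLimsup)) λ M M∈ N →
    let u , limsup = to (proj₂ (proj₂ measLimsup) M) M∈ ; k , N≤k , run = limsup N in k , N≤k , from (Y⇔ k M) (u , run)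

-- Random generics

code-resp : ∀ {V κ L X γ δ} → γ ≐ δ → IsCode V κ L X γ → IsCode V κ L X δ
code-resp e (basic φ v v∈ q) = basic φ v v∈ (≐-trans (≐-sym e) q)
code-resp e (neg ζ q d)      = neg ζ (≐-trans (≐-sym e) q) d
code-resp e (join Γ q s ds)  = join Γ (≐-trans (≐-sym e) q) s ds
code-resp e (meet Γ q s ds)  = meet Γ (≐-trans (≐-sym e) q) s ds

int-resp : ∀ {V κ L X γ δ M} (e : γ ≐ δ) (d : IsCode V κ L X γ) → (M ∈Int d) ⇔ (M ∈Int code-resp e d)
int-resp e (basic φ v v∈ q) = mk⇔ id id
int-resp e (neg ζ q d)      = mk⇔ id id
int-resp e (join Γ q s ds)  = mk⇔ id id
int-resp e (meet Γ q s ds)  = mk⇔ id id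

module Codes (em : ExcludedMiddle (lsuc 0ℓ)) (V : Class) (isModel : IsTransitiveModel V)
             {κ X L R ν : 𝕍} (Vκ : V κ) (VX : V X) (infinite : Infinite V X) (VR : V R)
             {m : ℕ} (arity : Arity L R m) (r : Fin m → Fin m)
             (ω⊆κ : ∀ n → num n ∈ κ) (im : IsInvariantMeasure V κ L X ν) where
  open IsTransitiveModel isModel
  open IsInvariantMeasure im
  open IsProbabilityMeasure isProbabilityMeasure
  open NullRuns em V isModel VX infinite VR {m} arity r ω⊆κ im
  open Classical em

  -- For a double sequence given by one formula, the sequence of its rows, each taken as a set and
  -- tagged by `a`, belongs to V. With `a` the tag of a join or a meet this is a sequence of codes,
  -- one per row.
  module Array (F : ℕ → ℕ → 𝕍) (FV : ∀ k n → V (F k n)) {l} {P : Vec 𝕍 (suc (suc (suc l))) → Set ℓ} (d : Dfn P)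
               {ρ : Vec 𝕍 l} (vs : AllV ρ) (func : ∀ k n z → V z → P (z ∷ num n ∷ num k ∷ ρ) ⇔ z ≐ F k n) where

    rowFam : ∀ k → Fam (F k)
    rowFam k = graphV ℕ num ωV (F k) (FV k) d (numV k ∷ vs) (func k)

    collectFam : ∀ {a} → V a → Fam (λ k → ⟨ a , sup ℕ (F k) ⟩)
    collectFam {a} Va = graphV ℕ num ωV _ (λ k → ⟨⟩V Va (rangeV (rowFam k)))
      (∃ᴰ (v1 ≐⟨ v3 , v0 ⟩ᴰ ∧ᴰ ∀∈ᴰ v0 (∃∈ᴰ v5 (shiftᴰ 7 (v1 ∷ v0 ∷ v4 ∷ []) d)) ∧ᴰ ∀∈ᴰ v4 (∀ᴰ (shiftᴰ 7 (v0 ∷ v1 ∷ v4 ∷ []) d ⇒ᴰ v0 ∈ᴰ v2))))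
      (Va ∷ ωV ∷ vs) λ k y Vy → mk⇔ (sound k y) (complete k y)
      where
      Enumerates : ℕ → 𝕍 → Set _
      Enumerates k Γ = (∀ z → z ∈ Γ → ∃[ n ] n ∈ ω × P (z ∷ n ∷ num k ∷ ρ))
                     × (∀ n → n ∈ ω → ∀ z → V z → P (z ∷ n ∷ num k ∷ ρ) → z ∈ Γ)
      at-num : ∀ k {n n′ z} → V z → n ≐ num n′ → P (z ∷ n ∷ num k ∷ ρ) → z ≐ F k n′
      at-num k {n} {n′} {z} Vz n≐ p = to (func k n′ z Vz)
        (resp d (Vz ∷ respects _ _ (≐-sym n≐) (numV n′) ∷ numV k ∷ vs) (Vz ∷ numV n′ ∷ numV k ∷ vs)
          (≐-refl z ∷ n≐ ∷ ≐*-refl)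
          p)
      enum-row : ∀ k → Enumerates k (sup ℕ (F k))
      enum-row k = (λ { z (n , e) → num n , num-∈ω n , (from (func k n z (respects _ _ (≐-sym e) (FV k n))) e) })
                 , (λ { n (n′ , n≐) z Vz p → n′ , at-num k {n} {n′} {z} Vz n≐ p })
      sound : ∀ k y → (∃[ Γ ] V Γ × y ≐ ⟨ a , Γ ⟩ × Enumerates k Γ) → y ≐ ⟨ a , sup ℕ (F k) ⟩
      sound k y (Γ , VΓ , e , f , g) = ≐-trans e (⟨⟩-cong (≐-refl a) (ext {Γ} {sup ℕ (F k)}
        (λ z z∈ → case f z z∈ of λ { (n , (n′ , n≐) , p) → n′ , at-num k {n} {n′} {z} (elemV VΓ z∈) n≐ p })
        (λ { z (n , z≐) → let Vz = respects _ _ (≐-sym z≐) (FV k n) in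
               g (num n) (num-∈ω n) z Vz (from (func k n z Vz) z≐) })))
      complete : ∀ k y → y ≐ ⟨ a , sup ℕ (F k) ⟩ → ∃[ Γ ] V Γ × y ≐ ⟨ a , Γ ⟩ × Enumerates k Γ
      complete k y e = sup ℕ (F k) , rangeV (rowFam k) , e , enum-row k

  private
    φ : List (Literal L m)
    φ = atom (rel R m arity (tabulate r)) ∷ []

    φV : V ⌜ φ ⌝ᶜ
    φV = ⟨⟩V (⟨⟩V (numV 1) (⟨⟩V VR (nums (tabulate r)))) (numV 0)
      where
      nums : ∀ {n} (is : Vec (Fin m) n) → V (tuple (Vec.map (λ i → num (toℕ i)) is))
      nums []       = numV 0
      nums (i ∷ is) = ⟨⟩V (numV (toℕ i)) (nums is)

    b : ℕ × ℕ → 𝕍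
    b (k , j) = basicᶜ φ (args k j)

    bFam : Fam² b
    bFam = Fam².pairFam {λ _ → num 0} {λ (k , j) → ⟨ ⌜ φ ⌝ᶜ , tuple (args k j) ⟩} (Fam².constFam (numV 0))
             (Fam².pairFam {λ _ → ⌜ φ ⌝ᶜ} {λ (k , j) → tuple (args k j)} (Fam².constFam φV) argsFam)

    bs : 𝕍
    bs = graph (ℕ × ℕ) num² b

    bV : ∀ k j → V (b (k , j))
    bV k j = Fam².famV {b} bFam (k , j)

    -- The `k + 1` conjuncts of `Run k k` as an infinite sequence: the negated conjunct comes at
    -- `j = k` and is repeated from there on, since meets of codes are enumerated by κ.
    stepOf : ∀ {k j} → Dec (j ℕ.< k) → 𝕍
    stepOf {k} {j} (yes _) = b (k , j)
    stepOf {k} {j} (no _)  = ¬ᶜ b (k , k)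

    step : ℕ → ℕ → 𝕍
    step k j = stepOf (j ℕ.<? k)

    stepOfV : ∀ {k j} (d : Dec (j ℕ.< k)) → V (stepOf d)
    stepOfV {k} {j} (yes _) = bV k j
    stepOfV {k} {j} (no _)  = ⟨⟩V (numV 1) (bV k k)

    InB : 𝕍 → 𝕍 → 𝕍 → Set₁
    InB k j z = ∃[ p ] V p × p ≐ ⟨ k , j ⟩ × ⟨ p , z ⟩ ∈ bs

    inB⇔ : ∀ k j z → InB (num k) (num j) z ⇔ z ≐ b (k , j)
    inB⇔ k j z = mk⇔
      (λ (p , _ , p≐ , pz) → to (fam²At {b} {p} {k , j} p≐) pz)
      (λ e → num² (k , j) , ⟨⟩V (numV k) (numV j) , ≐-refl (num² (k , j)) , from (fam²∈ {b} {k , j} {z}) e)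

    StepAt : 𝕍 → 𝕍 → 𝕍 → Set₁
    StepAt z j k = (j ∈ k × InB k j z) ⊎ (¬ (j ∈ k) × (∃[ c ] V c × InB k k c × z ≐ ⟨ num 1 , c ⟩))

    step⇔ : ∀ k j z → StepAt z (num j) (num k) ⇔ z ≐ step k j
    step⇔ k j z = go (j ℕ.<? k)
      where
      go : (d : Dec (j ℕ.< k)) → StepAt z (num j) (num k) ⇔ z ≐ stepOf d
      go (yes j<k) = mk⇔
        (λ { (inj₁ (_ , q)) → to (inB⇔ k j z) q ; (inj₂ (j∉ , _)) → ⊥-elim (j∉ (num-∈ {j} {k} j<k)) })
        (λ e → inj₁ (num-∈ {j} {k} j<k , from (inB⇔ k j z) e))
      go (no j≮k) = mk⇔
        (λ { (inj₁ (j∈ , _)) → ⊥-elim (j≮k (num-∈⁻ {j} {k} j∈))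
           ; (inj₂ (_ , c , _ , q , e)) → ≐-trans e (⟨⟩-cong (≐-refl (num 1)) (to (inB⇔ k k c) q)) })
        (λ e → inj₂ ((λ j∈ → j≮k (num-∈⁻ {j} {k} j∈)) , b (k , k) , bV k k , from (inB⇔ k k (b (k , k))) (≐-refl (b (k , k))) , e))

    module Steps = Array step (λ k j → stepOfV (j ℕ.<? k))
      (v1 ∈ᴰ v2 ∧ᴰ ∃ᴰ (v0 ≐⟨ v3 , v2 ⟩ᴰ ∧ᴰ ⟨ v0 , v1 ⟩∈ᴰ v4)
       ∨ᴰ ¬ᴰ (v1 ∈ᴰ v2) ∧ᴰ ∃ᴰ (∃ᴰ (v0 ≐⟨ v4 , v4 ⟩ᴰ ∧ᴰ ⟨ v0 , v1 ⟩∈ᴰ v5) ∧ᴰ v1 ≐⟨ v5 , v0 ⟩ᴰ))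
      (bFam ∷ numV 1 ∷ []) (λ k j z _ → step⇔ k j z)

    -- y k codes Run k k, w N the union of Run k k over k ≥ N, and W the limit superior.
    y : ℕ → 𝕍
    y k = ⋀ᶜ sup ℕ (step k)

    yFam : Fam y
    yFam = Steps.collectFam (numV 3)

    -- `N ⊔ n` runs over exactly the indices from `N` on, so the join over them is indexed by all
    -- natural numbers.
    late : ℕ → ℕ → 𝕍
    late N n = y (N ℕ.⊔ n)

    LateAt : 𝕍 → 𝕍 → 𝕍 → Set
    LateAt z n N = (n ∈ N × ⟨ N , z ⟩ ∈ graph ℕ num y) ⊎ (¬ (n ∈ N) × ⟨ n , z ⟩ ∈ graph ℕ num y)

    late⇔ : ∀ N n z → LateAt z (num n) (num N) ⇔ z ≐ late N n
    late⇔ N n z = case n ℕ.<? N of λ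
      { (yes n<N) → mk⇔
          (λ { (inj₁ (_ , q)) → ≐-trans (to (fam∈ {y} {N} {z}) q) (≡⇒≐ (cong y (sym (ℕ.m≥n⇒m⊔n≡m (ℕ.<⇒≤ n<N)))))
             ; (inj₂ (n∉ , _)) → ⊥-elim (n∉ (num-∈ {n} {N} n<N)) })
          (λ e → inj₁ (num-∈ {n} {N} n<N , from (fam∈ {y} {N} {z}) (≐-trans e (≡⇒≐ (cong y (ℕ.m≥n⇒m⊔n≡m (ℕ.<⇒≤ n<N)))))))
      ; (no n≮N) → mk⇔
          (λ { (inj₁ (n∈ , _)) → ⊥-elim (n≮N (num-∈⁻ {n} {N} n∈))
             ; (inj₂ (_ , q)) → ≐-trans (to (fam∈ {y} {n} {z}) q) (≡⇒≐ (cong y (sym (ℕ.m≤n⇒m⊔n≡n (ℕ.≮⇒≥ n≮N))))) })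
          (λ e → inj₂ ((λ n∈ → n≮N (num-∈⁻ {n} {N} n∈))
                      , from (fam∈ {y} {n} {z}) (≐-trans e (≡⇒≐ (cong y (ℕ.m≤n⇒m⊔n≡n (ℕ.≮⇒≥ n≮N))))))) }

    module Lates = Array late (λ N n → famV {y} yFam (N ℕ.⊔ n))
      (v1 ∈ᴰ v2 ∧ᴰ ⟨ v2 , v0 ⟩∈ᴰ v3 ∨ᴰ ¬ᴰ (v1 ∈ᴰ v2) ∧ᴰ ⟨ v1 , v0 ⟩∈ᴰ v3) (yFam ∷ []) (λ N n z _ → late⇔ N n z)

    w : ℕ → 𝕍
    w N = ⋁ᶜ sup ℕ (late N)

    wFam : Fam w
    wFam = Lates.collectFam (numV 2)

    W : 𝕍
    W = ⋀ᶜ sup ℕ w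

    WV : V W
    WV = ⟨⟩V (numV 3) (rangeV wFam)

    Code : 𝕍 → Set₁
    Code = IsCode V κ L X

    -- Codes ask for enumerations by κ, which may be larger than ω: a countable sequence is
    -- stretched by giving the default value `F 0` to the elements of κ outside ω.
    enumerated : ∀ {F : ℕ → 𝕍} → Fam F → ∀ Γ → Γ ≐ sup ℕ F → ∃[ f ] V f × IsSurjection f κ Γ
    enumerated {F} fam Γ Γ≐ = proj₁ relation , proj₁ (proj₂ relation)
      , ((λ q q∈ → let a , z , e , a∈ , z∈ = proj₂ (proj₂ (proj₂ relation)) q q∈ in a , z , e , a∈ , ∈-respʳ (≐-sym Γ≐) z∈)
        , total′ , functional) , λ z z∈ → surjective z (∈-respʳ Γ≐ z∈)
      where
      abstract
        relation : ∃[ f ] V f × (∀ a z → ⟨ a , z ⟩ ∈ f ⇔ (a ∈ κ × z ∈ sup ℕ F × (⟨ a , z ⟩ ∈ graph ℕ num F ⊎ (¬ (a ∈ ω) × z ≐ F 0))))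
                         × (∀ p → p ∈ f → ∃[ a ] ∃[ z ] p ≐ ⟨ a , z ⟩ × a ∈ κ × z ∈ sup ℕ F)
        relation = relationV (⟨ v0 , v1 ⟩∈ᴰ v2 ∨ᴰ (¬ᴰ (v0 ∈ᴰ v3) ∧ᴰ v1 ≐ᴰ v4)) (fam ∷ ωV ∷ famV fam 0 ∷ []) Vκ (rangeV fam)
      f⇔ = proj₁ (proj₂ (proj₂ relation))
      total′ : ∀ a → a ∈ κ → ∃[ z ] ⟨ a , z ⟩ ∈ proj₁ relation
      total′ a a∈ = case em₀ (a ∈ ω) of λ
        { (yes (n , a≐)) → F n , from (f⇔ a (F n)) (a∈ , elem ℕ F n , inj₁ (from (famAt {F} {a} {n} a≐) (≐-refl (F n))))
        ; (no a∉) → F 0 , from (f⇔ a (F 0)) (a∈ , elem ℕ F 0 , inj₂ (a∉ , ≐-refl (F 0))) }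
      functional : ∀ a z z′ → ⟨ a , z ⟩ ∈ proj₁ relation → ⟨ a , z′ ⟩ ∈ proj₁ relation → z ≐ z′
      functional a z z′ p q = go (proj₂ (proj₂ (to (f⇔ a z) p))) (proj₂ (proj₂ (to (f⇔ a z′) q)))
        where
        inω : ∀ {z} → ⟨ a , z ⟩ ∈ graph ℕ num F → a ∈ ω
        inω {z} (n , e) = n , ⟨⟩-injˡ {a} {num n} {z} {F n} e
        go : ⟨ a , z ⟩ ∈ graph ℕ num F ⊎ (¬ (a ∈ ω) × z ≐ F 0) → ⟨ a , z′ ⟩ ∈ graph ℕ num F ⊎ (¬ (a ∈ ω) × z′ ≐ F 0) → z ≐ z′
        go (inj₁ r) (inj₁ s) = let n , a≐ = inω {z} r in ≐-trans (to (famAt {F} {a} {n} a≐) r) (≐-sym (to (famAt {F} {a} {n} a≐) s))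
        go (inj₁ r) (inj₂ (a∉ , _)) = ⊥-elim (a∉ (inω {z} r))
        go (inj₂ (a∉ , _)) (inj₁ r) = ⊥-elim (a∉ (inω {z′} r))
        go (inj₂ (_ , e)) (inj₂ (_ , e′)) = ≐-trans e (≐-sym e′)
      surjective : ∀ z → z ∈ sup ℕ F → ∃[ a ] ⟨ a , z ⟩ ∈ proj₁ relation
      surjective z z∈@(n , e) = num n , from (f⇔ (num n) z) (ω⊆κ n , z∈ , inj₁ (from (fam∈ {F} {n} {z}) e))

    bCode : ∀ k j → Code (b (k , j))
    bCode k j = basic φ (args k j) (args∈X k j) (≐-refl (b (k , j)))

    stepCode : ∀ {k j γ} (d : Dec (j ℕ.< k)) → γ ≐ stepOf d → Code γ
    stepCode {k} {j} (yes _) e = code-resp (≐-sym e) (bCode k j)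
    stepCode {k} {j} (no _)  e = neg (b (k , k)) e (bCode k k)

    yCode : ∀ {γ} k → γ ≐ y k → Code γ
    yCode k e = meet (sup ℕ (step k)) e (enumerated (Steps.rowFam k) _ (≐-refl (sup ℕ (step k)))) λ { δ (j , e′) → stepCode {k} {j} (j ℕ.<? k) e′ }

    wCode : ∀ {γ} N → γ ≐ w N → Code γ
    wCode N e = join (sup ℕ (late N)) e (enumerated (Lates.rowFam N) _ (≐-refl (sup ℕ (late N)))) λ { δ (n , e′) → yCode (N ℕ.⊔ n) e′ }

    WCode : Code W
    WCode = meet (sup ℕ w) (≐-refl W) (enumerated wFam _ (≐-refl (sup ℕ w))) λ { δ (N , e) → wCode N e }

    b-int : ∀ {M} k j → ⊨ᶜ M φ (args k j) ⇔ Ev k j M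
    b-int {M} k j = mk⇔ (λ { (p ∷ []) → subst (Holds M R) (args-site k j) p })
                        (λ p → subst (Holds M R) (sym (args-site k j)) p ∷ [])

    y-sound : ∀ {M γ} k (e : γ ≐ y k) → M ∈Int yCode k e → Run k k M
    y-sound {M} k e int = (λ j j<k → go (j ℕ.<? k) j<k (int (step k j) (elem ℕ (step k) j)))
                        , stop (k ℕ.<? k) (int (step k k) (elem ℕ (step k) k))
      where
      go : ∀ {j γ} (d : Dec (j ℕ.< k)) {e : γ ≐ stepOf d} → j ℕ.< k → M ∈Int stepCode d e → Ev k j M
      go {j} (yes _) _ int = to (b-int {M} k j) int
      go (no j≮k) j<k _ = ⊥-elim (j≮k j<k)
      stop : ∀ {γ} (d : Dec (k ℕ.< k)) {e : γ ≐ stepOf d} → M ∈Int stepCode d e → ¬ Ev k k M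
      stop (yes k<k) _ = ⊥-elim (ℕ.<-irrefl refl k<k)
      stop (no _) int ev = int (from (b-int {M} k k) ev)

    y-complete : ∀ {M γ} k (e : γ ≐ y k) → Run k k M → M ∈Int yCode k e
    y-complete {M} k e (f , g) δ (j , e′) = go (j ℕ.<? k)
      where
      go : (d : Dec (j ℕ.< k)) {e : δ ≐ stepOf d} → M ∈Int stepCode d e
      go (yes j<k) = from (b-int {M} k j) (f j j<k)
      go (no _) = λ int → g (to (b-int {M} k k) int)

    W-sound : ∀ {M} → M ∈Int WCode → Limsup M
    W-sound {M} int N = case int (w N) (elem ℕ w N) of λ
      { (δ , (n , e) , run) → N ℕ.⊔ n , ℕ.m≤m⊔n N n , y-sound {M} (N ℕ.⊔ n) e run }

    W-complete : ∀ {M} → Limsup M → M ∈Int WCode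
    W-complete {M} limsup δ (N , e) =
      let k , N≤k , run = limsup N ; N⊔k≡k = ℕ.m≤n⇒m⊔n≡n N≤k in
      late N k , elem ℕ (late N) k , y-complete {M} (N ℕ.⊔ k) (≐-refl (y (N ℕ.⊔ k))) (subst (λ k → Run k k M) (sym N⊔k≡k) run)

    L∞ : 𝕍
    L∞ = proj₁ measLimsup
    L∞∈ : L∞ ∈ 𝒮
    L∞∈ = proj₁ (proj₂ measLimsup)
    L∞⇔ : Describes L∞ Limsup
    L∞⇔ = proj₂ (proj₂ measLimsup)

  -- The measure says nothing directly about `M`, which may lie outside V. But as `W` codes a null
  -- event, its negation has positive measure and is weaker than every condition, so the filter
  -- contains it by upward closure, and `M` satisfies each of its conditions.
  random⇒¬limsup : ∀ {M} → IsRandomGeneric V κ L X ν M → ¬ Limsup M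
  random⇒¬limsup {M} (P , E , G , (VP , VE , P⇔ , E⇔) , (G⊆P , (p , p∈G) , up , _) , M∈V[G] , char) limsup =
    proj₂ (from (char M M∈V[G]) (≐-refl M)) (¬ᶜ W) ¬W∈G ¬WCode (W-complete limsup)
    where
    ¬WCode : Code (¬ᶜ W)
    ¬WCode = neg W (≐-refl (¬ᶜ W)) WCode

    abstract
      co : Meas (λ M → ¬ Limsup M)
      co = meas-¬ measLimsup
    ¬W∈P : (¬ᶜ W) ∈ P
    ¬W∈P = from (P⇔ (¬ᶜ W)) (⟨⟩V (numV 1) WV , ¬WCode , proj₁ pos , (proj₁ co , 𝒮⇒V (proj₁ (proj₂ co)) , co⇔ , proj₁ (proj₂ pos)) , proj₂ (proj₂ pos))
      where
      pos : 0ℚ <μ proj₁ co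
      pos = co-null-positive L∞∈ null-limsup (proj₁ (proj₂ co)) λ M → mk⇔
        (λ M∈ → let u , ¬l = to (proj₂ (proj₂ co) M) M∈ in u , λ q → ¬l (proj₂ (to (L∞⇔ M) q)))
        (λ (u , ¬q) → from (proj₂ (proj₂ co) M) (u , λ l → ¬q (from (L∞⇔ M) (u , l))))
      co⇔ : ∀ M → M ∈ proj₁ co ⇔ (Str V L X M × ¬ (M ∈Int WCode))
      co⇔ M = mk⇔
        (λ M∈ → let u , ¬l = to (proj₂ (proj₂ co) M) M∈ in to (𝒰⇔ M) u , λ int → ¬l (W-sound {M} int))
        (λ (s , ¬int) → from (proj₂ (proj₂ co) M) (from (𝒰⇔ M) s , λ l → ¬int (W-complete {M} l)))

    p∈P : p ∈ P
    p∈P = G⊆P p p∈G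
    Vp : V p
    Vp = elemV VP p∈P

    -- The order compares `p` with `¬ᶜ W` through the code of `p` and not `¬ᶜ W`, hence the double
    -- negation.
    ¬¬W : 𝕍
    ¬¬W = ¬ᶜ ¬ᶜ W
    both : 𝕍
    both = ⁅ p , ¬¬W ⁆
    ¬¬WV : V ¬¬W
    ¬¬WV = ⟨⟩V (numV 1) (⟨⟩V (numV 1) WV)

    enum-both : ∃[ f ] V f × IsSurjection f κ both
    enum-both = enumerated {cons p λ _ → ¬¬W} (consFam Vp (constFam ¬¬WV))
      both ((λ { true → 0 , ≐-refl p ; false → 1 , ≐-refl ¬¬W }) , λ { zero → true , ≐-refl p ; (suc _) → false , ≐-refl ¬¬W })

    -- Every condition lies below ¬W, because its meet with W is null.
    below : ⟨ p , ¬ᶜ W ⟩ ∈ E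
    below = case proj₂ (to (P⇔ p) p∈P) of λ (dp , _ , (A , VA , A⇔ , Aν) , _) → build dp A A⇔ (ν⇒𝒮 Aν)
      where
      build : ∀ dp A → (∀ M → M ∈ A ⇔ (Str V L X M × M ∈Int dp)) → A ∈ 𝒮 → ⟨ p , ¬ᶜ W ⟩ ∈ E
      build dp A A⇔ A∈ = from (E⇔ ⟨ p , ¬ᶜ W ⟩) (p , ¬ᶜ W , ≐-refl ⟨ p , ¬ᶜ W ⟩ , p∈P , ¬W∈P , bothCode
          , proj₁ meas , (proj₁ cap , 𝒮⇒V (proj₁ (proj₂ cap)) , cap⇔ , proj₂ meas) , null⇒0 (proj₂ meas) null)
        where
        member : ∀ δ → δ ≐ p ⊎ δ ≐ ¬¬W → Code δ
        member δ (inj₁ e) = code-resp (≐-sym e) dp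
        member δ (inj₂ e) = neg (¬ᶜ W) e ¬WCode
        bothCode : Code (p ∧ᶜ ¬¬W)
        bothCode = meet both (≐-refl (p ∧ᶜ ¬¬W)) enum-both λ δ δ∈ → member δ (∈⁅⁆⁻ {δ} {p} {¬¬W} δ∈)
        both-int : ∀ M → (M ∈Int bothCode) ⇔ (M ∈Int dp × Limsup M)
        both-int M = mk⇔
          (λ int → from (int-resp (≐-sym (≐-refl p)) dp) (int p (true , ≐-refl p))
                 , dne λ ¬l → int ¬¬W (false , ≐-refl ¬¬W) λ i → ¬l (W-sound {M} i))
          (λ (i , l) δ δ∈ → go δ i l (∈⁅⁆⁻ {δ} {p} {¬¬W} δ∈))
          where
          go : ∀ δ → M ∈Int dp → Limsup M → (s : δ ≐ p ⊎ δ ≐ ¬¬W) → M ∈Int member δ s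
          go δ i l (inj₁ e) = to (int-resp (≐-sym e) dp) i
          go δ i l (inj₂ e) = λ ¬int → ¬int (W-complete {M} l)
        abstract
          cap : Meas (λ M → M ∈ A × Limsup M)
          cap = meas-∧ (meas-∈ A∈) measLimsup
        meas : ∃[ r ] ⟨ proj₁ cap , r ⟩ ∈ ν
        meas = measure (proj₁ (proj₂ cap))
        cap⇔ : ∀ M → M ∈ proj₁ cap ⇔ (Str V L X M × M ∈Int bothCode)
        cap⇔ M = mk⇔
          (λ M∈ → let u , a , l = to (proj₂ (proj₂ cap) M) M∈ in
             to (𝒰⇔ M) u , from (both-int M) (proj₂ (to (A⇔ M) a) , l))
          (λ (s , int) → let i , l = to (both-int M) int in
             from (proj₂ (proj₂ cap) M) (from (𝒰⇔ M) s , from (A⇔ M) (s , i) , l))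
        null : Null (proj₁ cap)
        null = null-mono (proj₁ (proj₂ cap)) L∞∈
          (λ M M∈ → let u , _ , l = to (proj₂ (proj₂ cap) M) M∈ in from (L∞⇔ M) (u , l)) null-limsup

    ¬W∈G : (¬ᶜ W) ∈ G
    ¬W∈G = up p (¬ᶜ W) p∈G ¬W∈P below

-- Cohen generics

holds-respˡ : ∀ {M N R n} {v : Vec 𝕍 n} → M ≐ N → Holds M R v → Holds N R v
holds-respˡ e (A , I , q , p) = A , I , ≐-trans (≐-sym e) q , p

str-resp : ∀ {L A M N} → M ≐ N → IsStr L A M → IsStr L A N
str-resp e (I , q , f) = I , ≐-trans (≐-sym e) q , f

module CohenRuns (em : ExcludedMiddle (lsuc 0ℓ)) (V : Class) (isModel : IsTransitiveModel V)
                 {X L : 𝕍} (VX : V X) (infinite : Infinite V X) {K : Class} (fraisse : IsStrongFraisse V L K)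
                 (sep′ : Classical.Separation em L K) (VR : V (Classical.Separation.R sep′)) where
  open IsTransitiveModel isModel
  open Classical em
  open Separation sep′
  open Amalgamation V isModel fraisse
  open IsStrongFraisse fraisse

  index : Fin m → Fin m
  index = proj₁ (pattern-index v⁺)

  open Events em V isModel VX infinite VR {m} arity index

  site-inj : ∀ k j j′ i i′ → lookup (site k j) i ≐ lookup (site k j′) i′ → (j , toℕ (index i)) ≡ (j′ , toℕ (index i′))
  site-inj k j j′ i i′ e = idx-inj {j} {toℕ (index i)} {j′} {toℕ (index i′)} (cong proj₂
    (grid-inj (k , idx j (toℕ (index i))) (k , idx j′ (toℕ (index i′)))
      (subst₂ _≐_ (lookup-site k j i) (lookup-site k j′ i′) e)))

  site-pattern : ∀ k j i i′ → lookup (site k j) i ≐ lookup (site k j) i′ ⇔ lookup v⁺ i ≐ lookup v⁺ i′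
  site-pattern k j i i′ = ⇔-trans (mk⇔ fwd bwd) (proj₂ (pattern-index v⁺) i i′)
    where
    fwd : lookup (site k j) i ≐ lookup (site k j) i′ → index i ≡ index i′
    fwd e = Fin.toℕ-injective (cong proj₂ (site-inj k j j i i′ e))
    bwd : index i ≡ index i′ → lookup (site k j) i ≐ lookup (site k j) i′
    bwd e = subst₂ _≐_ (sym (lookup-site k j i)) (sym (lookup-site k j i′)) (≡⇒≐ (cong (block k j) e))

  site∈X : ∀ k j i → lookup (site k j) i ∈ X
  site∈X k j i = subst (_∈ X) (sym (lookup-site k j i)) (grid∈X (k , idx j (toℕ (index i))))

  siteV : ∀ k j → AllV (site k j)
  siteV k j = allExt λ i → elemV VX (site∈X k j i)

  -- Rows are disjoint, so each entry of a finite enumeration of `A` spoils at most one row; `B`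
  -- exceeds all of these.
  avoids : ∀ {A} → Finite V A → ∃[ B ] (∀ k → B ℕ.≤ k → ∀ i → ¬ (grid (k , i) ∈ A))
  avoids {A} (n , f , _ , _ , ((fMap@(_ , _ , fun)) , fSurj)) =
    let B , free = go n in B , λ k B≤k i p →
      let x , q = fSurj (grid (k , i)) p ; m , m<n , x≐ = ∈-num⁻ n (proj₁ (map-codomain fMap q))
      in free k B≤k i m m<n (pair-respˡ {x} {num m} {f} (grid (k , i)) x≐ q)
    where
    Free : ℕ → ℕ → Set
    Free n B = ∀ k → B ℕ.≤ k → ∀ i m → m ℕ.< n → ¬ (⟨ num m , grid (k , i) ⟩ ∈ f)
    go : ∀ n → ∃[ B ] Free n B
    extended : ∀ n B → Free n B → Dec (∃[ p ] ⟨ num n , grid p ⟩ ∈ f) → ∃[ B ] Free (suc n) B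
    go zero = 0 , λ k _ i m ()
    go (suc n) = let B , free = go n in extended n B free (em₀ (∃[ p ] ⟨ num n , grid p ⟩ ∈ f))
    extended n B free (no none) = B , λ k B≤k i m m<1+n q →
      [ (λ m<n → free k B≤k i m m<n q) , (λ { refl → none ((k , i) , q) }) ]′ (ℕ.m≤n⇒m<n∨m≡n (ℕ.s≤s⁻¹ m<1+n))
    extended n B free (yes ((k₀ , i₀) , q₀)) = suc k₀ ℕ.⊔ B , λ k B≤k i m m<1+n q →
      [ (λ m<n → free k (ℕ.≤-trans (ℕ.m≤n⊔m (suc k₀) B) B≤k) i m m<n q)
      , (λ { refl → ℕ.<-irrefl (cong proj₁ (grid-inj (k₀ , i₀) (k , i) (fun (num n) _ _ q₀ q)))
                      (ℕ.≤-trans (ℕ.m≤m⊔n (suc k₀) B) B≤k) }) ]′ (ℕ.m≤n⇒m<n∨m≡n (ℕ.s≤s⁻¹ m<1+n))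

  sub-refl : ∀ {A M} → IsStr L A M → IsSubstructure L M M
  sub-refl {A} str = A , A , str , str , (λ _ → id) , λ R v _ _ → mk⇔ id id

  sub-trans : ∀ {M N Q} → IsSubstructure L M N → IsSubstructure L N Q → IsSubstructure L M Q
  sub-trans (A , B , sA , sB , A⊆B , e) (B′ , C , sB′ , sC , B′⊆C , e′) =
    A , C , sA , sC , (λ x x∈ → B′⊆C x (∈-respʳ B≐B′ (A⊆B x x∈)))
    , λ R v ar v∈ → ⇔-trans (e R v ar v∈) (e′ R v ar (VecAll.map (λ {x} x∈ → ∈-respʳ B≐B′ (A⊆B x x∈)) v∈))
    where B≐B′ = carrier-unique sB sB′

  sub-holds : ∀ {M N R n} {v : Vec 𝕍 n} → Arity L R n → IsSubstructure L M N → Holds M R v → Holds N R v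
  sub-holds {R = R} {v = v} ar (_ , _ , sA , _ , _ , e) h = to (e R v ar (holds⇒∈ sA h)) h

  module _ {p A} (Kp : K p) (strp : IsStr L A p) (A⊆X : A ⊆ X) (k : ℕ) (free : ∀ i → ¬ (grid (k , i) ∈ A)) where

    -- `used` confines the added points to earlier blocks of row `k`; this makes the points of block
    -- `j` fresh for the next amalgamation.
    record Stage (j : ℕ) : Set₁ where
      field
        q D     : 𝕍
        inK     : K q
        isStr   : IsStr L D q
        D⊆X     : D ⊆ X
        extends : IsSubstructure L p q
        holds   : ∀ i → i ℕ.< j → Ev k i q
        used    : ∀ x → x ∈ D → x ∈ A ⊎ (∃[ i ] ∃[ c ] i ℕ.< j × x ≐ lookup (site k i) c)

    open Stage

    unused : ∀ {j} (s : Stage j) c → ¬ (lookup (site k j) c ∈ D s)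
    unused {j} s c x∈ = [ (λ x∈A → free (idx j (toℕ (index c))) (subst (_∈ A) (lookup-site k j c) x∈A))
      , (λ (i , c′ , i<j , e) → ℕ.<-irrefl (sym (cong proj₁ (site-inj k j i c c′ e))) i<j) ]′ (used s (lookup (site k j) c) x∈)

    abstract
      attach : ∀ {j} (s : Stage j) {N B} → K N → IsStr L B N → (v : Vec 𝕍 m) → VecAll.All (_∈ B) v →
        (∀ i i′ → lookup v⁺ i ≐ lookup v⁺ i′ ⇔ lookup v i ≐ lookup v i′) → Extension (q s) (D s) N v (site k j)
      attach {j} s KN strN v v∈ same′ = extend (inK s) (isStr s) KN strN v (site k j) v∈ (siteV k j)
        (λ i i′ → ⇔-trans (site-pattern k j i i′) (same′ i i′)) (unused s)

    initial : Stage 0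
    initial = record { q = p ; D = A ; inK = Kp ; isStr = strp ; D⊆X = A⊆X ; extends = sub-refl strp
                     ; holds = λ i () ; used = λ x → inj₁ }

    advance : ∀ {j} → Stage j → Stage (suc j)
    advance {j} s = record
      { q = Extension.q e ; D = Extension.D′ e ; inK = Extension.inK e ; isStr = Extension.isStr e
      ; D⊆X = λ x x∈ → [ D⊆X s x , (λ (i , x≐) → ∈-respˡ (≐-sym x≐) (site∈X k j i)) ]′ (Extension.only e x x∈)
      ; extends = sub-trans (extends s) (Extension.extends e)
      ; holds = λ i i<1+j → [ (λ i<j → sub-holds arity (Extension.extends e) (holds s i i<j))
                            , (λ { refl → from (Extension.realizes e R arity) holds⁺ }) ]′ (ℕ.m≤n⇒m<n∨m≡n (ℕ.s≤s⁻¹ i<1+j))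
      ; used = λ x x∈ → [ (λ x∈D → [ inj₁ , (λ (i , c , i<j , x≐) → inj₂ (i , c , ℕ.m<n⇒m<1+n i<j , x≐)) ]′ (used s x x∈D))
                        , (λ (c , x≐) → inj₂ (j , c , ℕ.≤-refl , x≐)) ]′ (Extension.only e x x∈) }
      where
      e : Extension (q s) (D s) N⁺ v⁺ (site k j)
      e = attach s inK⁺ isStr⁺ v⁺ v⁺∈ (λ i i′ → mk⇔ id id)

    stage : ∀ j → Stage j
    stage zero    = initial
    stage (suc j) = advance (stage j)

    -- `site∈D` is what makes the failure at block `k` permanent: conditions are extended as
    -- substructures, so a relation among points of the domain can no longer change.
    record Decided : Set₁ where
      field
        q D     : 𝕍
        inK     : K q
        isStr   : IsStr L D q
        D⊆X     : D ⊆ X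
        extends : IsSubstructure L p q
        run     : Run k k q
        site∈D  : VecAll.All (_∈ D) (site k k)

    decided : Decided
    decided = record
      { q = Extension.q e ; D = Extension.D′ e ; inK = Extension.inK e ; isStr = Extension.isStr e
      ; D⊆X = λ x x∈ → [ D⊆X s x , (λ (i , x≐) → ∈-respˡ (≐-sym x≐) (site∈X k k i)) ]′ (Extension.only e x x∈)
      ; extends = sub-trans (extends s) (Extension.extends e)
      ; run = (λ i i<k → sub-holds arity (Extension.extends e) (holds s i i<k))
            , λ h → ¬holds⁻ (to (Extension.realizes e R arity) h)
      ; site∈D = allExt (Extension.new e) }
      where
      s : Stage k
      s = stage k
      e : Extension (q s) (D s) N⁻ v⁻ (site k k)
      -- Sites repeat points by the pattern of `v⁺`; `same` allows `v⁻` to be placed there.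
      e = attach s inK⁻ isStr⁻ v⁻ v⁻∈ same

  -- A run decided by a condition survives in the union of the filter. Positive facts persist, and a
  -- fact of `M` contradicting the failure would hold in some condition of the filter, hence in a
  -- common extension of both, where it has been excluded.
  cohen⇒limsup : ∀ {M} → IsCohenGeneric V L X K M → ∀ N → ∃[ k ] N ℕ.≤ k × Run k k M
  cohen⇒limsup {M} (P , E , G , (VP , VE , P⇔ , E⇔) , (G⊆P , _ , _ , directed , generic) , U , I , M≐ , _ , I⇔) N =
    conclude (generic D DV D⊆P dense)
    where
    -- The failure is required of all stronger conditions, since R may fail in `q` merely because
    -- some argument is not yet in its domain.
    Forces : 𝕍 → 𝕍 → Set₁
    Forces q k = k ∈ ω × ¬ (k ∈ num N) × (∀ j → j ∈ k → At facts q k j) × (∀ s → s ∈ P → ⟨ s , q ⟩ ∈ E → ¬ At facts s k k)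
    abstract
      D-exists : ∃[ D ] V D × (∀ q → q ∈ D ⇔ (q ∈ P × (∃[ k ] Forces q k)))
      D-exists = sep (∃∈ᴰ v2 (¬ᴰ (v0 ∈ᴰ v2) ∧ᴰ ∀∈ᴰ v0 (atᴰ v7 v2 v1 v0) ∧ᴰ ∀∈ᴰ v4 (⟨ v0 , v2 ⟩∈ᴰ v6 ⇒ᴰ ¬ᴰ atᴰ v7 v0 v1 v1)))
        (numV N ∷ ωV ∷ VP ∷ VE ∷ factFam ∷ []) VP
    D : 𝕍
    D = proj₁ D-exists
    DV : V D
    DV = proj₁ (proj₂ D-exists)
    D⇔ : ∀ q → q ∈ D ⇔ (q ∈ P × (∃[ k ] Forces q k))
    D⇔ = proj₂ (proj₂ D-exists)
    D⊆P : D ⊆ P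
    D⊆P q q∈ = proj₁ (to (D⇔ q) q∈)
    PV : ∀ {q} → q ∈ P → V q
    PV = elemV VP

    E⁻ : ∀ {s q} → ⟨ s , q ⟩ ∈ E → ∃[ B ] IsStr L B q ×
      (∀ R {n} (v : Vec 𝕍 n) → Arity L R n → VecAll.All (_∈ B) v → Holds q R v ⇔ Holds s R v)
    E⁻ {s} {q} sq = case to (E⇔ ⟨ s , q ⟩) sq of λ (s′ , q′ , e , _ , _ , B , _ , strB , _ , _ , agree) →
      let s≐ = ⟨⟩-injˡ {s} {s′} {q} {q′} e ; q≐ = ⟨⟩-injʳ {s} {s′} {q} {q′} e in
      B , str-resp (≐-sym q≐) strB , λ R {n} v ar v∈ → mk⇔
        (λ h → holds-respˡ (≐-sym s≐) (to (agree R v ar v∈) (holds-respˡ q≐ h)))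
        (λ h → holds-respˡ (≐-sym q≐) (from (agree R v ar v∈) (holds-respˡ s≐ h)))

    dense : ∀ p → p ∈ P → ∃[ d ] d ∈ D × ⟨ d , p ⟩ ∈ E
    dense p p∈ = q , from (D⇔ q) (q∈P , num k , num-∈ω k , k∉N , positive , negative)
                   , from (E⇔ ⟨ q , p ⟩) (q , p , ≐-refl ⟨ q , p ⟩ , q∈P , p∈ , extends)
      where
      Kp : K p
      Kp = proj₁ (to (P⇔ p) p∈)
      A : 𝕍
      A = proj₁ (proj₂ (to (P⇔ p) p∈))
      strp : IsStr L A p
      strp = proj₁ (proj₂ (proj₂ (to (P⇔ p) p∈)))
      fin : ∃[ A ] IsStr L A p × Finite V A
      fin = structures p Kp
      avoid : ∃[ B ] (∀ k → B ℕ.≤ k → ∀ i → ¬ (grid (k , i) ∈ proj₁ fin))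
      avoid = avoids (proj₂ (proj₂ fin))
      k : ℕ
      -- Beyond `N`, and so large that the whole row misses the finite domain of `p`.
      k = N ℕ.⊔ proj₁ avoid
      free : ∀ i → ¬ (grid (k , i) ∈ A)
      free i x∈ = proj₂ avoid k (ℕ.m≤n⊔m N (proj₁ avoid)) i (∈-respʳ (carrier-unique strp (proj₁ (proj₂ fin))) x∈)
      open Decided (decided Kp strp (proj₂ (proj₂ (proj₂ (to (P⇔ p) p∈)))) k free) renaming (D to Dq)
      q∈P : q ∈ P
      q∈P = from (P⇔ q) (inK , Dq , isStr , D⊆X)
      k∉N : ¬ (num k ∈ num N)
      k∉N k∈N = ℕ.<⇒≱ (num-∈⁻ {k} {N} k∈N) (ℕ.m≤m⊔n N (proj₁ avoid))
      positive : ∀ j → j ∈ num k → At facts q (num k) j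
      positive j j∈ = let i , i<k , j≐ = ∈-num⁻ k j∈ in
        at-complete q {num k} {j} k i (PV q∈P) (≐-refl (num k)) j≐ (proj₁ run i i<k)
      negative : ∀ s → s ∈ P → ⟨ s , q ⟩ ∈ E → ¬ At facts s (num k) (num k)
      negative s s∈ sq at = case E⁻ {s} {q} sq of λ (B , strB , agree) →
        proj₂ run (from (agree R (site k k) arity (VecAll.map (∈-respʳ (carrier-unique isStr strB)) site∈D))
                        (at-sound s {num k} {num k} k k (≐-refl (num k)) (≐-refl (num k)) at))

    conclude : (∃[ q ] q ∈ D × q ∈ G) → ∃[ k ] N ℕ.≤ k × Run k k M
    conclude (q , q∈D , q∈G) = case to (D⇔ q) q∈D of λ { (_ , a , (k , a≐) , a∉N , pos , forbids) →
      k , ℕ.≮⇒≥ (λ k<N → a∉N (∈-respˡ {num k} {a} {num N} (≐-sym a≐) (num-∈ {k} {N} k<N)))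
        , positive k a a≐ pos , negative k a a≐ forbids }
      where
      positive : ∀ k a → a ≐ num k → (∀ j → j ∈ a → At facts q a j) → ∀ j → j ℕ.< k → Ev k j M
      positive k a a≐ pos j j<k = case at-sound q {a} {num j} k j a≐ (≐-refl (num j))
          (pos (num j) (∈-respʳ {num j} {num k} {a} (≐-sym a≐) (num-∈ {j} {k} j<k))) of λ (A , J , q≐ , s∈) →
        U , I , M≐ , from (I⇔ (fact (k , j))) (q , A , J , q∈G , q≐ , s∈)
      negative : ∀ k a → a ≐ num k → (∀ s → s ∈ P → ⟨ s , q ⟩ ∈ E → ¬ At facts s a a) → ¬ Ev k k M
      negative k a a≐ forbids ev =
        case to (I⇔ (fact (k , k))) (to (holds⇔ {M = M} {U} {I} {R} {site k k} M≐) ev) of λ (q′ , A , J , q′∈G , q′≐ , s∈) →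
        case directed q′ q q′∈G q∈G of λ (s , s∈G , sq′ , sq) →
        case E⁻ {s} {q′} sq′ of λ (B , strB , agree) →
          let h : Ev k k q′
              h = A , J , q′≐ , s∈
          in forbids s (G⊆P s s∈G) sq (at-complete s {a} {a} k k (PV (G⊆P s s∈G)) a≐ a≐
               (to (agree R (site k k) arity (holds⇒∈ strB h)) h))

-- Incompatibility of the two kinds of genericity.

cohen-random-disjoint : ExcludedMiddle (lsuc 0ℓ) → (V : Class) → IsTransitiveModel V → ∀ {κ X L} →
  V κ → IsOrdinal κ → Infinite V κ → V X → Infinite V X → V L → ∀ {M K ν} →
  IsStrongFraisse V L K → ¬ IsHighlyHomogeneous V L K → IsCohenGeneric V L X K M →
  IsInvariantMeasure V κ L X ν → ¬ IsRandomGeneric V κ L X ν M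
cohen-random-disjoint em V isModel {κ} {X} {L} Vκ ordinal infκ VX infX VL {M} {K} {ν} fraisse ¬hh cohen im random =
  Codes.random⇒¬limsup em V isModel Vκ VX infX VR arity (CohenRuns.index em V isModel VX infX fraisse sep′ VR)
    (ω⊆ordinal V isModel ordinal infκ) im random
    (CohenRuns.cohen⇒limsup em V isModel VX infX fraisse sep′ VR cohen)
  where
  open Classical em
  open Closure V isModel using (⟨⟩V⁻; elemV)
  sep′ : Separation L K
  sep′ = separation ¬hh
  open Separation sep′
  VR : V R
  VR = proj₁ (⟨⟩V⁻ (elemV VL arity))

corollary7p15 : ExcludedMiddle (lsuc 0ℓ) →
    (V : Class) → IsTransitiveModel V →
    (κ X L : 𝕍) →
    V κ → IsOrdinal κ → Infinite V κ →
    V X → Infinite V X →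
    V L → IsLanguage L →
    (M : 𝕍) →
    ((∃[ K ] IsStrongFraisse V L K × ¬ IsHighlyHomogeneous V L K × IsCohenGeneric V L X K M) →
    (ν : 𝕍) → IsInvariantMeasure V κ L X ν → ¬ IsRandomGeneric V κ L X ν M)
    × ((∃[ ν ] IsInvariantMeasure V κ L X ν × IsRandomGeneric V κ L X ν M) →
    (K : Class) → IsStrongFraisse V L K → ¬ IsHighlyHomogeneous V L K → ¬ IsCohenGeneric V L X K M)
corollary7p15 em V isModel κ X L Vκ ordinal infκ VX infX VL _ M =
  (λ (K , fraisse , ¬hh , cohen) ν im random → disjoint fraisse ¬hh cohen im random)
  , λ (ν , im , random) K fraisse ¬hh cohen → disjoint fraisse ¬hh cohen im random
  where
  disjoint : ∀ {K ν} → IsStrongFraisse V L K → ¬ IsHighlyHomogeneous V L K → IsCohenGeneric V L X K M →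
             IsInvariantMeasure V κ L X ν → ¬ IsRandomGeneric V κ L X ν M
  disjoint = cohen-random-disjoint em V isModel Vκ ordinal infκ VX infX VL
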